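{- Suppose $\alpha$ and $\beta$ are integers satisfying $0<\alpha<4\beta$. Let $q=e^{\pi i\tau}$ with $\operatorname{Im}\tau>0$, and let $x,y$ be nonzero complex numbers. Then \begin{align*} &\left(\sum_{m,n\in\mathbf Z}(-1)^{n}q^{\alpha(m+1/2)^2+\alpha(m+1/2)n+\beta n^2}x^{m+1/2}y^{n}\right)^2+\left(\sum_{m,n\in\mathbf Z}q^{\alpha m^2+\alpha mn+\beta n^2}x^my^n\right)^2\\ &=\left(\sum_{m,n\in\mathbf Z}(-1)^{n}q^{\alpha m^2+\alpha mn+\beta n^2}x^my^n\right)^2+\left(\sum_{m,n\in\mathbf Z}q^{\alpha(m+1/2)^2+\alpha(m+1/2)n+\beta n^2}x^{m+1/2}y^{n}\right)^2. \end{align*}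
   Context: Real powers of $q$ are $q^r=e^{\pi i r\tau}$. A square root $x^{1/2}$ is fixed once and for all, and $x^{m+1/2}=x^m x^{1/2}$ for integers $m$. -}

module Defs where

open import Level using (Level; suc; _⊔_)
open import Algebra.Bundles using (CommutativeRing; RawRing)
open import Algebra.Core using (Op₁; Op₂)
open import Algebra.Structures using (IsCommutativeRing)
import Algebra.Definitions.RawMonoid as RawMonoidDefs
import Algebra.Definitions.RawSemiring as RawSemiringDefs
import Algebra.Properties.Ring as RingProperties
open import Data.Empty using (⊥-elim)
open import Data.Integer.Base as ℤ using (ℤ; +_; -[1+_])
open import Data.List.Base using (List; foldr; map)
open import Data.List.Relation.Binary.Subset.Propositional using (_⊆_)
open import Data.List.Relation.Unary.Unique.Propositional using (Unique)
open import Data.Nat.Base as ℕ using (ℕ; zero; z≤n; s≤s)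
import Data.Nat.Properties as ℕₚ
open import Data.Product.Base using (∃; _×_; _,_; proj₁; proj₂)
open import Data.Sum.Base using (_⊎_; inj₁; inj₂)
open import Relation.Binary.Core using (Rel)
open import Relation.Binary.Definitions using (Cotransitive)
open import Relation.Binary.Lattice.Definitions using (Supremum)
open import Relation.Binary.PropositionalEquality.Core using (_≡_; refl; subst)
open import Relation.Binary.Structures using (IsStrictPartialOrder)
open import Relation.Nullary.Negation.Core using (¬_)

-- The real numbers are axiomatised as a Cauchy complete Archimedean ordered
-- field, the order axioms being the constructive ones.  Every such field is
-- ℝ up to isomorphism classically, and the Bishop reals also satisfy them.

record OrderedField c ℓ₁ ℓ₂ : Set (suc (c ⊔ ℓ₁ ⊔ ℓ₂)) where
  infix  8 -_
  infixl 7 _*_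
  infixl 6 _+_ _∨_
  infix  4 _≈_ _<_ _≤_
  field
    Carrier              : Set c
    _≈_                  : Rel Carrier ℓ₁
    _<_                  : Rel Carrier ℓ₂
    _+_ _*_ _∨_          : Op₂ Carrier
    -_                   : Op₁ Carrier
    0# 1#                : Carrier
    isCommutativeRing    : IsCommutativeRing _≈_ _+_ _*_ -_ 0# 1#
    isStrictPartialOrder : IsStrictPartialOrder _≈_ _<_
    <-cotrans            : Cotransitive _<_
    <-tight              : ∀ {x y} → ¬ (x < y) → ¬ (y < x) → x ≈ y

  _≤_ : Rel Carrier ℓ₂
  x ≤ y = ¬ (y < x)

  field
    ∨-supremum           : Supremum _≤_ _∨_
    0<1                  : 0# < 1#
    +-monoˡ-<            : ∀ z {x y} → x < y → x + z < y + z
    *-pos                : ∀ {x y} → 0# < x → 0# < y → 0# < x * y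
    recip                : ∀ x → 0# < x → Carrier
    recip-inverse        : ∀ x (0<x : 0# < x) → x * recip x 0<x ≈ 1#
    0<recip              : ∀ x (0<x : 0# < x) → 0# < recip x 0<x

  commutativeRing : CommutativeRing c ℓ₁
  commutativeRing = record { isCommutativeRing = isCommutativeRing }

  open CommutativeRing commutativeRing public
    using (rawRing; ring; setoid; _-_)

  fromℕ : ℕ → Carrier
  fromℕ n = RawMonoidDefs._×_ (RawRing.+-rawMonoid rawRing) n 1#

  ∣_∣ : Carrier → Carrier
  ∣ x ∣ = x ∨ - x

  Cauchy : (ℕ → Carrier) → Set (c ⊔ ℓ₂)
  Cauchy f = ∀ ε → 0# < ε → ∃ λ N → ∀ m n → N ℕ.≤ m → N ℕ.≤ n → ∣ f m - f n ∣ < ε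

  Converges : (ℕ → Carrier) → Carrier → Set (c ⊔ ℓ₂)
  Converges f l = ∀ ε → 0# < ε → ∃ λ N → ∀ n → N ℕ.≤ n → ∣ f n - l ∣ < ε

record RealField c ℓ₁ ℓ₂ : Set (suc (c ⊔ ℓ₁ ⊔ ℓ₂)) where
  field
    orderedField : OrderedField c ℓ₁ ℓ₂

  open OrderedField orderedField public

  field
    archimedean : ∀ x → ∃ λ n → x < fromℕ n
    complete    : ∀ f → Cauchy f → ∃ λ l → Converges f l

module Real {c ℓ₁ ℓ₂} (R : RealField c ℓ₁ ℓ₂) where
  open RealField R public
  open CommutativeRing commutativeRing public
    using ( +-cong; +-congˡ; +-congʳ; +-comm; +-assoc; +-identityˡ; +-identityʳ
          ; -‿cong; -‿inverseˡ; -‿inverseʳ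
          ; *-cong; *-congˡ; *-congʳ; *-comm; *-assoc; *-identityˡ; *-identityʳ
          ; distribˡ; distribʳ; zeroˡ; zeroʳ )
    renaming (refl to ≈-refl; sym to ≈-sym; trans to ≈-trans)
  open IsStrictPartialOrder isStrictPartialOrder public
    using (<-resp-≈) renaming (trans to <-trans; irrefl to <-irrefl)

  partialSum : (ℕ → Carrier) → ℕ → Carrier
  partialSum t zero      = 0#
  partialSum t (ℕ.suc n) = partialSum t n + t n

  fromℤ : ℤ → Carrier
  fromℤ (+ n)    = fromℕ n
  fromℤ -[1+ n ] = - fromℕ (ℕ.suc n)

  <-respˡ : ∀ {x x′ y} → x ≈ x′ → x < y → x′ < y
  <-respˡ = proj₂ <-resp-≈

  <-respʳ : ∀ {x y y′} → y ≈ y′ → x < y → x < y′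
  <-respʳ = proj₁ <-resp-≈

  ≤-reflexive : ∀ {x y} → x ≈ y → x ≤ y
  ≤-reflexive x≈y y<x = <-irrefl (≈-sym x≈y) y<x

  ≤-refl : ∀ {x} → x ≤ x
  ≤-refl = ≤-reflexive ≈-refl

  <⇒≤ : ∀ {x y} → x < y → x ≤ y
  <⇒≤ x<y y<x = <-irrefl ≈-refl (<-trans x<y y<x)

  ≤-<-trans : ∀ {x y z} → x ≤ y → y < z → x < z
  ≤-<-trans {x} x≤y y<z with <-cotrans y<z x
  ... | inj₁ y<x = ⊥-elim (x≤y y<x)
  ... | inj₂ x<z = x<z

  <-≤-trans : ∀ {x y z} → x < y → y ≤ z → x < z
  <-≤-trans {z = z} x<y y≤z with <-cotrans x<y z
  ... | inj₁ x<z = x<z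
  ... | inj₂ z<y = ⊥-elim (y≤z z<y)

  ≤-trans : ∀ {x y z} → x ≤ y → y ≤ z → x ≤ z
  ≤-trans x≤y y≤z z<x = x≤y (≤-<-trans y≤z z<x)

  ≤-resp : ∀ {x x′ y y′} → x ≈ x′ → y ≈ y′ → x ≤ y → x′ ≤ y′
  ≤-resp x≈x′ y≈y′ x≤y y′<x′ = x≤y (<-respˡ (≈-sym y≈y′) (<-respʳ (≈-sym x≈x′) y′<x′))

  private
    module RP = RingProperties ring

    x+z-z : ∀ x z → (x + z) + - z ≈ x
    x+z-z x z = ≈-trans (+-assoc _ _ _) (≈-trans (+-congˡ (-‿inverseʳ z)) (+-identityʳ x))

    x-z+z : ∀ x z → (x + - z) + z ≈ x
    x-z+z x z = ≈-trans (+-assoc _ _ _) (≈-trans (+-congˡ (-‿inverseˡ z)) (+-identityʳ x))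

  +-cancelʳ-< : ∀ z {x y} → x + z < y + z → x < y
  +-cancelʳ-< z p = <-respˡ (x+z-z _ z) (<-respʳ (x+z-z _ z) (+-monoˡ-< (- z) p))

  +-monoˡ-≤ : ∀ z {x y} → x ≤ y → x + z ≤ y + z
  +-monoˡ-≤ z x≤y p = x≤y (+-cancelʳ-< z p)

  +-mono-≤ : ∀ {x y u v} → x ≤ y → u ≤ v → x + u ≤ y + v
  +-mono-≤ {y = y} {u = u} x≤y u≤v =
    ≤-trans (+-monoˡ-≤ u x≤y) (≤-resp (+-comm _ _) (+-comm _ _) (+-monoˡ-≤ y u≤v))

  neg-mono-≤ : ∀ {x y} → x ≤ y → - y ≤ - x
  neg-mono-≤ {x} {y} x≤y -x<-y = x≤y
    (<-respˡ (≈-trans (+-congˡ (+-comm x y)) (≈-trans (+-comm _ _) (x+z-z y x)))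
    (<-respʳ (≈-trans (+-comm _ _) (x+z-z x y)) (+-monoˡ-< (x + y) -x<-y)))

  *-monoˡ-< : ∀ c → 0# < c → ∀ {x y} → x < y → c * x < c * y
  *-monoˡ-< c 0<c {x} {y} x<y =
    <-respˡ (+-identityˡ _)
    (<-respʳ (≈-trans (+-congʳ (RP.x[y-z]≈xy-xz c y x)) (x-z+z _ _))
    (+-monoˡ-< (c * x) (*-pos 0<c (<-respˡ (-‿inverseʳ x) (+-monoˡ-< (- x) x<y)))))

  *-monoˡ-≤ : ∀ c → 0# ≤ c → ∀ {x y} → x ≤ y → c * x ≤ c * y
  *-monoˡ-≤ c 0≤c {x} {y} x≤y cy<cx = ¬0<c λ 0<c →
    <-irrefl (*-congˡ (<-tight x≤y (λ x<y → <⇒≤ (*-monoˡ-< c 0<c x<y) cy<cx))) cy<cx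
    where
    ¬0<c : ¬ ¬ (0# < c)
    ¬0<c ¬p = <-irrefl (≈-trans (*-congʳ c≈0) (≈-trans (≈-trans (zeroˡ y) (≈-sym (zeroˡ x)))
                        (*-congʳ (≈-sym c≈0)))) cy<cx
      where c≈0 = ≈-sym (<-tight ¬p 0≤c)

  *-monoʳ-≤ : ∀ c → 0# ≤ c → ∀ {x y} → x ≤ y → x * c ≤ y * c
  *-monoʳ-≤ c 0≤c x≤y = ≤-resp (*-comm _ _) (*-comm _ _) (*-monoˡ-≤ c 0≤c x≤y)

  *-nonneg : ∀ {x y} → 0# ≤ x → 0# ≤ y → 0# ≤ x * y
  *-nonneg {x} 0≤x 0≤y = ≤-resp (zeroʳ x) ≈-refl (*-monoˡ-≤ x 0≤x 0≤y)

  +-nonneg : ∀ {x y} → 0# ≤ x → 0# ≤ y → 0# ≤ x + y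
  +-nonneg p q = ≤-resp (+-identityˡ 0#) ≈-refl (+-mono-≤ p q)

  0≤fromℕ : ∀ n → 0# ≤ fromℕ n
  0≤fromℕ zero      = ≤-refl
  0≤fromℕ (ℕ.suc n) = +-nonneg (<⇒≤ 0<1) (0≤fromℕ n)

  0<fromℕ-suc : ∀ n → 0# < fromℕ (ℕ.suc n)
  0<fromℕ-suc n = <-≤-trans 0<1
    (≤-resp (+-identityʳ 1#) ≈-refl (+-mono-≤ ≤-refl (0≤fromℕ n)))

  fromℕ-mono-≤ : ∀ {m n} → m ℕ.≤ n → fromℕ m ≤ fromℕ n
  fromℕ-mono-≤ {n = n} z≤n = 0≤fromℕ n
  fromℕ-mono-≤ (s≤s p)     = +-mono-≤ ≤-refl (fromℕ-mono-≤ p)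


  1/suc : ℕ → Carrier
  1/suc n = recip (fromℕ (ℕ.suc n)) (0<fromℕ-suc n)

  0≤1/suc : ∀ n → 0# ≤ 1/suc n
  0≤1/suc n = <⇒≤ (0<recip _ _)

  x≤∣x∣ : ∀ x → x ≤ ∣ x ∣
  x≤∣x∣ x = proj₁ (∨-supremum x (- x))

  -x≤∣x∣ : ∀ x → - x ≤ ∣ x ∣
  -x≤∣x∣ x = proj₁ (proj₂ (∨-supremum x (- x)))

  -- | x | ≤ b
  Bounded : Carrier → Carrier → Set ℓ₂
  Bounded b x = x ≤ b × - x ≤ b

  private
    neg≤⇒ : ∀ {x b} → - x ≤ b → - b ≤ x
    neg≤⇒ p = ≤-resp ≈-refl (RP.-‿involutive _) (neg-mono-≤ p)

  ∣∣-least : ∀ {x b} → Bounded b x → ∣ x ∣ ≤ b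
  ∣∣-least {x} {b} (p , q) = proj₂ (proj₂ (∨-supremum x (- x))) b p q

  Bounded-∣∣ : ∀ x → Bounded ∣ x ∣ x
  Bounded-∣∣ x = x≤∣x∣ x , -x≤∣x∣ x

  Bounded-≤ : ∀ {b b′ x} → b ≤ b′ → Bounded b x → Bounded b′ x
  Bounded-≤ b≤b′ (p , q) = ≤-trans p b≤b′ , ≤-trans q b≤b′

  Bounded-nonneg : ∀ {b x} → Bounded b x → 0# ≤ b
  Bounded-nonneg {b} {x} (p , q) b<0 = <-irrefl ≈-refl (≤-<-trans 0≤b+b b+b<0)
    where
    0≤b+b : 0# ≤ b + b
    0≤b+b = ≤-resp (-‿inverseʳ x) ≈-refl (+-mono-≤ p q)
    b+b<0 : b + b < 0#
    b+b<0 = <-trans (<-respʳ (+-identityˡ b) (+-monoˡ-< b b<0)) b<0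

  Bounded-neg : ∀ {b x} → Bounded b x → Bounded b (- x)
  Bounded-neg (p , q) = q , ≤-resp (≈-sym (RP.-‿involutive _)) ≈-refl p

  Bounded-+ : ∀ {b b′ x x′} → Bounded b x → Bounded b′ x′ → Bounded (b + b′) (x + x′)
  Bounded-+ (p , q) (p′ , q′) =
    +-mono-≤ p p′ , ≤-resp (RP.-‿+-comm _ _) ≈-refl (+-mono-≤ q q′)

  private
    *-upper : ∀ {b b′ x x′} → Bounded b x → Bounded b′ x′ → x * x′ ≤ b * b′
    *-upper {b} {b′} {x} {x′} Bx@(p , q) Bx′@(p′ , q′) bb′<xx′ =
      case-neg λ x′<0 → ≤-trans
        (≤-resp (≈-trans (≈-sym (RP.-‿distribˡ-* x (- x′)))
                   (≈-trans (-‿cong (≈-sym (RP.-‿distribʳ-* x x′))) (RP.-‿involutive _)))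
                ≈-refl
                (*-monoʳ-≤ (- x′) (≤-resp RP.-0#≈0# ≈-refl (neg-mono-≤ (<⇒≤ x′<0))) q))
        (*-monoˡ-≤ b 0≤b q′) bb′<xx′
      where
      0≤b = Bounded-nonneg Bx
      case-neg : ¬ ¬ (x′ < 0#)
      case-neg 0≤x′ = ≤-trans (*-monoʳ-≤ x′ 0≤x′ p) (*-monoˡ-≤ b 0≤b p′) bb′<xx′

  Bounded-* : ∀ {b b′ x x′} → Bounded b x → Bounded b′ x′ → Bounded (b * b′) (x * x′)
  Bounded-* Bx Bx′ = *-upper Bx Bx′ ,
    ≤-resp (≈-sym (RP.-‿distribˡ-* _ _)) ≈-refl (*-upper (Bounded-neg Bx) Bx′)

  Bounded-self : ∀ {x} → 0# ≤ x → Bounded x x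
  Bounded-self 0≤x = ≤-refl , ≤-trans (≤-resp ≈-refl RP.-0#≈0# (neg-mono-≤ 0≤x)) 0≤x

  -- A series whose terms are dominated by b, where b at least halves at each
  -- step from N on, is Cauchy: from N on, partial sums plus 2 b decrease and
  -- partial sums minus 2 b increase.
  module Dominated
    (t b : ℕ → Carrier) (t-bounded : ∀ k → Bounded (b k) (t k))
    (N : ℕ) (halving : ∀ k → N ℕ.≤ k → b (ℕ.suc k) + b (ℕ.suc k) ≤ b k)
    where

    private
      S : ℕ → Carrier
      S = partialSum t

      0≤b : ∀ k → 0# ≤ b k
      0≤b k = Bounded-nonneg (t-bounded k)

      d : ℕ → Carrier
      d k = b k + b k

      tail : ∀ n j → N ℕ.≤ n → Bounded (d n) ((S (j ℕ.+ n) - S n)) ×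
                                (S (j ℕ.+ n) - S n) + d (j ℕ.+ n) ≤ d n ×
                                - (S (j ℕ.+ n) - S n) + d (j ℕ.+ n) ≤ d n
      tail n j N≤n = (drop (proj₁ (go j)) , drop (proj₂ (go j))) , go j
        where
        drop : ∀ {x} → x + d (j ℕ.+ n) ≤ d n → x ≤ d n
        drop p = ≤-trans
          (≤-resp (+-identityʳ _) ≈-refl (+-mono-≤ ≤-refl (+-nonneg (0≤b _) (0≤b _)))) p
        step : ∀ {u v s k} → N ℕ.≤ k → s + d k ≤ d n → v ≤ b k → u ≈ s + v →
               u + d (ℕ.suc k) ≤ d n
        step N≤k ih v≤b u≈ = ≤-trans
          (≤-resp (≈-trans (≈-sym (+-assoc _ _ _)) (+-congʳ (≈-sym u≈))) ≈-refl
            (+-mono-≤ ≤-refl (+-mono-≤ v≤b (halving _ N≤k)))) ih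
        eq : ∀ x y z → (x + y) - z ≈ (x - z) + y
        eq x y z = ≈-trans (+-assoc _ _ _)
                   (≈-trans (+-congˡ (+-comm _ _)) (≈-sym (+-assoc _ _ _)))
        go : ∀ j → (S (j ℕ.+ n) - S n) + d (j ℕ.+ n) ≤ d n ×
                   - (S (j ℕ.+ n) - S n) + d (j ℕ.+ n) ≤ d n
        go zero = ≤-reflexive (≈-trans (+-congʳ (-‿inverseʳ _)) (+-identityˡ _))
                , ≤-reflexive (≈-trans (+-congʳ (≈-trans (-‿cong (-‿inverseʳ _)) RP.-0#≈0#))
                                       (+-identityˡ _))
        go (ℕ.suc j) with go j | ℕₚ.≤-trans N≤n (ℕₚ.m≤n+m n j) | t-bounded (j ℕ.+ n)
        ... | p , q | N≤k | tu , tl =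
          step N≤k p tu (eq _ _ _) ,
          step N≤k q tl (≈-trans (-‿cong (eq _ _ _)) (≈-sym (RP.-‿+-comm _ _)))

      decay : ∀ j → fromℕ (ℕ.suc j) * b (j ℕ.+ N) ≤ b N
      decay zero = ≤-reflexive (≈-trans (*-congʳ (+-identityʳ 1#)) (*-identityˡ _))
      decay (ℕ.suc j) = ≤-trans (≤-trans two (*-monoˡ-≤ _ (0≤fromℕ (ℕ.suc j))
                                  (halving _ (ℕₚ.m≤n+m N j)))) (decay j)
        where
        x = fromℕ (ℕ.suc j)
        y = b (ℕ.suc (j ℕ.+ N))
        two : (1# + x) * y ≤ x * (y + y)
        two = ≤-resp (≈-sym (distribʳ _ _ _)) (≈-sym (distribˡ _ _ _))
          (+-monoˡ-≤ (x * y) (*-monoʳ-≤ y (0≤b _)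
            (≤-resp (+-identityʳ 1#) ≈-refl (+-mono-≤ ≤-refl (0≤fromℕ j)))))

      small : ∀ ε → 0# < ε → ∃ λ j → d (j ℕ.+ N) + d (j ℕ.+ N) < ε
      small ε 0<ε = small′ (archimedean (D * r))
        where
        four : Carrier → Carrier
        four x = (x + x) + (x + x)
        D = four (b N)
        r = recip ε 0<ε
        small′ : (∃ λ j → D * r < fromℕ j) → ∃ λ j → d (j ℕ.+ N) + d (j ℕ.+ N) < ε
        small′ (j , Dr<j) = j , claim
          where
          J = fromℕ (ℕ.suc j)
          β = b (j ℕ.+ N)
          i = 1/suc j
          D<εJ : D < ε * J
          D<εJ = <-respˡ
            (≈-trans (*-comm _ _) (≈-trans (*-assoc _ _ _)
              (≈-trans (*-congˡ (≈-trans (*-comm _ _) (recip-inverse ε 0<ε))) (*-identityʳ D))))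
            (*-monoˡ-< ε 0<ε (<-≤-trans Dr<j (fromℕ-mono-≤ (ℕₚ.n≤1+n j))))
          J4β≤D : J * four β ≤ D
          J4β≤D = ≤-resp (≈-sym (≈-trans (distribˡ _ _ _) (+-cong (distribˡ _ _ _) (distribˡ _ _ _))))
            ≈-refl (+-mono-≤ (+-mono-≤ (decay j) (decay j)) (+-mono-≤ (decay j) (decay j)))
          unJ : ∀ x → i * (J * x) ≈ x
          unJ x = ≈-trans (≈-sym (*-assoc _ _ _)) (≈-trans (*-congʳ
            (≈-trans (*-comm _ _) (recip-inverse J (0<fromℕ-suc j)))) (*-identityˡ x))
          claim : four β < ε
          claim = <-respˡ (unJ _) (<-respʳ (≈-trans (*-congˡ (*-comm _ _)) (unJ _))
            (*-monoˡ-< i (0<recip _ _) (≤-<-trans J4β≤D D<εJ)))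

    cauchy : Cauchy S
    cauchy ε 0<ε = cauchy′ (small ε 0<ε)
      where
      cauchy′ : (∃ λ j → d (j ℕ.+ N) + d (j ℕ.+ N) < ε) →
                ∃ λ K → ∀ m n → K ℕ.≤ m → K ℕ.≤ n → ∣ S m - S n ∣ < ε
      cauchy′ (j , 2d<ε) = K , λ m n K≤m K≤n → ≤-<-trans
        (∣∣-least (resp {m} {n} (Bounded-+ (near m K≤m) (Bounded-neg (near n K≤n))))) 2d<ε
        where
        K = j ℕ.+ N
        near : ∀ m → K ℕ.≤ m → Bounded (d K) (S m - S K)
        near m K≤m = subst-near (ℕₚ.m∸n+n≡m K≤m)
          where
          subst-near : (m ℕ.∸ K) ℕ.+ K ≡ m → Bounded (d K) (S m - S K)
          subst-near e = subst (λ z → Bounded (d K) (S z - S K)) e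
            (proj₁ (tail K (m ℕ.∸ K) (ℕₚ.m≤n+m N j)))
        telescope : ∀ x y z → (x - z) + - (y - z) ≈ x - y
        telescope x y z = ≈-trans (+-congˡ (RP.⁻¹-anti-homo‿- y z))
          (≈-trans (≈-sym (+-assoc _ _ _)) (+-congʳ (x-z+z x z)))
        resp : ∀ {m n} → Bounded (d K + d K) ((S m - S K) + - (S n - S K)) →
               Bounded (d K + d K) (S m - S n)
        resp (p , q) = ≤-resp (telescope _ _ _) ≈-refl p
                     , ≤-resp (-‿cong (telescope _ _ _)) ≈-refl q

    seriesSum : Carrier
    seriesSum = proj₁ (complete S cauchy)

    seriesSum-converges : Converges (partialSum t) seriesSum
    seriesSum-converges = proj₂ (complete S cauchy)

  -- Euler's series  π / 2 = Σ k! / (1 · 3 ⋯ (2 k + 1))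
  --                       = 1 + 1/3 + (1 · 2)/(3 · 5) + ⋯
  eulerTerm : ℕ → Carrier
  eulerTerm zero      = 1#
  eulerTerm (ℕ.suc k) = eulerTerm k * (fromℕ (ℕ.suc k) * 1/suc (2 ℕ.+ (k ℕ.+ k)))

  private
    fromℕ-+ : ∀ m n → fromℕ (m ℕ.+ n) ≈ fromℕ m + fromℕ n
    fromℕ-+ zero n      = ≈-sym (+-identityˡ _)
    fromℕ-+ (ℕ.suc m) n = ≈-trans (+-congˡ (fromℕ-+ m n)) (≈-sym (+-assoc _ _ _))

    0≤eulerTerm : ∀ k → 0# ≤ eulerTerm k
    0≤eulerTerm zero      = <⇒≤ 0<1
    0≤eulerTerm (ℕ.suc k) = *-nonneg (0≤eulerTerm k)
      (*-nonneg (0≤fromℕ (ℕ.suc k)) (0≤1/suc (2 ℕ.+ (k ℕ.+ k))))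

    euler-halving : ∀ k → 0 ℕ.≤ k → eulerTerm (ℕ.suc k) + eulerTerm (ℕ.suc k) ≤ eulerTerm k
    euler-halving k _ = ≤-resp
      (≈-trans (*-congˡ (distribʳ _ _ _)) (distribˡ _ _ _)) (*-identityʳ _)
      (*-monoˡ-≤ (eulerTerm k) (0≤eulerTerm k) ratio)
      where
      ratio : (fromℕ (ℕ.suc k) + fromℕ (ℕ.suc k)) * 1/suc (2 ℕ.+ (k ℕ.+ k)) ≤ 1#
      ratio = ≤-resp ≈-refl
        (recip-inverse (fromℕ (3 ℕ.+ (k ℕ.+ k))) (0<fromℕ-suc (2 ℕ.+ (k ℕ.+ k))))
        (*-monoʳ-≤ _ (0≤1/suc (2 ℕ.+ (k ℕ.+ k)))
        (≤-resp (fromℕ-+ (ℕ.suc k) (ℕ.suc k)) ≈-refl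
          (fromℕ-mono-≤ {n = 3 ℕ.+ (k ℕ.+ k)} (≤-via (ℕₚ.+-suc (ℕ.suc k) k)))))
        where
        ≤-via : ∀ {m} → m ≡ 2 ℕ.+ (k ℕ.+ k) → m ℕ.≤ 3 ℕ.+ (k ℕ.+ k)
        ≤-via refl = ℕₚ.n≤1+n _

    module Euler = Dominated eulerTerm eulerTerm
      (λ k → Bounded-self (0≤eulerTerm k)) 0 euler-halving

  π : Carrier
  π = Euler.seriesSum + Euler.seriesSum

  infix 5 _+i_
  record ℂ : Set c where
    constructor _+i_
    field
      re im : Carrier
  open ℂ public

  infix  4 _≈ᶜ_
  infixl 6 _+ᶜ_ _-ᶜ_
  infixl 7 _*ᶜ_
  infix  8 -ᶜ_

  _≈ᶜ_ : Rel ℂ ℓ₁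
  z ≈ᶜ w = re z ≈ re w × im z ≈ im w

  _+ᶜ_ _-ᶜ_ _*ᶜ_ : Op₂ ℂ
  z +ᶜ w = (re z + re w) +i (im z + im w)
  z -ᶜ w = (re z - re w) +i (im z - im w)
  z *ᶜ w = (re z * re w - im z * im w) +i (re z * im w + im z * re w)

  -ᶜ_ : Op₁ ℂ
  -ᶜ z = (- re z) +i (- im z)

  fromℝ : Carrier → ℂ
  fromℝ x = x +i 0#

  0ᶜ 1ᶜ 𝕚 : ℂ
  0ᶜ = fromℝ 0#
  1ᶜ = fromℝ 1#
  𝕚  = 0# +i 1#

  ℂ-rawRing : RawRing c ℓ₁
  ℂ-rawRing = record
    { Carrier = ℂ ; _≈_ = _≈ᶜ_ ; _+_ = _+ᶜ_ ; _*_ = _*ᶜ_ ; -_ = -ᶜ_ ; 0# = 0ᶜ ; 1# = 1ᶜ }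

  open RawSemiringDefs (RawRing.rawSemiring ℂ-rawRing) public using (_^_)

  ∣_∣² : ℂ → Carrier
  ∣ z ∣² = re z * re z + im z * im z

  -- The constructive form of z ≠ 0.
  NonZero : ℂ → Set ℓ₂
  NonZero z = 0# < ∣ z ∣²

  inverse : ∀ z → NonZero z → ℂ
  inverse z z≢0 = (re z * r) +i (- im z * r)
    where r = recip ∣ z ∣² z≢0

  zpow : ∀ z → NonZero z → ℤ → ℂ
  zpow z z≢0 (+ n)    = z ^ n
  zpow z z≢0 -[1+ n ] = inverse z z≢0 ^ ℕ.suc n

  -- (-1)ⁿ
  sgn : ℤ → ℂ
  sgn n = (-ᶜ 1ᶜ) ^ ℤ.∣ n ∣

  -- z ^ k / k !
  expTerm : ℂ → ℕ → ℂ
  expTerm z zero      = 1ᶜ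
  expTerm z (ℕ.suc k) = expTerm z k *ᶜ z *ᶜ fromℝ (1/suc k)

  module _ (z : ℂ) where
    private
      M = ∣ re z ∣ ∨ ∣ im z ∣

      bound : ℕ → Carrier
      bound zero      = 1#
      bound (ℕ.suc k) = bound k * (M + M) * 1/suc k

      re≤M : Bounded M (re z)
      re≤M = Bounded-≤ (proj₁ (∨-supremum _ _)) (Bounded-∣∣ (re z))

      im≤M : Bounded M (im z)
      im≤M = Bounded-≤ (proj₁ (proj₂ (∨-supremum _ _))) (Bounded-∣∣ (im z))

      0≤M+M : 0# ≤ M + M
      0≤M+M = +-nonneg (Bounded-nonneg re≤M) (Bounded-nonneg re≤M)

      0≤bound : ∀ k → 0# ≤ bound k
      0≤bound zero      = <⇒≤ 0<1
      0≤bound (ℕ.suc k) = *-nonneg (*-nonneg (0≤bound k) 0≤M+M) (0≤1/suc k)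

      Bounded-resp : ∀ {b b′ x x′} → b ≈ b′ → x ≈ x′ → Bounded b x → Bounded b′ x′
      Bounded-resp e e′ (p , q) = ≤-resp e′ e p , ≤-resp (-‿cong e′) e q

      scale-re : ∀ (w : ℂ) r → re w * r ≈ re (w *ᶜ fromℝ r)
      scale-re w r = ≈-sym (≈-trans (+-congˡ (≈-trans (-‿cong (zeroʳ _)) RP.-0#≈0#)) (+-identityʳ _))

      scale-im : ∀ (w : ℂ) r → im w * r ≈ im (w *ᶜ fromℝ r)
      scale-im w r = ≈-sym (≈-trans (+-congʳ (zeroʳ _)) (+-identityˡ _))

      terms-bounded : ∀ k → Bounded (bound k) (re (expTerm z k)) × Bounded (bound k) (im (expTerm z k))
      terms-bounded zero =
        Bounded-self (<⇒≤ 0<1) , Bounded-≤ (<⇒≤ 0<1) (Bounded-self ≤-refl)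
      terms-bounded (ℕ.suc k) with terms-bounded k
      ... | Br , Bi =
        Bounded-resp ≈-refl (scale-re (expTerm z k *ᶜ z) _)
          (Bounded-* (Bounded-resp (≈-sym (distribˡ _ _ _)) ≈-refl
            (Bounded-+ (Bounded-* Br re≤M) (Bounded-neg (Bounded-* Bi im≤M)))) inv) ,
        Bounded-resp ≈-refl (scale-im (expTerm z k *ᶜ z) _)
          (Bounded-* (Bounded-resp (≈-sym (distribˡ _ _ _)) ≈-refl
            (Bounded-+ (Bounded-* Br im≤M) (Bounded-* Bi re≤M))) inv)
        where
        inv = Bounded-self (0≤1/suc k)

      N : ℕ
      N = proj₁ (archimedean ((M + M) + (M + M)))

      bound-halving : ∀ k → N ℕ.≤ k → bound (ℕ.suc k) + bound (ℕ.suc k) ≤ bound k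
      bound-halving k N≤k = ≤-resp
        (≈-trans (*-congʳ (distribˡ _ _ _)) (distribʳ _ _ _))
        (≈-trans (*-assoc _ _ _) (≈-trans (*-congˡ (recip-inverse _ _)) (*-identityʳ _)))
        (*-monoʳ-≤ _ (0≤1/suc k) (*-monoˡ-≤ (bound k) (0≤bound k)
          (≤-trans (<⇒≤ (proj₂ (archimedean _)))
            (fromℕ-mono-≤ (ℕₚ.≤-trans N≤k (ℕₚ.n≤1+n k))))))

      module Re = Dominated (λ k → re (expTerm z k)) bound
        (λ k → proj₁ (terms-bounded k)) N bound-halving
      module Im = Dominated (λ k → im (expTerm z k)) bound
        (λ k → proj₂ (terms-bounded k)) N bound-halving

    exp : ℂ
    exp = Re.seriesSum +i Im.seriesSum

    re-exp-converges : Converges (partialSum (λ k → re (expTerm z k))) (re exp)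
    re-exp-converges = Re.seriesSum-converges

    im-exp-converges : Converges (partialSum (λ k → im (expTerm z k))) (im exp)
    im-exp-converges = Im.seriesSum-converges

  Σᶜ : ∀ {a} {I : Set a} → (I → ℂ) → List I → ℂ
  Σᶜ f F = foldr _+ᶜ_ 0ᶜ (map f F)

  -- Unconditional summation: the net of sums over finite subsets of the index
  -- set converges (in ℂ, equivalently, the family is absolutely summable).
  -- The inequality ∣ z ∣² < ε² says ∣ z ∣ < ε.
  HasSum : ∀ {a} {I : Set a} → (I → ℂ) → ℂ → Set (a ⊔ c ⊔ ℓ₂)
  HasSum {I = I} f s = ∀ ε → 0# < ε → ∃ λ (F₀ : List I) →
    ∀ F → Unique F → F₀ ⊆ F → ∣ Σᶜ f F -ᶜ s ∣² < ε * ε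

  ½ : Carrier
  ½ = 1/suc 1

  -- qʳ = exp (π i r τ)
  qpow : ℂ → Carrier → ℂ
  qpow τ r = exp (fromℝ π *ᶜ 𝕚 *ᶜ fromℝ r *ᶜ τ)

  quad : ℤ → ℤ → Carrier → Carrier → Carrier
  quad α β u v = fromℤ α * (u * u) + fromℤ α * u * v + fromℤ β * (v * v)

-- Completing the square, α m² + α m n + β n² = α u² + (4 β - α) v² for
-- u = m + n/2 and v = n/2, and x ^ m y ^ n = x ^ u (x ^ -1 y²) ^ v.  Each of the
-- four double series therefore splits, by the parity of n, into products of
-- one-variable series A₀, A₁ in u and B₀, B₁ in v, where the index tells whether
-- the variable runs through ℤ or ℤ + 1/2:
--
--   S₁ = A₁ B₀ - A₀ B₁,  S₂ = A₀ B₀ + A₁ B₁,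
--   S₃ = A₀ B₀ - A₁ B₁,  S₄ = A₁ B₀ + A₀ B₁,
--
-- and S₁² + S₂² = S₃² + S₄² is an identity of polynomials.

module Submission where

open import Defs
open import Data.Integer.Base using (ℤ; +_) renaming (_<_ to _<ᶻ_; _*_ to _*ᶻ_)
open import Data.Product.Base using (∃-syntax; _×_; _,_)

open import Algebra.Bundles using (CommutativeRing)
import Algebra.Properties.AbelianGroup as AbelianGroupProperties
import Algebra.Properties.CommutativeSemigroup as CommutativeSemigroupProperties
import Algebra.Properties.CommutativeSemiring.Exp as CommutativeExp
import Algebra.Properties.Ring as RingProperties
import Algebra.Properties.Semiring.Exp as Exp
import Algebra.Properties.Semiring.Mult.TCOptimised as Mult
import Algebra.Solver.Ring as RingSolver
open import Algebra.Solver.Ring.AlmostCommutativeRing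
  using (AlmostCommutativeRing; fromCommutativeRing; _-Raw-AlmostCommutative⟶_)
open import Data.Integer.Base as ℤ using (-[1+_])
import Data.Integer.Properties as ℤₚ
open import Data.Integer.Solver using (module +-*-Solver)
open import Data.List.Base
  using (List; []; _∷_; _++_; foldr; map; cartesianProduct; deduplicate; downFrom; [_])
open import Data.List.Membership.Propositional using (_∈_)
open import Data.List.Membership.Propositional.Properties
  using ( ∈-∃++; ∈-cartesianProduct⁺; ∈-deduplicate⁺; ∈-map⁺; ∈-map⁻
        ; ∈-downFrom⁺; ∈-downFrom⁻; ∈-++⁺ˡ; ∈-++⁺ʳ; ∈-++⁻ )
open import Data.List.Properties using (map-∘)
open import Data.List.Relation.Binary.Permutation.Propositional as ↭ using (_↭_; ↭-sym)
open import Data.List.Relation.Binary.Permutation.Propositional.Properties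
  using (shift; ∈-resp-↭; All-resp-↭)
open import Data.List.Relation.Binary.Subset.Propositional using (_⊆_)
open import Data.List.Relation.Unary.All as All using (All; []; _∷_)
import Data.List.Relation.Unary.All.Properties as Allₚ
open import Data.List.Relation.Unary.AllPairs using ([]; _∷_)
open import Data.List.Relation.Unary.Any using (here; there)
import Data.List.Relation.Unary.Unique.DecPropositional.Properties as DecUnique
open import Data.List.Relation.Unary.Unique.Propositional using (Unique)
open import Data.List.Relation.Unary.Unique.Propositional.Properties
  using (map⁺; ++⁺; cartesianProduct⁺; downFrom⁺)
open import Data.Maybe.Base using (Maybe; just; nothing)
open import Data.Nat.Base as ℕ using (ℕ; zero; suc)
import Data.Nat.Properties as ℕₚ
open import Data.Nat.Solver using () renaming (module +-*-Solver to ℕ-Solver)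
open import Data.Product.Base using (Σ; proj₁; proj₂)
open import Data.Sum.Base using (_⊎_; inj₁; inj₂; [_,_]′)
open import Data.Sum.Properties using (inj₁-injective; inj₂-injective)
open import Function.Base using (_∘_)
open import Level using (_⊔_)
open import Relation.Binary.Definitions using (DecidableEquality)
open import Relation.Binary.PropositionalEquality.Core as ≡ using (_≡_; _≢_; cong)
import Relation.Binary.Reasoning.Setoid as SetoidReasoning
open import Relation.Nullary.Decidable.Core using (yes; no)
open import Relation.Nullary.Negation.Core using (¬_; contradiction)

-- The existence of the sums is part of the claim. It rests on α > 0 and 4 β - α > 0: each
-- one-variable series has a factor bounded by ρ^(j²) with ρ < 1, which beats the geometric growth
-- of the remaining factors. That q^r is multiplicative in r and of modulus below 1 for r > 0 is
-- derived from the exponential series: the addition theorem from a Cauchy product, the modulus from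
-- |e^z|² = e^(2 re z). Moduli enter only through their squares, so no square roots of reals are
-- taken.
--
-- `HasSum` by itself exhibits no bound on finite sums of absolute values, which a product of two
-- series calls for. Every series therefore carries a dominating family (`Sums`); this notion passes
-- along bijections, disjoint unions and products of index sets, as the splitting by parity
-- requires.
--
-- `qpow` unfolds to limits that contain large convergence proofs. The argument runs with an opaque
-- twin `q` instead, which is exchanged for `qpow` only at the very end, by uniqueness of limits.

-- A ring solver with integer coefficients

module Integers {c ℓ} (CR : CommutativeRing c ℓ) where
  open CommutativeRing CR
    renaming (refl to ≈-refl; sym to ≈-sym; trans to ≈-trans)
  open RingProperties ring
  open AbelianGroupProperties +-abelianGroup using (⁻¹-∙-comm)
  open Mult semiring using (1+×; ×-homo-+; ×1-homo-*) renaming (_×_ to _·_)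
  open SetoidReasoning setoid

  -- The optimised multiple, so that embed 1 is 1# on the nose.
  embed : ℤ → Carrier
  embed (+ n)    = n · 1#
  embed -[1+ n ] = - (suc n · 1#)

  embed-neg : ∀ i → embed (ℤ.- i) ≈ - embed i
  embed-neg (+ zero)  = ≈-sym -0#≈0#
  embed-neg (+ suc n) = ≈-refl
  embed-neg -[1+ n ]  = ≈-sym (-‿involutive _)

  embed-⊖ : ∀ m n → embed (m ℤ.⊖ n) ≈ m · 1# - n · 1#
  embed-⊖ m       zero    = ≈-sym (≈-trans (+-congˡ -0#≈0#) (+-identityʳ _))
  embed-⊖ zero    (suc n) = ≈-sym (+-identityˡ _)
  embed-⊖ (suc m) (suc n) = begin
    embed (suc m ℤ.⊖ suc n)         ≡⟨ ≡.cong embed (ℤₚ.[1+m]⊖[1+n]≡m⊖n m n) ⟩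
    embed (m ℤ.⊖ n)                 ≈⟨ embed-⊖ m n ⟩
    M - N                           ≈⟨ +-congʳ (+-identityʳ M) ⟨
    (M + 0#) - N                    ≈⟨ +-congʳ (+-congˡ (-‿inverseʳ 1#)) ⟨
    (M + (1# - 1#)) - N             ≈⟨ +-congʳ (+-assoc M 1# (- 1#)) ⟨
    ((M + 1#) - 1#) - N             ≈⟨ +-assoc _ _ _ ⟩
    (M + 1#) + (- 1# - N)           ≈⟨ +-cong (+-comm M 1#) (⁻¹-∙-comm 1# N) ⟩
    (1# + M) - (1# + N)             ≈⟨ +-cong (1+× m 1#) (-‿cong (1+× n 1#)) ⟨
    suc m · 1# - suc n · 1#         ∎
    where
    M = m · 1#
    N = n · 1#

  embed-+ : ∀ i j → embed (i ℤ.+ j) ≈ embed i + embed j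
  embed-+ (+ m)    (+ n)    = ×-homo-+ 1# m n
  embed-+ (+ m)    -[1+ n ] = embed-⊖ m (suc n)
  embed-+ -[1+ m ] (+ n)    = ≈-trans (embed-⊖ n (suc m)) (+-comm _ _)
  embed-+ -[1+ m ] -[1+ n ] = begin
    - (suc (suc (m ℕ.+ n)) · 1#)    ≡⟨ ≡.cong (λ k → - (k · 1#)) (≡.sym (≡.cong suc (ℕₚ.+-suc m n))) ⟩
    - ((suc m ℕ.+ suc n) · 1#)      ≈⟨ -‿cong (×-homo-+ 1# (suc m) (suc n)) ⟩
    - (suc m · 1# + suc n · 1#)     ≈⟨ ⁻¹-∙-comm _ _ ⟨
    - (suc m · 1#) - suc n · 1#     ∎

  private
    embed-*ˡ : ∀ m j → embed (+ m ℤ.* j) ≈ embed (+ m) * embed j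
    embed-*ˡ m (+ n) = ≈-trans (reflexive (≡.cong embed (≡.sym (ℤₚ.pos-* m n)))) (×1-homo-* m n)
    embed-*ˡ m -[1+ n ] = begin
      embed (+ m ℤ.* -[1+ n ])       ≡⟨ ≡.cong embed (ℤₚ.neg-distribʳ-* (+ m) (+ suc n)) ⟨
      embed (ℤ.- (+ m ℤ.* + suc n))  ≈⟨ embed-neg (+ m ℤ.* + suc n) ⟩
      - embed (+ m ℤ.* + suc n)      ≈⟨ -‿cong (embed-*ˡ m (+ suc n)) ⟩
      - (embed (+ m) * embed (+ suc n)) ≈⟨ -‿distribʳ-* _ _ ⟩
      embed (+ m) * embed -[1+ n ]   ∎

  embed-* : ∀ i j → embed (i ℤ.* j) ≈ embed i * embed j
  embed-* (+ m)    j = embed-*ˡ m j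
  embed-* -[1+ m ] j = begin
    embed (-[1+ m ] ℤ.* j)         ≡⟨ ≡.cong embed (ℤₚ.neg-distribˡ-* (+ suc m) j) ⟨
    embed (ℤ.- (+ suc m ℤ.* j))    ≈⟨ embed-neg (+ suc m ℤ.* j) ⟩
    - embed (+ suc m ℤ.* j)        ≈⟨ -‿cong (embed-*ˡ (suc m) j) ⟩
    - (embed (+ suc m) * embed j)  ≈⟨ -‿distribˡ-* _ _ ⟩
    embed -[1+ m ] * embed j       ∎

  private
    almost : AlmostCommutativeRing c ℓ
    almost = fromCommutativeRing CR

    morphism : ℤ.+-*-rawRing -Raw-AlmostCommutative⟶ almost
    morphism = record
      { ⟦_⟧    = embed
      ; +-homo = embed-+
      ; *-homo = embed-*
      ; -‿homo = embed-neg
      ; 0-homo = ≈-refl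
      ; 1-homo = ≈-refl
      }

    -- Coefficients are compared in ℤ, where equality is decidable; in the ring itself it need not
    -- be.
    _≟_ : ∀ i j → Maybe (embed i ≈ embed j)
    i ≟ j with i ℤₚ.≟ j
    ... | yes i≡j = just (reflexive (≡.cong embed i≡j))
    ... | no _    = nothing

  module Solver = RingSolver ℤ.+-*-rawRing almost morphism _≟_

-- The identities are solved over an abstract ring before they are instantiated
-- at ℂ, where the solver would expand both sides into real and imaginary parts.
module RingIdentities {c ℓ} (CR : CommutativeRing c ℓ) where
  open CommutativeRing CR
    using ( Carrier; _≈_; _+_; _*_; _-_; -_; 0#; 1#
          ; trans; +-congˡ; +-congʳ; *-congˡ; *-identityʳ )
    renaming (refl to ≈-refl)
  open Integers.Solver CR

  [x+y]-x≈y : ∀ x y → (x + y) - x ≈ y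
  [x+y]-x≈y = solve 2 (λ x y → (x :+ y) :- x := y) ≈-refl

  [x-y]+z≈[x+z]-y : ∀ x y z → (x - y) + z ≈ (x + z) - y
  [x-y]+z≈[x+z]-y = solve 3 (λ x y z → (x :- y) :+ z := (x :+ z) :- y) ≈-refl

  [x-y]+[z-w]≈[x+z]-[y+w] : ∀ x y z w → (x - y) + (z - w) ≈ (x + z) - (y + w)
  [x-y]+[z-w]≈[x+z]-[y+w] = solve 4 (λ x y z w → (x :- y) :+ (z :- w) := (x :+ z) :- (y :+ w)) ≈-refl

  -[x+y]≈-x+-y : ∀ x y → - (x + y) ≈ - x + - y
  -[x+y]≈-x+-y = solve 2 (λ x y → :- (x :+ y) := :- x :+ :- y) ≈-refl

  -- For partial sums x, y with limits s, t: each summand on the left has a small factor x - s or y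
  -- - t, and the cofactors are partial sums or again small, so an estimate uses no bound on s or t.
  product-error : ∀ x s y t →
    (x - s) * y + x * (y - t) + - ((x - s) * (y - t)) ≈ x * y - s * t
  product-error = solve 4 (λ x s y t →
    (x :- s) :* y :+ x :* (y :- t) :+ :- ((x :- s) :* (y :- t)) := x :* y :- s :* t) ≈-refl

  -x*-x≈x*x : ∀ x → - x * - x ≈ x * x
  -x*-x≈x*x = solve 1 (λ x → :- x :* :- x := x :* x) ≈-refl

  [x-s]-[x-t]≈t-s : ∀ x s t → (x - s) - (x - t) ≈ t - s
  [x-s]-[x-t]≈t-s = solve 3 (λ x s t → (x :- s) :- (x :- t) := t :- s) ≈-refl

  n*[e*z*i]≈[n*i]*[z*e] : ∀ n e z i → n * (e * z * i) ≈ (n * i) * (z * e)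
  n*[e*z*i]≈[n*i]*[z*e] = solve 4 (λ n e z i → n :* (e :* z :* i) := (n :* i) :* (z :* e)) ≈-refl

  [m+n]*[e*f]≈m*e*f+n*f*e : ∀ m n e f → (m + n) * (e * f) ≈ (m * e) * f + (n * f) * e
  [m+n]*[e*f]≈m*e*f+n*f*e = solve 4 (λ m n e f →
    (m :+ n) :* (e :* f) := (m :* e) :* f :+ (n :* f) :* e) ≈-refl

  ac-bd≈ac-[-b][-d] : ∀ a b c d → a * c - b * d ≈ a * c - - b * - d
  ac-bd≈ac-[-b][-d] = solve 4 (λ a b c d → a :* c :- b :* d := a :* c :- :- b :* :- d) ≈-refl

  -[ad+bc]≈a[-d]+[-b]c : ∀ a b c d → - (a * d + b * c) ≈ a * - d + - b * c
  -[ad+bc]≈a[-d]+[-b]c = solve 4 (λ a b c d → :- (a :* d :+ b :* c) := a :* :- d :+ :- b :* c) ≈-refl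

  ac-b[-d]≈ac+bd : ∀ a b c d → a * c - b * - d ≈ a * c + b * d
  ac-b[-d]≈ac+bd = solve 4 (λ a b c d → a :* c :- b :* :- d := a :* c :+ b :* d) ≈-refl

  first-term : ∀ t r → t * r ≈ (1# * t - 0# * 0#) * r - (1# * 0# + 0# * t) * 0#
  first-term = solve 2 (λ t r → t :* r :=
    (con (+ 1) :* t :- con (+ 0) :* con (+ 0)) :* r :-
    (con (+ 1) :* con (+ 0) :+ con (+ 0) :* t) :* con (+ 0)) ≈-refl

  -- With P = ρ^n, the second summand is the amount by which ρ^n (1 + n (1 - ρ)) drops when n grows
  -- by one.
  bernoulli-step : ∀ ρ P n → ρ * P * (1# + (1# + n) * (1# - ρ)) +
    P * ((1# + n) * ((1# - ρ) * (1# - ρ))) ≈ P * (1# + n * (1# - ρ))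
  bernoulli-step = solve 3 (λ ρ P n → ρ :* P :* (con (+ 1) :+ (con (+ 1) :+ n) :* (con (+ 1) :- ρ)) :+
    P :* ((con (+ 1) :+ n) :* ((con (+ 1) :- ρ) :* (con (+ 1) :- ρ))) :=
    P :* (con (+ 1) :+ n :* (con (+ 1) :- ρ))) ≈-refl

  -- The left side is the real part of p i r (t + i u) exactly as the coordinatewise product
  -- unfolds, zeros included.
  re-exponent : ∀ p r t u →
    ((p * 0# - 0# * 1#) * r - (p * 1# + 0# * 0#) * 0#) * t -
    ((p * 0# - 0# * 1#) * 0# + (p * 1# + 0# * 0#) * r) * u ≈ - (p * r * u)
  re-exponent = solve 4 (λ p r t u → let o = con (+ 0); i = con (+ 1) in
    ((p :* o :- o :* i) :* r :- (p :* i :+ o :* o) :* o) :* t :-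
    ((p :* o :- o :* i) :* o :+ (p :* i :+ o :* o) :* r) :* u := :- (p :* r :* u)) ≈-refl

  p[x+y]t≈pxt+pyt : ∀ p x y t → p * (x + y) * t ≈ p * x * t + p * y * t
  p[x+y]t≈pxt+pyt = solve 4 (λ p x y t → p :* (x :+ y) :* t := p :* x :* t :+ p :* y :* t) ≈-refl

  [xy][zw]≈[xz][yw] : ∀ x y z w → (x * y) * (z * w) ≈ (x * z) * (y * w)
  [xy][zw]≈[xz][yw] = solve 4 (λ x y z w → (x :* y) :* (z :* w) := (x :* z) :* (y :* w)) ≈-refl

  -- Used with P = ρ^(n²), Q = ρ^n, S = ρ^(n+1) and V = W^n; on the right the factor Q (W + W) that
  -- must be made small stands alone.
  gaussian-step : ∀ P Q S C W V → P * Q * S * (C * (W * V)) + P * Q * S * (C * (W * V)) ≈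
                  P * (C * V) * (Q * (W + W)) * S
  gaussian-step = solve 6 (λ P Q S C W V →
    P :* Q :* S :* (C :* (W :* V)) :+ P :* Q :* S :* (C :* (W :* V)) :=
    P :* (C :* V) :* (Q :* (W :+ W)) :* S) ≈-refl

  -- For h = 1/2 and o = 1 this is s + ((1 - s)/2)² = ((1 + s)/2)². The factor (h + h)² makes it
  -- hold for every h.
  mean-square : ∀ h o s → (h + h) * (h + h) * o * s + (h * (o - s)) * (h * (o - s)) ≈
                (h * (o + s)) * (h * (o + s))
  mean-square = solve 3 (λ h o s →
    (h :+ h) :* (h :+ h) :* o :* s :+ (h :* (o :- s)) :* (h :* (o :- s)) :=
    (h :* (o :+ s)) :* (h :* (o :+ s))) ≈-refl

  re-*-inverse : ∀ a b r → a * (a * r) - b * (- b * r) ≈ (a * a + b * b) * r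
  re-*-inverse = solve 3 (λ a b r → a :* (a :* r) :- b :* (:- b :* r) := (a :* a :+ b :* b) :* r) ≈-refl

  im-*-inverse : ∀ a b r → a * (- b * r) + b * (a * r) ≈ 0#
  im-*-inverse = solve 3 (λ a b r → a :* (:- b :* r) :+ b :* (a :* r) := con (+ 0)) ≈-refl

  -1*[-1*x]≈x : ∀ x → - 1# * (- 1# * x) ≈ x
  -1*[-1*x]≈x = solve 1 (λ x → :- con (+ 1) :* (:- con (+ 1) :* x) := x) ≈-refl

  four* : ∀ x → (1# + (1# + (1# + (1# + 0#)))) * x ≈ x + x + x + x
  four* = solve 1 (λ x → let i = con (+ 1) in
    (i :+ (i :+ (i :+ (i :+ con (+ 0))))) :* x := x :+ x :+ x :+ x) ≈-refl

  [j+h]² : ∀ j h → h + h ≈ 1# → (j + h) * (j + h) ≈ j * j + (j + h * h)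
  [j+h]² j h h+h≈1 = trans
    (solve 2 (λ j h → (j :+ h) :* (j :+ h) := j :* j :+ (j :* (h :+ h) :+ h :* h)) ≈-refl j h)
    (+-congˡ (+-congʳ (trans (*-congˡ h+h≈1) (*-identityʳ j))))

  a[x+[y+z]] : ∀ a x y z → a * (x + (y + z)) ≈ a * x + (a * y + a * z)
  a[x+[y+z]] = solve 4 (λ a x y z → a :* (x :+ (y :+ z)) := a :* x :+ (a :* y :+ a :* z)) ≈-refl

  regroup : ∀ r a s b y → (r * a) * (s * (b * y)) ≈ (r * s) * (a * b) * y
  regroup = solve 5 (λ r a s b y → (r :* a) :* (s :* (b :* y)) := (r :* s) :* (a :* b) :* y) ≈-refl

  gather : ∀ a s b w → (a * s) * (b * (w * s)) ≈ (a * b) * ((s * s) * w)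
  gather = solve 4 (λ a s b w → (a :* s) :* (b :* (w :* s)) := (a :* b) :* ((s :* s) :* w)) ≈-refl

  xy∙z≈xz∙y : ∀ x y z → (x * y) * z ≈ (x * z) * y
  xy∙z≈xz∙y = solve 3 (λ x y z → (x :* y) :* z := (x :* z) :* y) ≈-refl

  reassociate : ∀ a b w s → ((a * b) * w) * s ≈ a * (b * (w * s))
  reassociate = solve 4 (λ a b w s → ((a :* b) :* w) :* s := a :* (b :* (w :* s))) ≈-refl

  -[auv]≈-1auv : ∀ a u v → - (a * u * v) ≈ - 1# * a * u * v
  -[auv]≈-1auv = solve 3 (λ a u v → :- (a :* u :* v) := :- con (+ 1) :* a :* u :* v) ≈-refl

  -- Here m = J - K and n = 2 K, so u = J and v = K.
  quad-integral-even : ∀ A B J K →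
    A * ((J - K) * (J - K)) + A * (J - K) * (K + K) + B * ((K + K) * (K + K)) ≈
    A * (J * J) + ((B + B + B + B) - A) * (K * K)
  quad-integral-even = solve 4 (λ A B J K →
    A :* ((J :- K) :* (J :- K)) :+ A :* (J :- K) :* (K :+ K) :+ B :* ((K :+ K) :* (K :+ K)) :=
    A :* (J :* J) :+ ((B :+ B :+ B :+ B) :- A) :* (K :* K)) ≈-refl

  -- Here m = J - K and n = 2 K + 1, so u = J + 1/2 and v = K + 1/2. The number 1 is written h + h:
  -- the identity is then polynomial in h and within reach of the solver.
  quad-integral-odd : ∀ A B J K h → let v = (h + h) + (K + K) in
    A * ((J - K) * (J - K)) + A * (J - K) * v + B * (v * v) ≈
    A * ((J + h) * (J + h)) + ((B + B + B + B) - A) * ((K + h) * (K + h))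
  quad-integral-odd = solve 5 (λ A B J K h → let v = (h :+ h) :+ (K :+ K) in
    A :* ((J :- K) :* (J :- K)) :+ A :* (J :- K) :* v :+ B :* (v :* v) :=
    A :* ((J :+ h) :* (J :+ h)) :+ ((B :+ B :+ B :+ B) :- A) :* ((K :+ h) :* (K :+ h))) ≈-refl

  quad-half-even : ∀ A B J K h → let u = (J - K) + h in
    A * (u * u) + A * u * (K + K) + B * ((K + K) * (K + K)) ≈
    A * ((J + h) * (J + h)) + ((B + B + B + B) - A) * (K * K)
  quad-half-even = solve 5 (λ A B J K h → let u = (J :- K) :+ h in
    A :* (u :* u) :+ A :* u :* (K :+ K) :+ B :* ((K :+ K) :* (K :+ K)) :=
    A :* ((J :+ h) :* (J :+ h)) :+ ((B :+ B :+ B :+ B) :- A) :* (K :* K)) ≈-refl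

  -- Here the first variable is J - K - 1 + 1/2 and n = 2 K + 1; the halves cancel in u = J, while v
  -- = K + 1/2.
  quad-half-odd : ∀ A B J K h → let u = ((J - K) - (h + h)) + h; v = (h + h) + (K + K) in
    A * (u * u) + A * u * v + B * (v * v) ≈
    A * (J * J) + ((B + B + B + B) - A) * ((K + h) * (K + h))
  quad-half-odd = solve 5 (λ A B J K h → let u = ((J :- K) :- (h :+ h)) :+ h; v = (h :+ h) :+ (K :+ K) in
    A :* (u :* u) :+ A :* u :* v :+ B :* (v :* v) :=
    A :* (J :* J) :+ ((B :+ B :+ B :+ B) :- A) :* ((K :+ h) :* (K :+ h))) ≈-refl

  -- Both sides are (a₀² + a₁²)(b₀² + b₁²), written as a sum of two squares in the two ways of the
  -- Brahmagupta-Fibonacci identity. The trailing factors 1 match the unfolding of `_^ 2`.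
  four-squares : ∀ a₀ a₁ b₀ b₁ →
    let s₁ = a₁ * b₀ + - (a₀ * b₁); s₂ = a₀ * b₀ + a₁ * b₁
        s₃ = a₀ * b₀ + - (a₁ * b₁); s₄ = a₁ * b₀ + a₀ * b₁
    in s₁ * (s₁ * 1#) + s₂ * (s₂ * 1#) ≈ s₃ * (s₃ * 1#) + s₄ * (s₄ * 1#)
  four-squares = solve 4 (λ a₀ a₁ b₀ b₁ →
    let s₁ = a₁ :* b₀ :+ :- (a₀ :* b₁); s₂ = a₀ :* b₀ :+ a₁ :* b₁
        s₃ = a₀ :* b₀ :+ :- (a₁ :* b₁); s₄ = a₁ :* b₀ :+ a₀ :* b₁; i = con (+ 1)
    in s₁ :* (s₁ :* i) :+ s₂ :* (s₂ :* i) := s₃ :* (s₃ :* i) :+ s₄ :* (s₄ :* i)) ≈-refl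

-- Finite sets as lists without repetitions

-- Each membership proof locates an occurrence of `x` in `ys`, which is removed; as `x` does not
-- recur in `xs`, the other entries of `xs` are still found in what remains.
unique-⊆-complement : ∀ {a} {A : Set a} {xs ys : List A} → Unique xs → xs ⊆ ys →
                      ∃[ zs ] ys ↭ xs ++ zs
unique-⊆-complement {xs = []} [] _ = _ , ↭.refl
unique-⊆-complement {A = A} {xs = x ∷ xs} (x≢ ∷ xs!) xs⊆ys with ∈-∃++ (xs⊆ys (here ≡.refl))
... | ps , qs , ≡.refl = extend (unique-⊆-complement xs! xs⊆ps++qs)
  where
  moved : ps ++ [ x ] ++ qs ↭ x ∷ ps ++ qs
  moved = shift x ps qs
  xs⊆ps++qs : xs ⊆ ps ++ qs
  xs⊆ps++qs y∈xs with ∈-resp-↭ moved (xs⊆ys (there y∈xs))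
  ... | here ≡.refl = contradiction ≡.refl (All.lookup x≢ y∈xs)
  ... | there y∈    = y∈
  extend : ∃[ zs ] ps ++ qs ↭ xs ++ zs → ∃[ zs ] ps ++ [ x ] ++ qs ↭ x ∷ xs ++ zs
  extend (zs , p) = zs , ↭.trans moved (↭.prep x p)

unique-⊎-split : ∀ {a b} {A : Set a} {B : Set b} {xs : List (A ⊎ B)} → Unique xs →
                 ∃[ ls ] ∃[ rs ] Unique ls × Unique rs × xs ↭ map inj₁ ls ++ map inj₂ rs
unique-⊎-split [] = [] , [] , [] , [] , ↭.refl
unique-⊎-split {xs = inj₁ l ∷ xs} (l≢ ∷ xs!) with unique-⊎-split xs!
... | ls , rs , ls! , rs! , p = l ∷ ls , rs , (fresh ∷ ls!) , rs! , ↭.prep _ p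
  where
  fresh : All (l ≢_) ls
  fresh = All.map (λ ne e → ne (cong inj₁ e))
    (Allₚ.map⁻ (Allₚ.++⁻ˡ (map inj₁ ls) (All-resp-↭ p l≢)))
unique-⊎-split {xs = inj₂ r ∷ xs} (r≢ ∷ xs!) with unique-⊎-split xs!
... | ls , rs , ls! , rs! , p =
  ls , r ∷ rs , ls! , (fresh ∷ rs!) , ↭.trans (↭.prep _ p) (↭-sym (shift _ (map inj₁ ls) (map inj₂ rs)))
  where
  fresh : All (r ≢_) rs
  fresh = All.map (λ ne e → ne (cong inj₂ e))
    (Allₚ.map⁻ (Allₚ.++⁻ʳ (map inj₁ ls) (All-resp-↭ p r≢)))

⊆-downFrom : ∀ (ns : List ℕ) → ∃[ N ] (∀ n → N ℕ.≤ n → ns ⊆ downFrom n)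
⊆-downFrom []       = 0 , λ _ _ ()
⊆-downFrom (m ∷ ns) = suc m ℕ.+ proj₁ rest , λ where
    n N≤n (here ≡.refl) → ∈-downFrom⁺ (ℕₚ.≤-trans (ℕₚ.m≤m+n (suc m) _) N≤n)
    n N≤n (there k∈ns)  → proj₂ rest n (ℕₚ.≤-trans (ℕₚ.m≤n+m _ (suc m)) N≤n) k∈ns
  where rest = ⊆-downFrom ns

-- Finite sums

module FiniteSums {c ℓ} (CR : CommutativeRing c ℓ) where
  open CommutativeRing CR renaming (refl to ≈-refl; sym to ≈-sym; trans to ≈-trans)
  open SetoidReasoning setoid
  open CommutativeSemigroupProperties +-commutativeSemigroup using (x∙yz≈y∙xz; interchange)

  ∑ : ∀ {a} {I : Set a} → (I → Carrier) → List I → Carrier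
  ∑ f F = foldr _+_ 0# (map f F)

  module _ {a} {I : Set a} where

    ∑-cong-∈ : ∀ {f g : I → Carrier} F → (∀ {i} → i ∈ F → f i ≈ g i) → ∑ f F ≈ ∑ g F
    ∑-cong-∈ []      f≈g = ≈-refl
    ∑-cong-∈ (i ∷ F) f≈g = +-cong (f≈g (here ≡.refl)) (∑-cong-∈ F (f≈g ∘ there))

    ∑-cong : ∀ {f g : I → Carrier} → (∀ i → f i ≈ g i) → ∀ F → ∑ f F ≈ ∑ g F
    ∑-cong f≈g F = ∑-cong-∈ F λ {i} _ → f≈g i

    ∑-++ : ∀ (f : I → Carrier) F G → ∑ f (F ++ G) ≈ ∑ f F + ∑ f G
    ∑-++ f []      G = ≈-sym (+-identityˡ _)
    ∑-++ f (i ∷ F) G = ≈-trans (+-congˡ (∑-++ f F G)) (≈-sym (+-assoc _ _ _))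

    ∑-↭ : ∀ (f : I → Carrier) {F G} → F ↭ G → ∑ f F ≈ ∑ f G
    ∑-↭ f ↭.refl         = ≈-refl
    ∑-↭ f (↭.prep _ p)   = +-congˡ (∑-↭ f p)
    ∑-↭ f (↭.swap i j p) = ≈-trans (x∙yz≈y∙xz _ _ _) (+-congˡ (+-congˡ (∑-↭ f p)))
    ∑-↭ f (↭.trans p q)  = ≈-trans (∑-↭ f p) (∑-↭ f q)

    ∑-map : ∀ {b} {J : Set b} (f : J → Carrier) (e : I → J) F → ∑ f (map e F) ≈ ∑ (f ∘ e) F
    ∑-map f e F = reflexive (cong (foldr _+_ 0#) (≡.sym (map-∘ F)))

    ∑-distrib-+ : ∀ (f g : I → Carrier) F → ∑ (λ i → f i + g i) F ≈ ∑ f F + ∑ g F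
    ∑-distrib-+ f g []      = ≈-sym (+-identityˡ 0#)
    ∑-distrib-+ f g (i ∷ F) = ≈-trans (+-congˡ (∑-distrib-+ f g F)) (interchange _ _ _ _)

    *-distribˡ-∑ : ∀ x (f : I → Carrier) F → x * ∑ f F ≈ ∑ (λ i → x * f i) F
    *-distribˡ-∑ x f []      = zeroʳ x
    *-distribˡ-∑ x f (i ∷ F) = ≈-trans (distribˡ _ _ _) (+-congˡ (*-distribˡ-∑ x f F))

  ∑-cartesianProduct : ∀ {a b} {I : Set a} {J : Set b} (f : I → Carrier) (g : J → Carrier) F G →
    ∑ (λ (i , j) → f i * g j) (cartesianProduct F G) ≈ ∑ f F * ∑ g G
  ∑-cartesianProduct f g []      G = ≈-sym (zeroˡ _)
  ∑-cartesianProduct f g (i ∷ F) G = begin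
    ∑ fg (map (i ,_) G ++ cartesianProduct F G)        ≈⟨ ∑-++ fg (map (i ,_) G) _ ⟩
    ∑ fg (map (i ,_) G) + ∑ fg (cartesianProduct F G)
      ≈⟨ +-cong (∑-map fg (i ,_) G) (∑-cartesianProduct f g F G) ⟩
    ∑ (λ j → f i * g j) G + ∑ f F * ∑ g G              ≈⟨ +-congʳ (*-distribˡ-∑ (f i) g G) ⟨
    f i * ∑ g G + ∑ f F * ∑ g G                        ≈⟨ distribʳ _ _ _ ⟨
    (f i + ∑ f F) * ∑ g G                              ∎
    where fg = λ (i , j) → f i * g j

-- Exhaustions of ℕ and ℕ × ℕ

antidiagonal : ℕ → List (ℕ × ℕ)
antidiagonal zero    = [ 0 , 0 ]
antidiagonal (suc k) = (0 , suc k) ∷ map (λ (i , j) → suc i , j) (antidiagonal k)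

triangle : ℕ → List (ℕ × ℕ)
triangle zero    = []
triangle (suc n) = antidiagonal n ++ triangle n

antidiagonal-sum : ∀ k {i j} → (i , j) ∈ antidiagonal k → i ℕ.+ j ≡ k
antidiagonal-sum zero    (here ≡.refl) = ≡.refl
antidiagonal-sum (suc k) (here ≡.refl) = ≡.refl
antidiagonal-sum (suc k) (there ij∈) with ∈-map⁻ _ ij∈
... | _ , ij∈′ , ≡.refl = cong suc (antidiagonal-sum k ij∈′)

∈-antidiagonal : ∀ i j → (i , j) ∈ antidiagonal (i ℕ.+ j)
∈-antidiagonal zero    zero    = here ≡.refl
∈-antidiagonal zero    (suc j) = here ≡.refl
∈-antidiagonal (suc i) j       = there (∈-map⁺ _ (∈-antidiagonal i j))

antidiagonal-! : ∀ k → Unique (antidiagonal k)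
antidiagonal-! zero    = [] ∷ []
antidiagonal-! (suc k) = All.tabulate fresh ∷ map⁺ (λ { ≡.refl → ≡.refl }) (antidiagonal-! k)
  where
  fresh : ∀ {x} → x ∈ map (λ (i , j) → suc i , j) (antidiagonal k) → (0 , suc k) ≢ x
  fresh x∈ ≡.refl with ∈-map⁻ (λ (i , j) → suc i , j) x∈
  ... | _ , _ , ()

triangle-sum : ∀ n {i j} → (i , j) ∈ triangle n → i ℕ.+ j ℕ.< n
triangle-sum (suc n) ij∈ with ∈-++⁻ (antidiagonal n) ij∈
... | inj₁ p = ℕₚ.≤-reflexive (cong suc (antidiagonal-sum n p))
... | inj₂ p = ℕₚ.m≤n⇒m≤1+n (triangle-sum n p)

∈-triangle : ∀ {n} i j → i ℕ.+ j ℕ.< n → (i , j) ∈ triangle n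
∈-triangle {suc n} i j i+j<1+n with ℕₚ.m≤n⇒m<n∨m≡n (ℕₚ.≤-pred i+j<1+n)
... | inj₁ i+j<n  = ∈-++⁺ʳ (antidiagonal n) (∈-triangle i j i+j<n)
... | inj₂ ≡.refl = ∈-++⁺ˡ (∈-antidiagonal i j)

triangle-! : ∀ n → Unique (triangle n)
triangle-! zero    = []
triangle-! (suc n) = ++⁺ (antidiagonal-! n) (triangle-! n) λ (p , q) →
  ℕₚ.<-irrefl (antidiagonal-sum n p) (triangle-sum n q)

-- An unconditional sum is approached along any such sequence of finite sets, so sums over different
-- index types can be compared stage by stage.
record Exhaustion (I : Set) : Set where
  field
    stage        : ℕ → List I
    stage-!      : ∀ n → Unique (stage n)
    exhausts     : ∀ F → ∃[ N ] (∀ n → N ℕ.≤ n → F ⊆ stage n)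

downFrom-exhaustion : Exhaustion ℕ
downFrom-exhaustion = record { stage = downFrom ; stage-! = downFrom⁺ ; exhausts = ⊆-downFrom }

triangle-exhaustion : Exhaustion (ℕ × ℕ)
triangle-exhaustion = record
  { stage = triangle ; stage-! = triangle-! ; exhausts = λ F →
      let N , sums⊆ = ⊆-downFrom (map (λ (i , j) → i ℕ.+ j) F) in
      N , λ n N≤n {(i , j)} ij∈F → ∈-triangle i j
        (∈-downFrom⁻ (sums⊆ n N≤n (∈-map⁺ (λ (i , j) → i ℕ.+ j) ij∈F)))
  }

module AntidiagonalSums {c ℓ} (CR : CommutativeRing c ℓ) where
  open CommutativeRing CR renaming (refl to ≈-refl; sym to ≈-sym; trans to ≈-trans)
  open FiniteSums CR

  -- The head of an antidiagonal is its only entry with first coordinate 0; its tail is the previous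
  -- antidiagonal shifted.
  ∑-antidiagonalˡ : ∀ {φ ψ : ℕ × ℕ → Carrier} → (∀ j → φ (0 , j) ≈ 0#) →
    (∀ i j → φ (suc i , j) ≈ ψ (i , j)) → ∀ k → ∑ φ (antidiagonal (suc k)) ≈ ∑ ψ (antidiagonal k)
  ∑-antidiagonalˡ {φ} φ0 φs k = ≈-trans (+-cong (φ0 (suc k))
    (≈-trans (∑-map φ _ (antidiagonal k)) (∑-cong (λ (i , j) → φs i j) (antidiagonal k)))) (+-identityˡ _)

  -- The entry with second coordinate 0 comes last in the list, so this mirror image takes an
  -- induction.
  ∑-antidiagonalʳ : ∀ {φ ψ : ℕ × ℕ → Carrier} → (∀ i → φ (i , 0) ≈ 0#) →
    (∀ i j → φ (i , suc j) ≈ ψ (i , j)) → ∀ k → ∑ φ (antidiagonal (suc k)) ≈ ∑ ψ (antidiagonal k)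
  ∑-antidiagonalʳ         φ0 φs zero    = +-cong (φs 0 0) (≈-trans (+-identityʳ _) (φ0 1))
  ∑-antidiagonalʳ {φ} {ψ} φ0 φs (suc k) = +-cong (φs 0 (suc k))
    (≈-trans (∑-map φ _ (antidiagonal (suc k)))
    (≈-trans (∑-antidiagonalʳ {φ = λ (i , j) → φ (suc i , j)} {λ (i , j) → ψ (suc i , j)}
        (λ i → φ0 (suc i)) (λ i j → φs (suc i) j) k)
      (≈-sym (∑-map ψ _ (antidiagonal k)))))

-- Parity of integers

suc-square : ∀ n → suc n ℕ.* suc n ≡ (n ℕ.* n ℕ.+ n) ℕ.+ suc n
suc-square = solve 1 (λ n → (con 1 :+ n) :* (con 1 :+ n) := (n :* n :+ n) :+ (con 1 :+ n)) ≡.refl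
  where open ℕ-Solver

doubleℕ : ℕ ⊎ ℕ → ℕ
doubleℕ (inj₁ k) = k ℕ.+ k
doubleℕ (inj₂ k) = suc (k ℕ.+ k)

halveℕ-suc : ℕ ⊎ ℕ → ℕ ⊎ ℕ
halveℕ-suc (inj₁ k) = inj₂ k
halveℕ-suc (inj₂ k) = inj₁ (suc k)

halveℕ : ℕ → ℕ ⊎ ℕ
halveℕ zero    = inj₁ zero
halveℕ (suc n) = halveℕ-suc (halveℕ n)

doubleℕ-halveℕ : ∀ n → doubleℕ (halveℕ n) ≡ n
doubleℕ-halveℕ zero    = ≡.refl
doubleℕ-halveℕ (suc n) with halveℕ n | doubleℕ-halveℕ n
... | inj₁ k | e = cong suc e
... | inj₂ k | e = ≡.trans (cong suc (ℕₚ.+-suc k k)) (cong suc e)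

halveℕ-even : ∀ k → halveℕ (k ℕ.+ k) ≡ inj₁ k
halveℕ-even zero    = ≡.refl
halveℕ-even (suc k) = ≡.trans (cong (λ n → halveℕ (suc n)) (ℕₚ.+-suc k k))
  (cong (λ x → halveℕ-suc (halveℕ-suc x)) (halveℕ-even k))

halveℕ-odd : ∀ k → halveℕ (suc (k ℕ.+ k)) ≡ inj₂ k
halveℕ-odd k = cong halveℕ-suc (halveℕ-even k)

double : ℤ ⊎ ℤ → ℤ
double (inj₁ k) = k ℤ.+ k
double (inj₂ k) = + 1 ℤ.+ (k ℤ.+ k)

halve : ℤ → ℤ ⊎ ℤ
halve (+ n)    = [ (λ k → inj₁ (+ k)) , (λ k → inj₂ (+ k)) ]′ (halveℕ n)
-- The integer is -(n + 1), so the parity of n is reversed: n = 2 k gives 1 - 2 (k + 1), and n = 2 k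
-- + 1 gives -2 (k + 1).
halve -[1+ n ] = [ (λ k → inj₂ -[1+ k ]) , (λ k → inj₁ -[1+ k ]) ]′ (halveℕ n)

double-halve : ∀ n → double (halve n) ≡ n
double-halve (+ n) with halveℕ n | doubleℕ-halveℕ n
... | inj₁ k | e = cong +_ e
... | inj₂ k | e = cong +_ e
double-halve -[1+ n ] with halveℕ n | doubleℕ-halveℕ n
... | inj₁ k | e = cong -[1+_] e
... | inj₂ k | e = cong -[1+_] e

halve-double : ∀ x → halve (double x) ≡ x
halve-double (inj₁ (+ k))    rewrite halveℕ-even k = ≡.refl
halve-double (inj₁ -[1+ k ]) rewrite halveℕ-odd k  = ≡.refl
halve-double (inj₂ (+ k))    rewrite halveℕ-odd k  = ≡.refl
halve-double (inj₂ -[1+ k ]) rewrite halveℕ-even k = ≡.refl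

-- The substitution u = m + n/2, v = n/2 (e = 0) or u = m + 1/2 + n/2, v = n/2
-- (e = 1).  Here v is k or k + 1/2 according to the parity of n, and u is
-- j or j + 1/2 for e = 0 but j + 1/2 or j for e = 1.
unshear : ℤ → (ℤ × ℤ) ⊎ (ℤ × ℤ) → ℤ × ℤ
unshear e (inj₁ (j , k)) = j ℤ.- k , k ℤ.+ k
unshear e (inj₂ (j , k)) = j ℤ.- k ℤ.- e , + 1 ℤ.+ (k ℤ.+ k)

shear : ℤ → ℤ × ℤ → (ℤ × ℤ) ⊎ (ℤ × ℤ)
shear e (m , n) = [ (λ k → inj₁ (m ℤ.+ k , k)) , (λ k → inj₂ (m ℤ.+ e ℤ.+ k , k)) ]′ (halve n)

module _ where
  open +-*-Solver

  unshear-shear : ∀ e x → unshear e (shear e x) ≡ x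
  unshear-shear e (m , n) with halve n | double-halve n
  ... | inj₁ k | eq = ≡.cong₂ _,_
    (solve 2 (λ m k → m :+ k :- k := m) ≡.refl m k) eq
  ... | inj₂ k | eq = ≡.cong₂ _,_
    (solve 3 (λ m e k → m :+ e :+ k :- k :- e := m) ≡.refl m e k) eq

  shear-unshear : ∀ e x → shear e (unshear e x) ≡ x
  shear-unshear e (inj₁ (j , k)) rewrite halve-double (inj₁ k) = cong (λ i → inj₁ (i , k))
    (solve 2 (λ j k → j :- k :+ k := j) ≡.refl j k)
  shear-unshear e (inj₂ (j , k)) rewrite halve-double (inj₂ k) = cong (λ i → inj₂ (i , k))
    (solve 3 (λ j k e → j :- k :- e :+ e :+ k := j) ≡.refl j k e)

module _ {c ℓ₁ ℓ₂} (R : RealField c ℓ₁ ℓ₂) where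
  open Real R
  module ℝ = CommutativeRing commutativeRing
  open RingProperties ring using (-0#≈0#; -‿distribˡ-*; -‿distribʳ-*)
  open Integers commutativeRing using () renaming (module Solver to ℝ-Solver)
  open ℝ-Solver
  open Exp ℝ.semiring using ()
    renaming (_^_ to _^ʳ_; ^-homo-* to ^ʳ-homo-*; ^-congʳ to ^ʳ-congʳ)

  -- Ordered field lemmas

  ≤-respˡ : ∀ {x x′ y} → x ≈ x′ → x ≤ y → x′ ≤ y
  ≤-respˡ e = ≤-resp e ≈-refl

  ≤-respʳ : ∀ {x y y′} → y ≈ y′ → x ≤ y → x ≤ y′
  ≤-respʳ = ≤-resp ≈-refl

  ≤-by-difference : ∀ {x y d} → 0# ≤ d → x + d ≈ y → x ≤ y
  ≤-by-difference {x} 0≤d e = ≤-resp (+-identityʳ x) e (+-mono-≤ ≤-refl 0≤d)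

  *-mono-≤ : ∀ {x y u v} → 0# ≤ y → 0# ≤ u → x ≤ y → u ≤ v → x * u ≤ y * v
  *-mono-≤ 0≤y 0≤u x≤y u≤v = ≤-trans (*-monoʳ-≤ _ 0≤u x≤y) (*-monoˡ-≤ _ 0≤y u≤v)

  +-mono-< : ∀ {x y u v} → x < y → u < v → x + u < y + v
  +-mono-< {y = y} {u = u} x<y u<v = <-trans (+-monoˡ-< u x<y)
    (<-respˡ (+-comm _ _) (<-respʳ (+-comm _ _) (+-monoˡ-< y u<v)))

  0≤1 : 0# ≤ 1#
  0≤1 = <⇒≤ 0<1

  neg-nonpos : ∀ {x} → x ≤ 0# → 0# ≤ - x
  neg-nonpos x≤0 = ≤-respˡ -0#≈0# (neg-mono-≤ x≤0)

  neg-mono-< : ∀ {x y} → x < y → - y < - x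
  neg-mono-< {x} {y} x<y =
    <-respˡ (solve 2 (λ x y → x :+ (:- x :+ :- y) := :- y) ≈-refl x y)
    (<-respʳ (solve 2 (λ x y → y :+ (:- x :+ :- y) := :- x) ≈-refl x y)
    (+-monoˡ-< (- x + - y) x<y))

  -- The goal is a negation, so the sign of `x` may be treated as decided even though the order is
  -- not decidable.
  0≤square : ∀ x → 0# ≤ x * x
  0≤square x xx<0 = ¬¬x<0 λ x<0 → *-nonneg (neg-nonpos (<⇒≤ x<0)) (neg-nonpos (<⇒≤ x<0))
    (<-respˡ (solve 1 (λ x → x :* x := :- x :* :- x) ≈-refl x) xx<0)
    where
    ¬¬x<0 : ¬ ¬ (x < 0#)
    ¬¬x<0 0≤x = *-nonneg 0≤x 0≤x xx<0

  -- Takes the place of a square root: it turns bounds on squared moduli into bounds on coordinates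
  -- and inner products.
  square-cancel-≤ : ∀ {x y} → 0# ≤ y → x * x ≤ y * y → x ≤ y
  square-cancel-≤ {x} {y} 0≤y xx≤yy y<x =
    xx≤yy (≤-<-trans (*-monoˡ-≤ y 0≤y (<⇒≤ y<x))
      (<-respˡ (*-comm x y) (*-monoˡ-< x (≤-<-trans 0≤y y<x) y<x)))

  square-mono-≤ : ∀ {x y} → 0# ≤ x → x ≤ y → x * x ≤ y * y
  square-mono-≤ 0≤x x≤y = *-mono-≤ (≤-trans 0≤x x≤y) 0≤x x≤y x≤y

  ½+½≈1 : ½ + ½ ≈ 1#
  ½+½≈1 = ≈-trans
    (solve 1 (λ h → h :+ h := (con (+ 1) :+ (con (+ 1) :+ con (+ 0))) :* h) ≈-refl ½)
    (recip-inverse _ _)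

  half : Carrier → Carrier
  half ε = ½ * ε

  half+half : ∀ ε → half ε + half ε ≈ ε
  half+half ε = ≈-trans (≈-sym (distribʳ ε ½ ½)) (≈-trans (*-congʳ ½+½≈1) (*-identityˡ ε))

  0<half : ∀ {ε} → 0# < ε → 0# < half ε
  0<half 0<ε = *-pos (0<recip _ _) 0<ε

  half< : ∀ {ε} → 0# < ε → half ε < ε
  half< {ε} 0<ε = <-respˡ (+-identityʳ _)
    (<-respʳ (≈-trans (+-comm _ _) (half+half ε))
      (<-respˡ (+-comm _ _) (+-monoˡ-< (half ε) (0<half 0<ε))))

  -- If y < x, then ε = (x - y)/2 contradicts the assumption.
  ≤-by-approximation : ∀ {x y} → (∀ ε → 0# < ε → x ≤ y + ε) → x ≤ y
  ≤-by-approximation {x} {y} approx y<x = approx (half (x - y)) (0<half 0<x-y)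
    (<-respʳ (solve 2 (λ x y → y :+ (x :- y) := x) ≈-refl x y)
      (<-respˡ (+-comm _ _) (<-respʳ (+-comm _ _) (+-monoˡ-< y (half< 0<x-y)))))
    where
    0<x-y : 0# < x - y
    0<x-y = <-respˡ (-‿inverseʳ y) (+-monoˡ-< (- y) y<x)

  Bounded⇒≤ : ∀ {ε x y} → Bounded ε (x - y) → x ≤ y + ε
  Bounded⇒≤ {x = x} {y} (p , _) = ≤-respˡ
    (solve 2 (λ x y → y :+ (x :- y) := x) ≈-refl x y) (+-mono-≤ ≤-refl p)

  Bounded⇒≥ : ∀ {ε x y} → Bounded ε (x - y) → y ≤ x + ε
  Bounded⇒≥ {x = x} {y} (_ , p) = ≤-respˡ
    (solve 2 (λ x y → x :+ :- (x :- y) := y) ≈-refl x y) (+-mono-≤ ≤-refl p)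

  ≈-by-bounds : ∀ {x y} → x ≤ y → y ≤ x → x ≈ y
  ≈-by-bounds x≤y y≤x = <-tight y≤x x≤y

  -- Complex numbers

  ≈ᶜ-refl : ∀ {z} → z ≈ᶜ z
  ≈ᶜ-refl = ≈-refl , ≈-refl

  ≈ᶜ-sym : ∀ {z w} → z ≈ᶜ w → w ≈ᶜ z
  ≈ᶜ-sym (p , q) = ≈-sym p , ≈-sym q

  ≈ᶜ-trans : ∀ {z w v} → z ≈ᶜ w → w ≈ᶜ v → z ≈ᶜ v
  ≈ᶜ-trans (p , q) (p′ , q′) = ≈-trans p p′ , ≈-trans q q′

  ℂ-commutativeRing : CommutativeRing c ℓ₁
  ℂ-commutativeRing = record
    { Carrier = ℂ ; _≈_ = _≈ᶜ_ ; _+_ = _+ᶜ_ ; _*_ = _*ᶜ_ ; -_ = -ᶜ_ ; 0# = 0ᶜ ; 1# = 1ᶜ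
    ; isCommutativeRing = record
      { isRing = record
        { +-isAbelianGroup = record
          { isGroup = record
            { isMonoid = record
              { isSemigroup = record
                { isMagma = record
                  { isEquivalence = record { refl = ≈ᶜ-refl ; sym = ≈ᶜ-sym ; trans = ≈ᶜ-trans }
                  ; ∙-cong = λ (p , q) (p′ , q′) → +-cong p p′ , +-cong q q′
                  }
                ; assoc = λ _ _ _ → +-assoc _ _ _ , +-assoc _ _ _
                }
              ; identity = (λ _ → +-identityˡ _ , +-identityˡ _) , (λ _ → +-identityʳ _ , +-identityʳ _)
              }
            ; inverse = (λ _ → -‿inverseˡ _ , -‿inverseˡ _) , (λ _ → -‿inverseʳ _ , -‿inverseʳ _)
            ; ⁻¹-cong = λ (p , q) → -‿cong p , -‿cong q
            }
          ; comm = λ _ _ → +-comm _ _ , +-comm _ _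
          }
        ; *-cong = λ (p , q) (p′ , q′) →
            +-cong (*-cong p p′) (-‿cong (*-cong q q′)) , +-cong (*-cong p q′) (*-cong q p′)
        ; *-assoc = λ z w v →
            solve 6 (λ a b c d e f →
              (a :* c :- b :* d) :* e :- (a :* d :+ b :* c) :* f :=
              a :* (c :* e :- d :* f) :- b :* (c :* f :+ d :* e))
              ≈-refl (re z) (im z) (re w) (im w) (re v) (im v) ,
            solve 6 (λ a b c d e f →
              (a :* c :- b :* d) :* f :+ (a :* d :+ b :* c) :* e :=
              a :* (c :* f :+ d :* e) :+ b :* (c :* e :- d :* f))
              ≈-refl (re z) (im z) (re w) (im w) (re v) (im v)
        ; *-identity = one-identityˡ , λ z → ≈ᶜ-trans (mul-comm z 1ᶜ) (one-identityˡ z)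
        ; distrib = mul-distribˡ , λ z w v → ≈ᶜ-trans (mul-comm (w +ᶜ v) z)
            (≈ᶜ-trans (mul-distribˡ z w v)
              (+-cong (proj₁ (mul-comm z w)) (proj₁ (mul-comm z v)) ,
               +-cong (proj₂ (mul-comm z w)) (proj₂ (mul-comm z v))))
        }
      ; *-comm = mul-comm
      }
    }
    where
    mul-comm : ∀ z w → z *ᶜ w ≈ᶜ w *ᶜ z
    mul-comm z w = +-cong (*-comm _ _) (-‿cong (*-comm _ _)) ,
                   ≈-trans (+-comm _ _) (+-cong (*-comm _ _) (*-comm _ _))
    one-identityˡ : ∀ z → 1ᶜ *ᶜ z ≈ᶜ z
    one-identityˡ z =
      ≈-trans (+-cong (*-identityˡ _) (≈-trans (-‿cong (zeroˡ _)) -0#≈0#)) (+-identityʳ _) ,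
      ≈-trans (+-cong (*-identityˡ _) (zeroˡ _)) (+-identityʳ _)
    mul-distribˡ : ∀ z w v → z *ᶜ (w +ᶜ v) ≈ᶜ z *ᶜ w +ᶜ z *ᶜ v
    mul-distribˡ z w v =
      solve 6 (λ a b c d e f →
        a :* (c :+ e) :- b :* (d :+ f) := (a :* c :- b :* d) :+ (a :* e :- b :* f))
        ≈-refl (re z) (im z) (re w) (im w) (re v) (im v) ,
      solve 6 (λ a b c d e f →
        a :* (d :+ f) :+ b :* (c :+ e) := (a :* d :+ b :* c) :+ (a :* f :+ b :* e))
        ≈-refl (re z) (im z) (re w) (im w) (re v) (im v)

  module ℂᴿ = CommutativeRing ℂ-commutativeRing
  module ℂ-Identities = RingIdentities ℂ-commutativeRing
  module ℝ-Identities = RingIdentities commutativeRing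
  open Exp ℂᴿ.semiring using (^-homo-*; ^-congʳ)
  module ≈ᶜ = SetoidReasoning ℂᴿ.setoid

  ∣∣²-cong : ∀ {z w} → z ≈ᶜ w → ∣ z ∣² ≈ ∣ w ∣²
  ∣∣²-cong (p , q) = +-cong (*-cong p p) (*-cong q q)

  ∣∣²-* : ∀ z w → ∣ z *ᶜ w ∣² ≈ ∣ z ∣² * ∣ w ∣²
  ∣∣²-* z w = solve 4 (λ a b c d →
    (a :* c :- b :* d) :* (a :* c :- b :* d) :+ (a :* d :+ b :* c) :* (a :* d :+ b :* c) :=
    (a :* a :+ b :* b) :* (c :* c :+ d :* d)) ≈-refl (re z) (im z) (re w) (im w)

  0≤∣∣² : ∀ z → 0# ≤ ∣ z ∣²
  0≤∣∣² z = +-nonneg (0≤square _) (0≤square _)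

  -- The modulus is never formed: ∥ z ∥≤ b says ∣ z ∣ ≤ b.
  infix 4 ∥_∥≤_
  record ∥_∥≤_ (z : ℂ) (b : Carrier) : Set ℓ₂ where
    constructor norm
    field
      bound-nonneg : 0# ≤ b
      square-bound : ∣ z ∣² ≤ b * b
  open ∥_∥≤_

  ∥∥≤-resp : ∀ {z w b d} → z ≈ᶜ w → b ≈ d → ∥ z ∥≤ b → ∥ w ∥≤ d
  ∥∥≤-resp e e′ (norm p q) = norm (≤-respʳ e′ p) (≤-resp (∣∣²-cong e) (*-cong e′ e′) q)

  ∥∥≤-respᶜ : ∀ {z w b} → z ≈ᶜ w → ∥ z ∥≤ b → ∥ w ∥≤ b
  ∥∥≤-respᶜ e = ∥∥≤-resp e ≈-refl

  ∥∥≤-mono : ∀ {z b d} → b ≤ d → ∥ z ∥≤ b → ∥ z ∥≤ d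
  ∥∥≤-mono b≤d (norm p q) = norm (≤-trans p b≤d) (≤-trans q (square-mono-≤ p b≤d))

  ∥∥≤-0 : ∥ 0ᶜ ∥≤ 0#
  ∥∥≤-0 = norm ≤-refl (≤-reflexive (≈-trans (+-congˡ (zeroˡ 0#)) (+-identityʳ _)))

  ∥∥≤-1 : ∥ 1ᶜ ∥≤ 1#
  ∥∥≤-1 = norm 0≤1 (≤-reflexive (≈-trans (+-congˡ (zeroˡ 0#)) (+-identityʳ _)))

  ∥∥≤-neg : ∀ {z b} → ∥ z ∥≤ b → ∥ -ᶜ z ∥≤ b
  ∥∥≤-neg {z} (norm p q) = norm p (≤-respˡ
    (solve 2 (λ x y → x :* x :+ y :* y := :- x :* :- x :+ :- y :* :- y) ≈-refl (re z) (im z)) q)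

  ∥∥≤-* : ∀ {z w b d} → ∥ z ∥≤ b → ∥ w ∥≤ d → ∥ z *ᶜ w ∥≤ b * d
  ∥∥≤-* {z} {w} {b} {d} (norm p q) (norm p′ q′) = norm (*-nonneg p p′)
    (≤-resp (≈-sym (∣∣²-* z w))
      (solve 2 (λ b d → (b :* b) :* (d :* d) := (b :* d) :* (b :* d)) ≈-refl b d)
      (*-mono-≤ (0≤square b) (0≤∣∣² w) q q′))

  -- The triangle inequality: |z + w|² = |z|² + |w|² + 2 `dot`, and `dot` ≤ b d by Cauchy-Schwarz,
  -- because `dot`² + `cross`² = |z w|².
  ∥∥≤-+ : ∀ {z w b d} → ∥ z ∥≤ b → ∥ w ∥≤ d → ∥ z +ᶜ w ∥≤ b + d
  ∥∥≤-+ {z} {w} {b} {d} Nz@(norm p q) Nw@(norm p′ q′) = norm (+-nonneg p p′)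
    (≤-resp
      (solve 4 (λ a b c d → (a :* a :+ b :* b) :+ (c :* c :+ d :* d) :+
          ((a :* c :+ b :* d) :+ (a :* c :+ b :* d)) :=
          (a :+ c) :* (a :+ c) :+ (b :+ d) :* (b :+ d)) ≈-refl (re z) (im z) (re w) (im w))
      (solve 2 (λ b d → (b :* b) :+ (d :* d) :+ (b :* d :+ b :* d) := (b :+ d) :* (b :+ d))
        ≈-refl b d)
      (+-mono-≤ (+-mono-≤ q q′) (+-mono-≤ cauchy-schwarz cauchy-schwarz)))
    where
    dot cross : Carrier
    dot   = re z * re w + im z * im w
    cross = re z * im w - im z * re w
    cauchy-schwarz : dot ≤ b * d
    cauchy-schwarz = square-cancel-≤ (*-nonneg p p′)
      (≤-trans
        (≤-by-difference (0≤square cross)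
          (solve 4 (λ a b c d →
            (a :* c :+ b :* d) :* (a :* c :+ b :* d) :+ (a :* d :- b :* c) :* (a :* d :- b :* c) :=
            (a :* c :- b :* d) :* (a :* c :- b :* d) :+ (a :* d :+ b :* c) :* (a :* d :+ b :* c))
            ≈-refl (re z) (im z) (re w) (im w)))
        (square-bound (∥∥≤-* Nz Nw)))

  Bounded⇒∥∥≤ : ∀ {b d z} → Bounded b (re z) → Bounded d (im z) → ∥ z ∥≤ b + d
  Bounded⇒∥∥≤ {b} {d} {z} B B′ = norm (+-nonneg 0≤b 0≤d)
    (≤-trans (+-mono-≤ (square≤ B) (square≤ B′))
      (≤-by-difference (+-nonneg (*-nonneg 0≤b 0≤d) (*-nonneg 0≤b 0≤d))
        (solve 2 (λ b d → (b :* b) :+ (d :* d) :+ (b :* d :+ b :* d) := (b :+ d) :* (b :+ d))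
          ≈-refl b d)))
    where
    0≤b = Bounded-nonneg B
    0≤d = Bounded-nonneg B′
    square≤ : ∀ {b x} → Bounded b x → x * x ≤ b * b
    square≤ B = proj₁ (Bounded-* B B)

  ∥∥≤⇒Bounded-re : ∀ {z b} → ∥ z ∥≤ b → Bounded b (re z)
  ∥∥≤⇒Bounded-re {z} (norm p q) = square-cancel-≤ p rr≤ ,
    square-cancel-≤ p (≤-respˡ (solve 1 (λ x → x :* x := :- x :* :- x) ≈-refl (re z)) rr≤)
    where
    rr≤ = ≤-trans (≤-by-difference (0≤square (im z)) ≈-refl) q

  ∥∥≤⇒Bounded-im : ∀ {z b} → ∥ z ∥≤ b → Bounded b (im z)
  ∥∥≤⇒Bounded-im {z} (norm p q) = square-cancel-≤ p rr≤ ,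
    square-cancel-≤ p (≤-respˡ (solve 1 (λ x → x :* x := :- x :* :- x) ≈-refl (im z)) rr≤)
    where
    rr≤ = ≤-trans (≤-by-difference (0≤square (re z)) (+-comm _ _)) q

  ∥∥≤-^ : ∀ {z b} → ∥ z ∥≤ b → ∀ n → ∥ z ^ n ∥≤ b ^ʳ n
  ∥∥≤-^ B zero    = ∥∥≤-1
  ∥∥≤-^ B (suc n) = ∥∥≤-* B (∥∥≤-^ B n)

  -- 1 + ∣ z ∣² serves as an upper bound for ∣ z ∣ without square roots.
  ∥∥≤-exists : ∀ z → ∥ z ∥≤ 1# + ∣ z ∣²
  ∥∥≤-exists z = norm (+-nonneg 0≤1 0≤s) (≤-by-difference
    (+-nonneg (+-nonneg 0≤1 0≤s) (*-nonneg 0≤s 0≤s))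
    (solve 1 (λ s → s :+ ((con (+ 1) :+ s) :+ s :* s) := (con (+ 1) :+ s) :* (con (+ 1) :+ s)) ≈-refl s))
    where
    s = ∣ z ∣²
    0≤s = 0≤∣∣² z

  ≈ᶜ-by-approximation : ∀ {z w} → (∀ ε → 0# < ε → ∥ z -ᶜ w ∥≤ ε) → z ≈ᶜ w
  ≈ᶜ-by-approximation {z} {w} approx =
    eq (λ ε 0<ε → ∥∥≤⇒Bounded-re (approx ε 0<ε)) , eq (λ ε 0<ε → ∥∥≤⇒Bounded-im (approx ε 0<ε))
    where
    eq : ∀ {x y} → (∀ ε → 0# < ε → Bounded ε (x - y)) → x ≈ y
    eq {x} {y} B = ≈-by-bounds
      (≤-by-approximation λ ε 0<ε → Bounded⇒≤ (B ε 0<ε))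
      (≤-by-approximation λ ε 0<ε → Bounded⇒≥ (B ε 0<ε))

  open FiniteSums commutativeRing
  open FiniteSums ℂ-commutativeRing using () renaming
    ( ∑-cong to Σᶜ-cong; ∑-cong-∈ to Σᶜ-cong-∈; ∑-++ to Σᶜ-++; ∑-↭ to Σᶜ-↭; ∑-map to Σᶜ-map
    ; ∑-distrib-+ to Σᶜ-distrib-+; *-distribˡ-∑ to *-distribˡ-Σᶜ
    ; ∑-cartesianProduct to Σᶜ-cartesianProduct )

  -- Absolute summation

  0≤∑ : ∀ {a} {I : Set a} {b : I → Carrier} → (∀ i → 0# ≤ b i) → ∀ F → 0# ≤ ∑ b F
  0≤∑ 0≤b []      = ≤-refl
  0≤∑ 0≤b (i ∷ F) = +-nonneg (0≤b i) (0≤∑ 0≤b F)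

  ∑-mono-⊆ : ∀ {a} {I : Set a} {b : I → Carrier} → (∀ i → 0# ≤ b i) →
             ∀ {F G} → Unique F → F ⊆ G → ∑ b F ≤ ∑ b G
  ∑-mono-⊆ {b = b} 0≤b {F} {G} F! F⊆G with unique-⊆-complement F! F⊆G
  ... | H , G↭F++H = ≤-by-difference (0≤∑ 0≤b H)
    (≈-trans (≈-sym (∑-++ b F H)) (≈-sym (∑-↭ b G↭F++H)))

  ∥Σᶜ∥≤∑ : ∀ {a} {I : Set a} {f : I → ℂ} {b : I → Carrier} → (∀ i → ∥ f i ∥≤ b i) →
           ∀ F → ∥ Σᶜ f F ∥≤ ∑ b F
  ∥Σᶜ∥≤∑ f≤b []      = ∥∥≤-0
  ∥Σᶜ∥≤∑ f≤b (i ∷ F) = ∥∥≤-+ (f≤b i) (∥Σᶜ∥≤∑ f≤b F)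

  -- Absolute summability to s.  The total is the supremum of the partial sums
  -- of a dominating family; one finite set that approximates both sums forces
  -- every larger one to approximate s, so no other set need be considered.
  record Sums {I : Set} (f : I → ℂ) (s : ℂ) : Set (c ⊔ ℓ₂) where
    field
      bound         : I → Carrier
      total         : Carrier
      dominated     : ∀ i → ∥ f i ∥≤ bound i
      ∑bound≤total  : ∀ F → Unique F → ∑ bound F ≤ total
      approximation : ∀ ε → 0# < ε → ∃[ F ]
        Unique F × total ≤ ∑ bound F + ε × ∥ Σᶜ f F -ᶜ s ∥≤ ε

    0≤bound : ∀ i → 0# ≤ bound i
    0≤bound i = bound-nonneg (dominated i)

    0≤total : 0# ≤ total
    0≤total = ∑bound≤total [] []

  open Sums

  -- A larger set is F₀ together with some H. The bounds over F₀ fall short of the total by at most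
  -- ε/2, so those over H add up to at most ε/2, and F₀ itself is within ε/2 of the sum.
  Sums⇒limit : ∀ {I : Set} {f : I → ℂ} {s} → Sums f s → ∀ ε → 0# < ε →
               ∃[ F₀ ] (∀ F → Unique F → F₀ ⊆ F → ∥ Σᶜ f F -ᶜ s ∥≤ ε)
  Sums⇒limit {f = f} {s} S ε 0<ε with approximation S (half ε) (0<half 0<ε)
  ... | F₀ , F₀! , total≤ , near = F₀ , claim
    where
    claim : ∀ F → Unique F → F₀ ⊆ F → ∥ Σᶜ f F -ᶜ s ∥≤ ε
    claim F F! F₀⊆F with unique-⊆-complement F₀! F₀⊆F
    ... | H , p = ∥∥≤-resp
      (≈ᶜ.begin
        (Σᶜ f F₀ -ᶜ s) +ᶜ Σᶜ f H   ≈ᶜ.≈⟨ ℂ-Identities.[x-y]+z≈[x+z]-y (Σᶜ f F₀) s (Σᶜ f H) ⟩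
        (Σᶜ f F₀ +ᶜ Σᶜ f H) -ᶜ s   ≈ᶜ.≈⟨ ℂᴿ.+-congʳ (Σᶜ-++ f F₀ H) ⟨
        Σᶜ f (F₀ ++ H) -ᶜ s        ≈ᶜ.≈⟨ ℂᴿ.+-congʳ (Σᶜ-↭ f p) ⟨
        Σᶜ f F -ᶜ s                ≈ᶜ.∎)
      (half+half ε)
      (∥∥≤-+ near (∥∥≤-mono rest (∥Σᶜ∥≤∑ (dominated S) H)))
      where
      b = bound S
      rest : ∑ b H ≤ half ε
      rest = ≤-resp (ℝ-Identities.[x+y]-x≈y (∑ b F₀) (∑ b H)) (ℝ-Identities.[x+y]-x≈y (∑ b F₀) (half ε))
        (+-monoˡ-≤ (- ∑ b F₀) (≤-trans
          (≤-respˡ (≈-trans (∑-↭ b p) (∑-++ b F₀ H)) (∑bound≤total S F F!)) total≤))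

  ∥∥≤half⇒∣∣²< : ∀ z {ε} → 0# < ε → ∥ z ∥≤ half ε → ∣ z ∣² < ε * ε
  ∥∥≤half⇒∣∣²< z {ε} 0<ε (norm _ p) = ≤-<-trans p
    (<-trans (*-monoˡ-< h 0<h {h} {ε} h<ε)
      (<-respˡ (*-comm ε h) (*-monoˡ-< ε 0<ε {h} {ε} h<ε)))
    where
    h   = half ε
    0<h = 0<half 0<ε
    h<ε = half< 0<ε

  Sums⇒HasSum : ∀ {I : Set} {f : I → ℂ} {s} → Sums f s → HasSum f s
  Sums⇒HasSum {f = f} {s} S ε 0<ε = F₀ , λ F F! F₀⊆F →
    ∥∥≤half⇒∣∣²< (Σᶜ f F -ᶜ s) 0<ε (proj₂ limit F F! F₀⊆F)
    where
    limit = Sums⇒limit S (half ε) (0<half 0<ε)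
    F₀ = proj₁ limit

  Sums-cong : ∀ {I : Set} {f g : I → ℂ} {s} → (∀ i → f i ≈ᶜ g i) → Sums f s → Sums g s
  Sums-cong f≈g S = record
    { bound = bound S ; total = total S
    ; dominated = λ i → ∥∥≤-respᶜ (f≈g i) (dominated S i)
    ; ∑bound≤total = ∑bound≤total S
    ; approximation = λ ε 0<ε → let F , F! , p , q = approximation S ε 0<ε in
        F , F! , p , ∥∥≤-respᶜ (ℂᴿ.+-congʳ (Σᶜ-cong f≈g F)) q
    }

  -- Treats negation and complex conjugation at once: applied termwise, such a map keeps the
  -- dominating family of a series.
  record IsAdditiveIsometry (φ : ℂ → ℂ) : Set (c ⊔ ℓ₁) where
    field
      φ-cong : ∀ {z w} → z ≈ᶜ w → φ z ≈ᶜ φ w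
      φ-+    : ∀ z w → φ (z +ᶜ w) ≈ᶜ φ z +ᶜ φ w
      φ-neg  : ∀ z → φ (-ᶜ z) ≈ᶜ -ᶜ φ z
      φ-∣∣²  : ∀ z → ∣ φ z ∣² ≈ ∣ z ∣²

    φ-0 : φ 0ᶜ ≈ᶜ 0ᶜ
    φ-0 = ≈ᶜ.begin
      φ 0ᶜ              ≈ᶜ.≈⟨ φ-cong (ℂᴿ.-‿inverseʳ 0ᶜ) ⟨
      φ (0ᶜ -ᶜ 0ᶜ)      ≈ᶜ.≈⟨ φ-+ 0ᶜ (-ᶜ 0ᶜ) ⟩
      φ 0ᶜ +ᶜ φ (-ᶜ 0ᶜ) ≈ᶜ.≈⟨ ℂᴿ.+-congˡ (φ-neg 0ᶜ) ⟩
      φ 0ᶜ -ᶜ φ 0ᶜ      ≈ᶜ.≈⟨ ℂᴿ.-‿inverseʳ (φ 0ᶜ) ⟩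
      0ᶜ                ≈ᶜ.∎

    φ-∥∥≤ : ∀ {z b} → ∥ z ∥≤ b → ∥ φ z ∥≤ b
    φ-∥∥≤ {z} (norm p q) = norm p (≤-respˡ (≈-sym (φ-∣∣² z)) q)

    φ-Σᶜ : ∀ {I : Set} (f : I → ℂ) F → φ (Σᶜ f F) ≈ᶜ Σᶜ (φ ∘ f) F
    φ-Σᶜ f []      = φ-0
    φ-Σᶜ f (i ∷ F) = ≈ᶜ-trans (φ-+ (f i) (Σᶜ f F)) (ℂᴿ.+-congˡ (φ-Σᶜ f F))

    Sums-isometry : ∀ {I : Set} {f : I → ℂ} {s} → Sums f s → Sums (φ ∘ f) (φ s)
    Sums-isometry {f = f} {s} S = record
      { bound = bound S ; total = total S
      ; dominated = λ i → φ-∥∥≤ (dominated S i)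
      ; ∑bound≤total = ∑bound≤total S
      ; approximation = λ ε 0<ε → let F , F! , p , q = approximation S ε 0<ε in
          F , F! , p , ∥∥≤-respᶜ
            (≈ᶜ-trans (φ-+ (Σᶜ f F) (-ᶜ s)) (ℂᴿ.+-cong (φ-Σᶜ f F) (φ-neg s))) (φ-∥∥≤ q)
      }

  neg-isometry : IsAdditiveIsometry (λ z → -ᶜ z)
  neg-isometry = record
    { φ-cong = ℂᴿ.-‿cong
    ; φ-+    = ℂ-Identities.-[x+y]≈-x+-y
    ; φ-neg  = λ _ → ≈ᶜ-refl
    ; φ-∣∣²  = λ z → +-cong (ℝ-Identities.-x*-x≈x*x (re z)) (ℝ-Identities.-x*-x≈x*x (im z))
    }

  Sums-reindex : ∀ {I J : Set} {f : J → ℂ} {s} (to : I → J) (from : J → I) →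
    (∀ j → to (from j) ≡ j) → (∀ i → from (to i) ≡ i) → Sums (f ∘ to) s → Sums f s
  Sums-reindex {f = f} {s} to from to∘from from∘to S = record
    { bound = bound S ∘ from ; total = total S
    ; dominated = λ j → ≡.subst (λ k → ∥ f k ∥≤ bound S (from j)) (to∘from j) (dominated S (from j))
    ; ∑bound≤total = λ F F! → ≤-respˡ (∑-map (bound S) from F)
        (∑bound≤total S (map from F) (map⁺ from-injective F!))
    ; approximation = λ ε 0<ε → let F , F! , p , q = approximation S ε 0<ε in
        map to F , map⁺ to-injective F! ,
        ≤-respʳ (+-congʳ (≈-trans
          (∑-cong (λ i → ℝ.reflexive (cong (bound S) (≡.sym (from∘to i)))) F)
          (≈-sym (∑-map (bound S ∘ from) to F)))) p ,
        ∥∥≤-respᶜ (ℂᴿ.+-congʳ (≈ᶜ-sym (Σᶜ-map f to F))) q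
    }
    where
    from-injective : ∀ {j k} → from j ≡ from k → j ≡ k
    from-injective e = ≡.trans (≡.sym (to∘from _)) (≡.trans (cong to e) (to∘from _))
    to-injective : ∀ {i k} → to i ≡ to k → i ≡ k
    to-injective e = ≡.trans (≡.sym (from∘to _)) (≡.trans (cong from e) (from∘to _))

  Sums-⊎ : ∀ {I J : Set} {f : I ⊎ J → ℂ} {s t} →
           Sums (f ∘ inj₁) s → Sums (f ∘ inj₂) t → Sums f (s +ᶜ t)
  Sums-⊎ {I} {J} {f} {s} {t} S T = record
    { bound = b ; total = total S + total T
    ; dominated = λ where
        (inj₁ i) → dominated S i
        (inj₂ j) → dominated T j
    ; ∑bound≤total = λ F F! → let L , M , L! , M! , p = unique-⊎-split F! in
        ≤-respˡ (≈-sym (≈-trans (∑-↭ b p) (∑b-++ L M)))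
          (+-mono-≤ (∑bound≤total S L L!) (∑bound≤total T M M!))
    ; approximation = λ ε 0<ε →
        let L , L! , p , q     = approximation S (half ε) (0<half 0<ε)
            M , M! , p′ , q′ = approximation T (half ε) (0<half 0<ε)
        in map inj₁ L ++ map inj₂ M ,
           ++⁺ (map⁺ inj₁-injective L!) (map⁺ inj₂-injective M!) (disjoint L M) ,
           ≤-respʳ (≈-trans (medialʳ _ _ _ _)
             (+-cong (≈-sym (∑b-++ L M)) (half+half ε))) (+-mono-≤ p p′) ,
           ∥∥≤-resp
             (≈ᶜ-trans
               (ℂ-Identities.[x-y]+[z-w]≈[x+z]-[y+w] (Σᶜ (f ∘ inj₁) L) s (Σᶜ (f ∘ inj₂) M) t)
               (ℂᴿ.+-congʳ (≈ᶜ-sym (Σf-++ L M))))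
             (half+half ε) (∥∥≤-+ q q′)
    }
    where
    b : I ⊎ J → Carrier
    b (inj₁ i) = bound S i
    b (inj₂ j) = bound T j
    ∑b-++ : ∀ L M → ∑ b (map inj₁ L ++ map inj₂ M) ≈ ∑ (bound S) L + ∑ (bound T) M
    ∑b-++ L M = ≈-trans (∑-++ b (map inj₁ L) (map inj₂ M)) (+-cong (∑-map b inj₁ L) (∑-map b inj₂ M))
    Σf-++ : ∀ L M → Σᶜ f (map inj₁ L ++ map inj₂ M) ≈ᶜ Σᶜ (f ∘ inj₁) L +ᶜ Σᶜ (f ∘ inj₂) M
    Σf-++ L M = ≈ᶜ-trans (Σᶜ-++ f (map inj₁ L) (map inj₂ M))
      (ℂᴿ.+-cong (Σᶜ-map f inj₁ L) (Σᶜ-map f inj₂ M))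
    disjoint : ∀ L M {x : I ⊎ J} → ¬ (x ∈ map inj₁ L × x ∈ map inj₂ M)
    disjoint L M (x∈L , x∈M) with ∈-map⁻ inj₁ x∈L | ∈-map⁻ inj₂ x∈M
    ... | _ , _ , ≡.refl | _ , _ , ()
    medialʳ : ∀ x y z w → (x + y) + (z + w) ≈ (x + z) + (y + w)
    medialʳ = ℝ-Solver.solve 4 (λ x y z w → let open ℝ-Solver in
      (x :+ y) :+ (z :+ w) := (x :+ z) :+ (y :+ w)) ≈-refl

  -- The products of the bounds dominate. A finite set of pairs lies in the rectangle spanned by its
  -- two projections; decidable equality serves to rid these of repetitions.
  Sums-× : ∀ {I J : Set} → DecidableEquality I → DecidableEquality J →
           ∀ {f : I → ℂ} {g : J → ℂ} {s t} → Sums f s → Sums g t →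
           Sums (λ (i , j) → f i *ᶜ g j) (s *ᶜ t)
  Sums-× {I} {J} _≟ᴵ_ _≟ᴶ_ {f} {g} {s} {t} S T = record
    { bound = bd ; total = total S * total T
    ; dominated = λ (i , j) → ∥∥≤-* (dominated S i) (dominated T j)
    ; ∑bound≤total = λ F F! →
        let A = deduplicate _≟ᴵ_ (map proj₁ F)
            B = deduplicate _≟ᴶ_ (map proj₂ F)
        in ≤-trans
          (∑-mono-⊆ 0≤bd F! λ x∈F → ∈-cartesianProduct⁺
            (∈-deduplicate⁺ _≟ᴵ_ (∈-map⁺ proj₁ x∈F)) (∈-deduplicate⁺ _≟ᴶ_ (∈-map⁺ proj₂ x∈F)))
          (≤-respˡ (≈-sym (∑-cartesianProduct b d A B))
            (*-mono-≤ (0≤total S) (0≤∑ (0≤bound T) B)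
              (∑bound≤total S A (DecUnique.deduplicate-! _≟ᴵ_ _))
              (∑bound≤total T B (DecUnique.deduplicate-! _≟ᴶ_ _))))
    ; approximation = approximate
    }
    where
    b = bound S
    d = bound T
    bd : I × J → Carrier
    bd (i , j) = b i * d j
    0≤bd : ∀ x → 0# ≤ bd x
    0≤bd (i , j) = *-nonneg (0≤bound S i) (0≤bound T j)
    approximate : ∀ ε → 0# < ε → ∃[ F ] Unique F × total S * total T ≤ ∑ bd F + ε ×
                  ∥ Σᶜ (λ (i , j) → f i *ᶜ g j) F -ᶜ (s *ᶜ t) ∥≤ ε
    approximate ε 0<ε = combine (approximation S δ 0<δ) (approximation T δ 0<δ)
      where
      -- With δ = ε / D both the deficit of the total and the error of the sum are at most δ (total
      -- S + total T + δ). The summand ε of D forces δ ≤ 1, and the summand 1 then absorbs the last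
      -- δ.
      D = (total S + total T + 1#) + ε
      0<D : 0# < D
      0<D = <-respˡ (+-identityˡ 0#) (≤-<-trans
        (+-monoˡ-≤ 0# (+-nonneg (+-nonneg (0≤total S) (0≤total T)) 0≤1))
        (<-respˡ (+-comm _ _) (<-respʳ (+-comm _ _) (+-monoˡ-< _ 0<ε))))
      δ = ε * recip D 0<D
      0<δ : 0# < δ
      0<δ = *-pos 0<ε (0<recip D 0<D)
      δD≈ε : δ * D ≈ ε
      δD≈ε = ≈-trans (*-assoc _ _ _)
        (≈-trans (*-congˡ (≈-trans (*-comm _ _) (recip-inverse D 0<D))) (*-identityʳ ε))
      ε≤D : ε ≤ D
      ε≤D = ≤-respˡ (+-identityˡ ε) (+-monoˡ-≤ ε (+-nonneg (+-nonneg (0≤total S) (0≤total T)) 0≤1))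
      δ≤1 : δ ≤ 1#
      δ≤1 1<δ = ε≤D (<-respˡ (*-identityʳ D) (<-respʳ (≈-trans (*-comm D δ) δD≈ε) (*-monoˡ-< D 0<D 1<δ)))
      expand : ∀ x y δ → x * y + (δ * y + x * δ + δ * δ) ≈ (x + δ) * (y + δ)
      expand = solve 3 (λ x y δ → x :* y :+ (δ :* y :+ x :* δ :+ δ :* δ) := (x :+ δ) :* (y :+ δ)) ≈-refl
        where open ℝ-Solver
      Approximation : ∀ {I : Set} {f : I → ℂ} {s} → Sums f s → Carrier → Set ℓ₂
      Approximation {f = f} {s} S δ = ∃[ F ]
        Unique F × total S ≤ ∑ (bound S) F + δ × ∥ Σᶜ f F -ᶜ s ∥≤ δ
      combine : Approximation S δ → Approximation T δ →
        ∃[ F ] Unique F × total S * total T ≤ ∑ bd F + ε ×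
        ∥ Σᶜ (λ (i , j) → f i *ᶜ g j) F -ᶜ (s *ᶜ t) ∥≤ ε
      combine (A , A! , p , q) (B , B! , p′ , q′) =
        cartesianProduct A B , cartesianProduct⁺ A! B! ,
        ≤-trans (*-mono-≤ (+-nonneg (0≤∑ (0≤bound S) A) (<⇒≤ 0<δ)) (0≤total T) p p′)
          (≤-trans (≤-respˡ (expand (∑ b A) (∑ d B) δ)
              (+-mono-≤ (≤-refl {∑ b A * ∑ d B}) error≤))
            (≤-reflexive (+-congʳ (≈-sym (∑-cartesianProduct b d A B))))) ,
        ∥∥≤-respᶜ
          (≈ᶜ-trans (ℂ-Identities.product-error (Σᶜ f A) s (Σᶜ g B) t)
            (ℂᴿ.+-congʳ (≈ᶜ-sym (Σᶜ-cartesianProduct f g A B))))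
          (∥∥≤-mono error≤ (∥∥≤-+ (∥∥≤-+ (∥∥≤-* q (∥Σᶜ∥≤∑ (dominated T) B))
            (∥∥≤-* (∥Σᶜ∥≤∑ (dominated S) A) q′)) (∥∥≤-neg (∥∥≤-* q q′))))
        where
        error≤ : δ * ∑ d B + ∑ b A * δ + δ * δ ≤ ε
        error≤ = ≤-trans
            (+-mono-≤ (+-mono-≤ (*-monoˡ-≤ δ (<⇒≤ 0<δ) (∑bound≤total T B B!))
                                (*-monoʳ-≤ δ (<⇒≤ 0<δ) (∑bound≤total S A A!)))
                      (*-monoˡ-≤ δ (<⇒≤ 0<δ) δ≤1))
            (≤-by-difference (*-nonneg (<⇒≤ 0<δ) (<⇒≤ 0<ε))
              (≈-trans (solve 5 (λ δ S T o ε →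
                  δ :* T :+ S :* δ :+ δ :* o :+ δ :* ε := δ :* ((S :+ T :+ o) :+ ε))
                  ≈-refl δ (total S) (total T) 1# ε) δD≈ε))
            where open ℝ-Solver

  -- Limits of sequences and series indexed by ℕ

  Converges-within : ∀ {u l} → Converges u l → ∀ ε → 0# < ε →
                     ∃[ N ] (∀ n → N ℕ.≤ n → Bounded ε (u n - l))
  Converges-within u→l ε 0<ε = let N , near = u→l ε 0<ε in
    N , λ n N≤n → Bounded-≤ (<⇒≤ (near n N≤n)) (Bounded-∣∣ _)

  limit-≥ : ∀ {u l a} → Converges u l → ∀ M → (∀ n → M ℕ.≤ n → a ≤ u n) → a ≤ l
  limit-≥ u→l M a≤u = ≤-by-approximation λ ε 0<ε → let N , near = Converges-within u→l ε 0<ε in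
    ≤-trans (a≤u (M ℕ.+ N) (ℕₚ.m≤m+n M N)) (Bounded⇒≤ (near (M ℕ.+ N) (ℕₚ.m≤n+m N M)))

  partialSum-mono : ∀ {t} → (∀ k → 0# ≤ t k) → ∀ m {n} → m ℕ.≤ n → partialSum t m ≤ partialSum t n
  partialSum-mono {t} 0≤t m {n} m≤n =
    ≡.subst (λ k → partialSum t m ≤ partialSum t k) (ℕₚ.m∸n+n≡m m≤n) (steps (n ℕ.∸ m))
    where
    steps : ∀ j → partialSum t m ≤ partialSum t (j ℕ.+ m)
    steps zero    = ≤-refl
    steps (suc j) = ≤-trans (steps j) (≤-by-difference (0≤t (j ℕ.+ m)) ≈-refl)

  ∑-downFrom : ∀ t n → ∑ t (downFrom n) ≈ partialSum t n
  ∑-downFrom t zero    = ≈-refl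
  ∑-downFrom t (suc n) = ≈-trans (+-congˡ (∑-downFrom t n)) (+-comm _ _)

  re-Σᶜ : ∀ {I : Set} (f : I → ℂ) F → re (Σᶜ f F) ≈ ∑ (re ∘ f) F
  re-Σᶜ f []      = ≈-refl
  re-Σᶜ f (i ∷ F) = +-congˡ (re-Σᶜ f F)

  im-Σᶜ : ∀ {I : Set} (f : I → ℂ) F → im (Σᶜ f F) ≈ ∑ (im ∘ f) F
  im-Σᶜ f []      = ≈-refl
  im-Σᶜ f (i ∷ F) = +-congˡ (im-Σᶜ f F)

  Bounded-resp : ∀ {b x y} → x ≈ y → Bounded b x → Bounded b y
  Bounded-resp e (p , q) = ≤-respˡ e p , ≤-respˡ (-‿cong e) q

  module _ {f : ℕ → ℂ} {b : ℕ → Carrier} (f≤b : ∀ k → ∥ f k ∥≤ b k)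
           (N : ℕ) (halving : ∀ k → N ℕ.≤ k → b (suc k) + b (suc k) ≤ b k) where

    private
      0≤b : ∀ k → 0# ≤ b k
      0≤b k = bound-nonneg (f≤b k)

      module B  = Dominated b b (λ k → Bounded-self (0≤b k)) N halving
      module Re = Dominated (re ∘ f) b (λ k → ∥∥≤⇒Bounded-re (f≤b k)) N halving
      module Im = Dominated (im ∘ f) b (λ k → ∥∥≤⇒Bounded-im (f≤b k)) N halving

    -- The total is the limit of the dominating series. Every finite set of naturals lies in an
    -- initial segment, so its bounds add up to at most this limit, and a long initial segment
    -- approximates everything at once.
    Sums-ℕ : ∀ s → Converges (partialSum (re ∘ f)) (re s) →
             Converges (partialSum (im ∘ f)) (im s) → Sums f s
    Sums-ℕ s re→ im→ = record
      { bound = b ; total = B.seriesSum ; dominated = f≤b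
      ; ∑bound≤total = λ F F! → let M , F⊆ = ⊆-downFrom F in
          limit-≥ B.seriesSum-converges M λ n M≤n →
            ≤-respʳ (∑-downFrom b n) (∑-mono-⊆ 0≤b F! (F⊆ n M≤n))
      ; approximation = λ ε 0<ε →
          let K , b-near  = Converges-within B.seriesSum-converges ε 0<ε
              L , re-near = Converges-within re→ (half ε) (0<half 0<ε)
              M , im-near = Converges-within im→ (half ε) (0<half 0<ε)
              n   = K ℕ.+ (L ℕ.+ M)
              K≤n = ℕₚ.m≤m+n K (L ℕ.+ M)
              L≤n = ℕₚ.≤-trans (ℕₚ.m≤m+n L M) (ℕₚ.m≤n+m (L ℕ.+ M) K)
              M≤n = ℕₚ.≤-trans (ℕₚ.m≤n+m M L) (ℕₚ.m≤n+m (L ℕ.+ M) K)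
          in downFrom n , downFrom⁺ n ,
             ≤-respʳ (+-congʳ (≈-sym (∑-downFrom b n))) (Bounded⇒≥ (b-near n K≤n)) ,
             ∥∥≤-resp ≈ᶜ-refl (half+half ε) (Bounded⇒∥∥≤
               (Bounded-resp (+-congʳ (≈-sym (≈-trans (re-Σᶜ f (downFrom n)) (∑-downFrom _ n))))
                 (re-near n L≤n))
               (Bounded-resp (+-congʳ (≈-sym (≈-trans (im-Σᶜ f (downFrom n)) (∑-downFrom _ n))))
                 (im-near n M≤n)))
      }

    Sums-ℕ-exists : ∃[ s ] Sums f s
    Sums-ℕ-exists = (Re.seriesSum +i Im.seriesSum) ,
      Sums-ℕ _ Re.seriesSum-converges Im.seriesSum-converges

  open Exhaustion

  Sums-along : ∀ {I : Set} (E : Exhaustion I) {f : I → ℂ} {s} → Sums f s → ∀ ε → 0# < ε →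
               ∃[ N ] (∀ n → N ℕ.≤ n → ∥ Σᶜ f (stage E n) -ᶜ s ∥≤ ε)
  Sums-along E S ε 0<ε =
    let F₀ , near = Sums⇒limit S ε 0<ε
        N , F₀⊆   = exhausts E F₀
    in N , λ n N≤n → near (stage E n) (stage-! E n) (F₀⊆ n N≤n)

  -- The index types may differ so that a double series taken along triangles can be compared with a
  -- simple one.
  Sums-unique : ∀ {I J : Set} (E : Exhaustion I) (D : Exhaustion J) {f : I → ℂ} {g : J → ℂ} {s t} →
    (∀ n → Σᶜ f (stage E n) ≈ᶜ Σᶜ g (stage D n)) → Sums f s → Sums g t → s ≈ᶜ t
  Sums-unique E D {f} {g} {s} {t} f≈g S T = ≈ᶜ-by-approximation λ ε 0<ε →
    let M , f-near = Sums-along E S (half ε) (0<half 0<ε)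
        N , g-near = Sums-along D T (half ε) (0<half 0<ε)
        n = M ℕ.+ N
    in ∥∥≤-resp
      (≈ᶜ-trans (ℂᴿ.+-congˡ (ℂᴿ.-‿cong (ℂᴿ.+-congʳ (f≈g n))))
                (ℂ-Identities.[x-s]-[x-t]≈t-s (Σᶜ g (stage D n)) t s))
      (half+half ε)
      (∥∥≤-+ (g-near n (ℕₚ.m≤n+m N M)) (∥∥≤-neg (f-near n (ℕₚ.m≤m+n M N))))

  open AntidiagonalSums ℂ-commutativeRing

  -- The exponential function

  fromℝ-cong : ∀ {x y} → x ≈ y → fromℝ x ≈ᶜ fromℝ y
  fromℝ-cong e = e , ≈-refl

  fromℝ-+ : ∀ x y → fromℝ (x + y) ≈ᶜ fromℝ x +ᶜ fromℝ y
  fromℝ-+ x y = ≈-refl , ≈-sym (+-identityˡ 0#)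

  fromℝ-* : ∀ x y → fromℝ (x * y) ≈ᶜ fromℝ x *ᶜ fromℝ y
  fromℝ-* x y =
    ≈-sym (≈-trans (+-congˡ (≈-trans (-‿cong (zeroˡ 0#)) -0#≈0#)) (+-identityʳ _)) ,
    ≈-sym (≈-trans (+-cong (zeroʳ x) (zeroˡ y)) (+-identityˡ 0#))

  ∥fromℝ∥ : ∀ {r} → 0# ≤ r → ∥ fromℝ r ∥≤ r
  ∥fromℝ∥ 0≤r = norm 0≤r (≤-reflexive (≈-trans (+-congˡ (zeroˡ 0#)) (+-identityʳ _)))

  suc*1/suc : ∀ k → fromℕ (suc k) * 1/suc k ≈ 1#
  suc*1/suc k = recip-inverse _ _

  module _ (z : ℂ) where
    private
      M : Carrier
      M = 1# + ∣ z ∣²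

      b : ℕ → Carrier
      b zero    = 1#
      b (suc k) = b k * M * 1/suc k

      expTerm≤b : ∀ k → ∥ expTerm z k ∥≤ b k
      expTerm≤b zero    = ∥∥≤-1
      expTerm≤b (suc k) = ∥∥≤-* (∥∥≤-* (expTerm≤b k) (∥∥≤-exists z)) (∥fromℝ∥ (0≤1/suc k))

      0≤b : ∀ k → 0# ≤ b k
      0≤b k = bound-nonneg (expTerm≤b k)

      N : ℕ
      -- Consecutive bounds have ratio M / (k + 1), at most 1/2 once 2 M ≤ k + 1.
      N = proj₁ (archimedean (M + M))

      halving : ∀ k → N ℕ.≤ k → b (suc k) + b (suc k) ≤ b k
      halving k N≤k = ≤-resp
        (≈-trans (*-congʳ (distribˡ _ _ _)) (distribʳ _ _ _))
        (≈-trans (*-assoc _ _ _) (≈-trans (*-congˡ (suc*1/suc k)) (*-identityʳ _)))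
        (*-monoʳ-≤ (1/suc k) (0≤1/suc k) (*-monoˡ-≤ (b k) (0≤b k) M+M≤))
        where
        M+M≤ : M + M ≤ fromℕ (suc k)
        M+M≤ = ≤-trans (<⇒≤ (proj₂ (archimedean (M + M)))) (fromℕ-mono-≤ (ℕₚ.m≤n⇒m≤1+n N≤k))

    -- Unlike exp, opaque: exp unfolds to terms that contain convergence proofs.
    opaque
      𝕖 : ℂ
      𝕖 = proj₁ (Sums-ℕ-exists expTerm≤b N halving)

      𝕖-sums : Sums (expTerm z) 𝕖
      𝕖-sums = proj₂ (Sums-ℕ-exists expTerm≤b N halving)

  expTerm-cong : ∀ {z w} → z ≈ᶜ w → ∀ k → expTerm z k ≈ᶜ expTerm w k
  expTerm-cong e zero    = ≈ᶜ-refl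
  expTerm-cong e (suc k) = ℂᴿ.*-congʳ (ℂᴿ.*-cong (expTerm-cong e k) e)

  natᶜ : ℕ → ℂ
  natᶜ k = fromℝ (fromℕ k)

  natᶜ-+ : ∀ m n → natᶜ (m ℕ.+ n) ≈ᶜ natᶜ m +ᶜ natᶜ n
  natᶜ-+ zero    n = ℂᴿ.sym (ℂᴿ.+-identityˡ _)
  natᶜ-+ (suc m) n = ≈ᶜ-trans (fromℝ-+ 1# _) (≈ᶜ-trans (ℂᴿ.+-congˡ (natᶜ-+ m n))
    (≈ᶜ-trans (ℂᴿ.sym (ℂᴿ.+-assoc 1ᶜ (natᶜ m) (natᶜ n))) (ℂᴿ.+-congʳ (ℂᴿ.sym (fromℝ-+ 1# _)))))

  natᶜ*1/suc : ∀ k → natᶜ (suc k) *ᶜ fromℝ (1/suc k) ≈ᶜ 1ᶜ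
  natᶜ*1/suc k = ≈ᶜ-trans (ℂᴿ.sym (fromℝ-* _ _)) (fromℝ-cong (suc*1/suc k))

  natᶜ-cancel : ∀ k {z w} → natᶜ (suc k) *ᶜ z ≈ᶜ natᶜ (suc k) *ᶜ w → z ≈ᶜ w
  natᶜ-cancel k {z} {w} e = ≈ᶜ-trans (ℂᴿ.sym (undo z)) (≈ᶜ-trans (ℂᴿ.*-congˡ e) (undo w))
    where
    undo : ∀ v → fromℝ (1/suc k) *ᶜ (natᶜ (suc k) *ᶜ v) ≈ᶜ v
    undo v = ≈ᶜ-trans (ℂᴿ.sym (ℂᴿ.*-assoc (fromℝ (1/suc k)) (natᶜ (suc k)) v))
      (≈ᶜ-trans (ℂᴿ.*-congʳ (≈ᶜ-trans (ℂᴿ.*-comm (fromℝ (1/suc k)) (natᶜ (suc k))) (natᶜ*1/suc k)))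
        (ℂᴿ.*-identityˡ v))

  expTerm-suc : ∀ z k → natᶜ (suc k) *ᶜ expTerm z (suc k) ≈ᶜ z *ᶜ expTerm z k
  expTerm-suc z k = ≈ᶜ-trans
    (ℂ-Identities.n*[e*z*i]≈[n*i]*[z*e] (natᶜ (suc k)) (expTerm z k) z (fromℝ (1/suc k)))
    (≈ᶜ-trans (ℂᴿ.*-congʳ (natᶜ*1/suc k)) (ℂᴿ.*-identityˡ _))

  module _ (z w : ℂ) where
    private
      term : ℕ × ℕ → ℂ
      term (i , j) = expTerm z i *ᶜ expTerm w j

    -- The binomial theorem, proved without binomial coefficients. The weight k + 1 splits as i + j
    -- on its antidiagonal; since i z^i / i! is z times the preceding term, the first part is z
    -- times the previous antidiagonal sum, and the second likewise w times it. The weight is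
    -- cancelled at the end.
    expTerm-+ : ∀ k → Σᶜ term (antidiagonal k) ≈ᶜ expTerm (z +ᶜ w) k
    expTerm-+ zero    = ≈ᶜ-trans (ℂᴿ.+-identityʳ _) (ℂᴿ.*-identityˡ _)
    expTerm-+ (suc k) = natᶜ-cancel k (≈ᶜ.begin
      natᶜ (suc k) *ᶜ Σᶜ term (antidiagonal (suc k))
        ≈ᶜ.≈⟨ *-distribˡ-Σᶜ (natᶜ (suc k)) term (antidiagonal (suc k)) ⟩
      Σᶜ (λ x → natᶜ (suc k) *ᶜ term x) (antidiagonal (suc k))
        ≈ᶜ.≈⟨ Σᶜ-cong-∈ (antidiagonal (suc k)) (λ {x} → weight {x}) ⟩
      Σᶜ (λ x → left x +ᶜ right x) (antidiagonal (suc k))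
        ≈ᶜ.≈⟨ Σᶜ-distrib-+ left right (antidiagonal (suc k)) ⟩
      Σᶜ left (antidiagonal (suc k)) +ᶜ Σᶜ right (antidiagonal (suc k))
        ≈ᶜ.≈⟨ ℂᴿ.+-cong
          (∑-antidiagonalˡ {left} {λ x → z *ᶜ term x} left-zero left-suc k)
          (∑-antidiagonalʳ {right} {λ x → w *ᶜ term x} right-zero right-suc k) ⟩
      Σᶜ (λ x → z *ᶜ term x) (antidiagonal k) +ᶜ Σᶜ (λ x → w *ᶜ term x) (antidiagonal k)
        ≈ᶜ.≈⟨ ℂᴿ.+-cong (*-distribˡ-Σᶜ z term (antidiagonal k)) (*-distribˡ-Σᶜ w term (antidiagonal k)) ⟨
      z *ᶜ Σᶜ term (antidiagonal k) +ᶜ w *ᶜ Σᶜ term (antidiagonal k)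
        ≈ᶜ.≈⟨ ℂᴿ.distribʳ (Σᶜ term (antidiagonal k)) z w ⟨
      (z +ᶜ w) *ᶜ Σᶜ term (antidiagonal k)
        ≈ᶜ.≈⟨ ℂᴿ.*-congˡ (expTerm-+ k) ⟩
      (z +ᶜ w) *ᶜ expTerm (z +ᶜ w) k
        ≈ᶜ.≈⟨ expTerm-suc (z +ᶜ w) k ⟨
      natᶜ (suc k) *ᶜ expTerm (z +ᶜ w) (suc k) ≈ᶜ.∎)
      where
      left right : ℕ × ℕ → ℂ
      left  (i , j) = (natᶜ i *ᶜ expTerm z i) *ᶜ expTerm w j
      right (i , j) = (natᶜ j *ᶜ expTerm w j) *ᶜ expTerm z i
      weight : ∀ {x} → x ∈ antidiagonal (suc k) → natᶜ (suc k) *ᶜ term x ≈ᶜ left x +ᶜ right x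
      weight {i , j} ij∈ = ≈ᶜ-trans
        (ℂᴿ.*-congʳ {term (i , j)} (≈ᶜ-trans
          (fromℝ-cong (ℝ.reflexive (cong fromℕ (≡.sym (antidiagonal-sum (suc k) ij∈))))) (natᶜ-+ i j)))
        (ℂ-Identities.[m+n]*[e*f]≈m*e*f+n*f*e (natᶜ i) (natᶜ j) (expTerm z i) (expTerm w j))
      zero-term : ∀ e f → (natᶜ 0 *ᶜ e) *ᶜ f ≈ᶜ 0ᶜ
      zero-term e f = ≈ᶜ-trans (ℂᴿ.*-congʳ (ℂᴿ.zeroˡ e)) (ℂᴿ.zeroˡ f)
      left-zero : ∀ j → left (0 , j) ≈ᶜ 0ᶜ
      left-zero j = zero-term (expTerm z 0) (expTerm w j)
      right-zero : ∀ i → right (i , 0) ≈ᶜ 0ᶜ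
      right-zero i = zero-term (expTerm w 0) (expTerm z i)
      left-suc : ∀ i j → left (suc i , j) ≈ᶜ z *ᶜ term (i , j)
      left-suc i j = ≈ᶜ-trans (ℂᴿ.*-congʳ (expTerm-suc z i)) (ℂᴿ.*-assoc z (expTerm z i) (expTerm w j))
      right-suc : ∀ i j → right (i , suc j) ≈ᶜ w *ᶜ term (i , j)
      right-suc i j = ≈ᶜ-trans (ℂᴿ.*-congʳ (expTerm-suc w j))
        (≈ᶜ-trans (ℂᴿ.*-assoc w (expTerm w j) (expTerm z i)) (ℂᴿ.*-congˡ (ℂᴿ.*-comm _ _)))

    private
      stages : ∀ n → Σᶜ term (triangle n) ≈ᶜ Σᶜ (expTerm (z +ᶜ w)) (downFrom n)
      stages zero    = ≈ᶜ-refl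
      stages (suc n) = ≈ᶜ-trans (Σᶜ-++ term (antidiagonal n) (triangle n))
        (ℂᴿ.+-cong (expTerm-+ n) (stages n))

    -- The Cauchy product: the double series of products, taken along triangles, has the partial
    -- sums of the exponential series of z + w.
    𝕖-+ : 𝕖 (z +ᶜ w) ≈ᶜ 𝕖 z *ᶜ 𝕖 w
    𝕖-+ = ≈ᶜ-sym (Sums-unique triangle-exhaustion downFrom-exhaustion {f = term} stages
      (Sums-× ℕₚ._≟_ ℕₚ._≟_ (𝕖-sums z) (𝕖-sums w)) (𝕖-sums (z +ᶜ w)))

  𝕖-cong : ∀ {z w} → z ≈ᶜ w → 𝕖 z ≈ᶜ 𝕖 w
  𝕖-cong {z} {w} e = Sums-unique downFrom-exhaustion downFrom-exhaustion
    (λ n → Σᶜ-cong (expTerm-cong e) (downFrom n)) (𝕖-sums z) (𝕖-sums w)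

  𝕖-0 : 𝕖 0ᶜ ≈ᶜ 1ᶜ
  𝕖-0 = ≈ᶜ-sym (≈ᶜ-by-approximation λ ε 0<ε →
    let N , near = Sums-along downFrom-exhaustion (𝕖-sums 0ᶜ) ε 0<ε in
    -- Stage `suc N` is used because stage 0 is empty and lacks the constant term 1.
    ∥∥≤-respᶜ (ℂᴿ.+-congʳ (stages N)) (near (suc N) (ℕₚ.n≤1+n N)))
    where
    expTerm-0 : ∀ k → expTerm 0ᶜ (suc k) ≈ᶜ 0ᶜ
    expTerm-0 k = ≈ᶜ-trans (ℂᴿ.*-congʳ (ℂᴿ.zeroʳ _)) (ℂᴿ.zeroˡ _)
    stages : ∀ n → Σᶜ (expTerm 0ᶜ) (downFrom (suc n)) ≈ᶜ 1ᶜ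
    stages zero    = ℂᴿ.+-identityʳ 1ᶜ
    stages (suc n) = ≈ᶜ-trans (ℂᴿ.+-cong (expTerm-0 n) (stages n)) (ℂᴿ.+-identityˡ 1ᶜ)

  -- The modulus of the exponential

  conj : ℂ → ℂ
  conj z = re z +i (- im z)

  conj-* : ∀ z w → conj (z *ᶜ w) ≈ᶜ conj z *ᶜ conj w
  conj-* z w = ℝ-Identities.ac-bd≈ac-[-b][-d] _ _ _ _ , ℝ-Identities.-[ad+bc]≈a[-d]+[-b]c _ _ _ _

  conj-isometry : IsAdditiveIsometry conj
  conj-isometry = record
    { φ-cong = λ (p , q) → p , -‿cong q
    ; φ-+    = λ z w → ≈-refl , ℝ-Identities.-[x+y]≈-x+-y (im z) (im w)
    ; φ-neg  = λ _ → ≈ᶜ-refl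
    ; φ-∣∣²  = λ z → +-congˡ (ℝ-Identities.-x*-x≈x*x (im z))
    }

  expTerm-conj : ∀ z k → conj (expTerm z k) ≈ᶜ expTerm (conj z) k
  expTerm-conj z zero    = ≈-refl , -0#≈0#
  expTerm-conj z (suc k) = ≈ᶜ-trans (conj-* (expTerm z k *ᶜ z) (fromℝ (1/suc k)))
    (ℂᴿ.*-cong (≈ᶜ-trans (conj-* (expTerm z k) z) (ℂᴿ.*-congʳ (expTerm-conj z k))) (≈-refl , -0#≈0#))

  𝕖-conj : ∀ z → conj (𝕖 z) ≈ᶜ 𝕖 (conj z)
  𝕖-conj z = Sums-unique downFrom-exhaustion downFrom-exhaustion
    (λ n → Σᶜ-cong (expTerm-conj z) (downFrom n))
    (IsAdditiveIsometry.Sums-isometry conj-isometry (𝕖-sums z)) (𝕖-sums (conj z))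

  -- The exponential commutes with conjugation, so |e^z|² is the real part of e^z times its
  -- conjugate, which is e^(z + conj z).
  ∣𝕖∣² : ∀ z → ∣ 𝕖 z ∣² ≈ re (𝕖 (z +ᶜ conj z))
  ∣𝕖∣² z = ≈-sym (≈-trans (proj₁ (𝕖-+ z (conj z)))
    (≈-trans (proj₁ (ℂᴿ.*-congˡ {𝕖 z} (≈ᶜ-sym (𝕖-conj z))))
      (ℝ-Identities.ac-b[-d]≈ac+bd _ _ _ _)))

  re-converges : ∀ {f : ℕ → ℂ} {s} → Sums f s → Converges (partialSum (re ∘ f)) (re s)
  re-converges {f} S ε 0<ε =
    let N , near = Sums-along downFrom-exhaustion S (half ε) (0<half 0<ε) in
    N , λ n N≤n → ≤-<-trans (∣∣-least (Bounded-resp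
      (+-congʳ (≈-trans (re-Σᶜ f (downFrom n)) (∑-downFrom _ n))) (∥∥≤⇒Bounded-re (near n N≤n))))
      (half< 0<ε)

  im-converges : ∀ {f : ℕ → ℂ} {s} → Sums f s → Converges (partialSum (im ∘ f)) (im s)
  im-converges {f} S ε 0<ε =
    let N , near = Sums-along downFrom-exhaustion S (half ε) (0<half 0<ε) in
    N , λ n N≤n → ≤-<-trans (∣∣-least (Bounded-resp
      (+-congʳ (≈-trans (im-Σᶜ f (downFrom n)) (∑-downFrom _ n))) (∥∥≤⇒Bounded-im (near n N≤n))))
      (half< 0<ε)

  module _ {t : Carrier} (0<t : 0# < t) where
    private
      real-term : ∀ k → 0# ≤ re (expTerm (fromℝ t) k) × im (expTerm (fromℝ t) k) ≈ 0#
      real-term zero    = 0≤1 , ≈-refl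
      real-term (suc k) with real-term k
      ... | 0≤re , im≈0 = ≤-respʳ (≈-sym (≈-trans (proj₁ shape) (≈-refl)))
            (*-nonneg (*-nonneg 0≤re (<⇒≤ 0<t)) (0≤1/suc k)) , proj₂ shape
        where
        term = expTerm (fromℝ t) k
        shape : expTerm (fromℝ t) (suc k) ≈ᶜ fromℝ (re term * t * 1/suc k)
        shape = ≈ᶜ-trans
          (ℂᴿ.*-congʳ {fromℝ (1/suc k)} (ℂᴿ.*-congʳ {fromℝ t} {term} {fromℝ (re term)} (≈-refl , im≈0)))
          (≈ᶜ-sym (≈ᶜ-trans (fromℝ-* (re term * t) (1/suc k)) (ℂᴿ.*-congʳ (fromℝ-* (re term) t))))

      0<re-1 : 0# < re (expTerm (fromℝ t) 1)
      0<re-1 = <-respʳ (ℝ-Identities.first-term t (1/suc 0)) (*-pos 0<t (0<recip _ _))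

    -- All terms are nonnegative reals, and the first two already add up to 1 + t.
    1<re-𝕖 : 1# < re (𝕖 (fromℝ t))
    1<re-𝕖 = <-≤-trans
      (<-respˡ (+-identityˡ 1#) (<-respʳ (+-comm _ _) (+-monoˡ-< 1# 0<re-1)))
      (limit-≥ (re-converges (𝕖-sums (fromℝ t))) 2 λ n 2≤n →
        ≤-respˡ (+-congʳ (+-identityˡ 1#)) (partialSum-mono (λ k → proj₁ (real-term k)) 2 2≤n))

  1<∣𝕖∣² : ∀ {z} → 0# < re z → 1# < ∣ 𝕖 z ∣²
  1<∣𝕖∣² {z} 0<re = <-respʳ (≈-trans
      (proj₁ (𝕖-cong {fromℝ (re z + re z)} {z +ᶜ conj z} (≈-refl , ≈-sym (-‿inverseʳ (im z)))))
      (≈-sym (∣𝕖∣² z)))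
    (1<re-𝕖 (<-respˡ (+-identityˡ 0#) (+-mono-< 0<re 0<re)))

  -- As e^z e^(-z) = 1, the number |e^z|² is the reciprocal of |e^(-z)|², which exceeds 1.
  ∣𝕖∣²<1 : ∀ {z} → re z < 0# → ∣ 𝕖 z ∣² < 1#
  ∣𝕖∣²<1 {z} re<0 = <-respˡ (≈-trans (*-identityʳ _) (≈-sym s≈r))
    (<-respʳ rt≈1 (*-monoˡ-< r (0<recip t 0<t) 1<t))
    where
    s = ∣ 𝕖 z ∣²
    t = ∣ 𝕖 (-ᶜ z) ∣²
    1<t : 1# < t
    1<t = 1<∣𝕖∣² (<-respˡ -0#≈0# (neg-mono-< re<0))
    0<t : 0# < t
    0<t = <-trans 0<1 1<t
    r = recip t 0<t
    rt≈1 : r * t ≈ 1#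
    rt≈1 = ≈-trans (*-comm r t) (recip-inverse t 0<t)
    st≈1 : s * t ≈ 1#
    st≈1 = ≈-trans (≈-sym (∣∣²-* (𝕖 z) (𝕖 (-ᶜ z))))
      (≈-trans (∣∣²-cong (≈ᶜ-trans (≈ᶜ-sym (𝕖-+ z (-ᶜ z))) (≈ᶜ-trans (𝕖-cong (ℂᴿ.-‿inverseʳ z)) 𝕖-0)))
        (≈-trans (+-cong (*-identityˡ 1#) (zeroˡ 0#)) (+-identityʳ 1#)))
    s≈r : s ≈ r
    s≈r = ≈-trans (≈-sym (*-identityʳ s)) (≈-trans (*-congˡ (≈-sym (recip-inverse t 0<t)))
      (≈-trans (≈-sym (*-assoc s t r)) (≈-trans (*-congʳ st≈1) (*-identityˡ r))))

  -- The constant π, integers as reals, Bernoulli's inequality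

  open CommutativeExp ℝ.commutativeSemiring using () renaming (^-distrib-* to ^ʳ-distrib-*)
  open Mult ℝ.semiring using (×ᵤ≈×)
  open Integers commutativeRing using (embed; embed-+; embed-*; embed-neg)

  -- Defs proves the convergence of Euler's series privately; unification
  -- recovers that proof from π.
  π⇒euler-converges : ∀ {h h′} →
    π ≡ proj₁ (complete (partialSum eulerTerm) h) + proj₁ (complete (partialSum eulerTerm) h′) →
    ∃[ l ] Converges (partialSum eulerTerm) l
  π⇒euler-converges {h} _ = complete (partialSum eulerTerm) h

  opaque
    euler-sum : ∃[ l ] Converges (partialSum eulerTerm) l
    euler-sum = π⇒euler-converges ≡.refl

  -- The number `π` with its convergence proof hidden; the two are shown equal by uniqueness of
  -- limits.
  ϖ : Carrier
  ϖ = proj₁ euler-sum + proj₁ euler-sum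

  0<ϖ : 0# < ϖ
  0<ϖ = <-respˡ (+-identityˡ 0#) (+-mono-< 0<l 0<l)
    where
    0≤eulerTerm : ∀ k → 0# ≤ eulerTerm k
    0≤eulerTerm zero    = 0≤1
    0≤eulerTerm (suc k) = *-nonneg (0≤eulerTerm k)
      (*-nonneg (0≤fromℕ (suc k)) (0≤1/suc (2 ℕ.+ (k ℕ.+ k))))
    0<l : 0# < proj₁ euler-sum
    0<l = <-≤-trans 0<1 (≤-respˡ (+-identityˡ 1#)
      (limit-≥ (proj₂ euler-sum) 1 λ n 1≤n → partialSum-mono 0≤eulerTerm 1 1≤n))

  -- `fromℤ` rests on the plain multiple of 1, `embed` on the optimised one; the homomorphism laws
  -- are carried over from the latter.
  fromℤ≈embed : ∀ i → fromℤ i ≈ embed i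
  fromℤ≈embed (+ n)    = ×ᵤ≈× n 1#
  fromℤ≈embed -[1+ n ] = -‿cong (×ᵤ≈× (suc n) 1#)

  fromℤ-+ : ∀ i j → fromℤ (i ℤ.+ j) ≈ fromℤ i + fromℤ j
  fromℤ-+ i j = ≈-trans (fromℤ≈embed (i ℤ.+ j)) (≈-trans (embed-+ i j)
    (≈-sym (+-cong (fromℤ≈embed i) (fromℤ≈embed j))))

  fromℤ-* : ∀ i j → fromℤ (i ℤ.* j) ≈ fromℤ i * fromℤ j
  fromℤ-* i j = ≈-trans (fromℤ≈embed (i ℤ.* j)) (≈-trans (embed-* i j)
    (≈-sym (*-cong (fromℤ≈embed i) (fromℤ≈embed j))))

  fromℤ-neg : ∀ i → fromℤ (ℤ.- i) ≈ - fromℤ i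
  fromℤ-neg i = ≈-trans (fromℤ≈embed (ℤ.- i)) (≈-trans (embed-neg i) (-‿cong (≈-sym (fromℤ≈embed i))))

  fromℤ-square : ∀ i → fromℤ i * fromℤ i ≈ fromℕ (ℤ.∣ i ∣ ℕ.* ℤ.∣ i ∣)
  fromℤ-square (+ n)    = ≈-trans (≈-sym (fromℤ-* (+ n) (+ n)))
    (ℝ.reflexive (cong fromℤ (≡.sym (ℤₚ.pos-* n n))))
  fromℤ-square -[1+ n ] = ≈-sym (fromℤ-* -[1+ n ] -[1+ n ])

  0<fromℤ : ∀ {i} → + 0 ℤ.< i → 0# < fromℤ i
  0<fromℤ {+ suc n} _ = 0<fromℕ-suc n
  0<fromℤ {+ zero} (ℤ.+<+ ())

  0≤^ʳ : ∀ {x} → 0# ≤ x → ∀ n → 0# ≤ x ^ʳ n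
  0≤^ʳ 0≤x zero    = 0≤1
  0≤^ʳ 0≤x (suc n) = *-nonneg 0≤x (0≤^ʳ 0≤x n)

  ^ʳ≤1 : ∀ {x} → 0# ≤ x → x ≤ 1# → ∀ n → x ^ʳ n ≤ 1#
  ^ʳ≤1 0≤x x≤1 zero    = ≤-refl
  ^ʳ≤1 0≤x x≤1 (suc n) = ≤-respʳ (*-identityˡ 1#) (*-mono-≤ 0≤1 (0≤^ʳ 0≤x n) x≤1 (^ʳ≤1 0≤x x≤1 n))

  -- The left side is 1 at n = 0 and no step raises it. This product form of Bernoulli's inequality
  -- gives an explicit rate of decay without dividing by ρ.
  bernoulli : ∀ {ρ} → 0# ≤ ρ → ∀ n → ρ ^ʳ n * (1# + fromℕ n * (1# - ρ)) ≤ 1#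
  bernoulli {ρ} 0≤ρ zero    = ≤-reflexive (≈-trans (*-identityˡ _)
    (≈-trans (+-congˡ (zeroˡ _)) (+-identityʳ 1#)))
  bernoulli {ρ} 0≤ρ (suc n) = ≤-trans
    (≤-by-difference
      (*-nonneg (0≤^ʳ 0≤ρ n) (*-nonneg (0≤fromℕ (suc n)) (0≤square (1# - ρ))))
      (ℝ-Identities.bernoulli-step ρ (ρ ^ʳ n) (fromℕ n)))
    (bernoulli 0≤ρ n)

  -- Real powers of q

  exponent : ℂ → Carrier → ℂ
  exponent τ r = fromℝ ϖ *ᶜ 𝕚 *ᶜ fromℝ r *ᶜ τ

  opaque
    q : ℂ → Carrier → ℂ
    q τ r = 𝕖 (exponent τ r)

    -- The link by which `q`, although opaque, is later identified with `qpow`: both are limits of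
    -- the same series.
    q-sums : ∀ τ r → Sums (expTerm (exponent τ r)) (q τ r)
    q-sums τ r = 𝕖-sums (exponent τ r)

  re-exponent : ∀ τ r → re (exponent τ r) ≈ - (ϖ * r * im τ)
  re-exponent τ r = ℝ-Identities.re-exponent ϖ r (re τ) (im τ)

  module _ (τ : ℂ) where

    opaque
      unfolding q

      q-cong : ∀ {r s} → r ≈ s → q τ r ≈ᶜ q τ s
      q-cong r≈s = 𝕖-cong (ℂᴿ.*-congʳ (ℂᴿ.*-congˡ (fromℝ-cong r≈s)))

      q-+ : ∀ r s → q τ (r + s) ≈ᶜ q τ r *ᶜ q τ s
      q-+ r s = ≈ᶜ-trans
        (𝕖-cong (≈ᶜ-trans (ℂᴿ.*-congʳ (ℂᴿ.*-congˡ (fromℝ-+ r s)))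
          (ℂ-Identities.p[x+y]t≈pxt+pyt (fromℝ ϖ *ᶜ 𝕚) (fromℝ r) (fromℝ s) τ)))
        (𝕖-+ (exponent τ r) (exponent τ s))

      q-0 : q τ 0# ≈ᶜ 1ᶜ
      q-0 = ≈ᶜ-trans (𝕖-cong (≈ᶜ-trans (ℂᴿ.*-congʳ (ℂᴿ.zeroʳ (fromℝ ϖ *ᶜ 𝕚))) (ℂᴿ.zeroˡ τ))) 𝕖-0

      ∣q∣²<1 : 0# < im τ → ∀ {r} → 0# < r → ∣ q τ r ∣² < 1#
      ∣q∣²<1 0<τ {r} 0<r = ∣𝕖∣²<1 (<-respˡ (≈-sym (re-exponent τ r))
        (<-respʳ -0#≈0# (neg-mono-< (*-pos (*-pos 0<ϖ 0<r) 0<τ))))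

    q-*fromℕ : ∀ a n → q τ (a * fromℕ n) ≈ᶜ q τ a ^ n
    q-*fromℕ a zero    = ≈ᶜ-trans (q-cong (zeroʳ a)) q-0
    q-*fromℕ a (suc n) = ≈ᶜ-trans (q-cong (≈-trans (distribˡ a 1# (fromℕ n)) (+-congʳ (*-identityʳ a))))
      (≈ᶜ-trans (q-+ a (a * fromℕ n)) (ℂᴿ.*-congˡ (q-*fromℕ a n)))

  -- Gaussian series

  -- At most geometric growth in both directions: the class of coefficients that a factor ρ^(j²)
  -- with ρ < 1 makes summable.
  record Growth (g : ℤ → ℂ) : Set (c ⊔ ℓ₂) where
    field
      constant rate : Carrier
      0≤rate        : 0# ≤ rate
      growth-bound  : ∀ j → ∥ g j ∥≤ constant * rate ^ʳ ℤ.∣ j ∣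
  open Growth

  Growth-* : ∀ {g h} → Growth g → Growth h → Growth (λ j → g j *ᶜ h j)
  Growth-* {g} {h} G H = record
    { constant = constant G * constant H
    ; rate = rate G * rate H
    ; 0≤rate = *-nonneg (0≤rate G) (0≤rate H)
    ; growth-bound = λ j → ∥∥≤-resp ≈ᶜ-refl
        (≈-trans (ℝ-Identities.[xy][zw]≈[xz][yw] _ _ _ _)
          (*-congˡ (≈-sym (^ʳ-distrib-* (rate G) (rate H) ℤ.∣ j ∣))))
        (∥∥≤-* (growth-bound G j) (growth-bound H j))
    }

  Growth-neg : ∀ {g} → Growth g → Growth (λ j → g (ℤ.- j))
  Growth-neg {g} G = record
    { constant = constant G ; rate = rate G ; 0≤rate = 0≤rate G
    ; growth-bound = λ j → ≡.subst (λ n → ∥ g (ℤ.- j) ∥≤ constant G * rate G ^ʳ n)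
        (ℤₚ.∣-i∣≡∣i∣ j) (growth-bound G (ℤ.- j))
    }

  -- The two directions have separate bases, negative powers being powers of an inverse; a single
  -- rate dominates both.
  Growth-powers : ∀ {g u v} → (∀ n → g (+ n) ≈ᶜ u ^ n) → (∀ n → g -[1+ n ] ≈ᶜ v ^ suc n) → Growth g
  Growth-powers {g} {u} {v} g≈u g≈v = record
    { constant = 1# ; rate = W ; 0≤rate = bound-nonneg u≤W
    ; growth-bound = λ where
        (+ n)    → ∥∥≤-resp (≈ᶜ-sym (g≈u n)) (≈-sym (*-identityˡ _)) (∥∥≤-^ u≤W n)
        -[1+ n ] → ∥∥≤-resp (≈ᶜ-sym (g≈v n)) (≈-sym (*-identityˡ _)) (∥∥≤-^ v≤W (suc n))
    }
    where
    W : Carrier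
    W = (1# + ∣ u ∣²) + (1# + ∣ v ∣²)
    u≤W : ∥ u ∥≤ W
    u≤W = ∥∥≤-mono (≤-by-difference (bound-nonneg (∥∥≤-exists v)) ≈-refl) (∥∥≤-exists u)
    v≤W : ∥ v ∥≤ W
    v≤W = ∥∥≤-mono (≤-by-difference (bound-nonneg (∥∥≤-exists u)) (+-comm _ _)) (∥∥≤-exists v)

  Growth-const : ∀ z → Growth (λ _ → z)
  Growth-const z = record
    { constant = 1# + ∣ z ∣² ; rate = 1# ; 0≤rate = 0≤1
    ; growth-bound = λ j → ∥∥≤-resp ≈ᶜ-refl
        (≈-sym (≈-trans (*-congˡ (1^n≈1 ℤ.∣ j ∣)) (*-identityʳ _))) (∥∥≤-exists z)
    }
    where
    1^n≈1 : ∀ n → 1# ^ʳ n ≈ 1#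
    1^n≈1 zero    = ≈-refl
    1^n≈1 (suc n) = ≈-trans (*-identityˡ _) (1^n≈1 n)

  Growth-q : ∀ τ a → Growth (λ j → q τ (a * fromℤ j))
  Growth-q τ a = Growth-powers {u = q τ a} {q τ (- a)} (q-*fromℕ τ a)
    (λ n → ≈ᶜ-trans (q-cong τ (≈-trans (≈-sym (-‿distribʳ-* a _)) (-‿distribˡ-* a _)))
      (q-*fromℕ τ (- a) (suc n)))

  Growth-zpow : ∀ z (z≢0 : NonZero z) → Growth (zpow z z≢0)
  Growth-zpow z z≢0 = Growth-powers {u = z} {inverse z z≢0} (λ _ → ≈ᶜ-refl) (λ _ → ≈ᶜ-refl)

  module _ {ρ : Carrier} (0≤ρ : 0# ≤ ρ) (ρ<1 : ρ < 1#)
           {C W : Carrier} (0≤C : 0# ≤ C) (0≤W : 0# ≤ W) where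

    private
      h : Carrier
      h = 1# - ρ

      0<h : 0# < h
      0<h = <-respˡ (-‿inverseʳ ρ) (+-monoˡ-< (- ρ) ρ<1)

    gaussianBound : ℕ → Carrier
    gaussianBound n = ρ ^ʳ (n ℕ.* n) * (C * W ^ʳ n)

    private
      0≤gaussianBound : ∀ n → 0# ≤ gaussianBound n
      0≤gaussianBound n = *-nonneg (0≤^ʳ 0≤ρ (n ℕ.* n)) (*-nonneg 0≤C (0≤^ʳ 0≤W n))

    -- With h = 1 - ρ, every n ≥ 2 W / h satisfies 2 W ≤ 1 + n h, whence ρ^n 2 W ≤ 1 by Bernoulli's
    -- inequality.
    gaussianStart : ℕ
    gaussianStart = proj₁ (archimedean ((W + W) * recip h 0<h))

    private
      W+W≤ : ∀ n → gaussianStart ℕ.≤ n → W + W ≤ 1# + fromℕ n * h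
      W+W≤ n N≤n = ≤-trans
        (≤-respˡ (≈-trans (*-assoc _ _ _)
            (≈-trans (*-congˡ (≈-trans (*-comm _ _) (recip-inverse h 0<h))) (*-identityʳ _)))
          (*-monoʳ-≤ h (<⇒≤ 0<h) (≤-trans (<⇒≤ (proj₂ (archimedean ((W + W) * recip h 0<h))))
            (fromℕ-mono-≤ N≤n))))
        (≤-by-difference 0≤1 (+-comm _ _))

      ρⁿ[W+W]≤1 : ∀ n → gaussianStart ℕ.≤ n → ρ ^ʳ n * (W + W) ≤ 1#
      ρⁿ[W+W]≤1 n N≤n = ≤-trans (*-monoˡ-≤ (ρ ^ʳ n) (0≤^ʳ 0≤ρ n) (W+W≤ n N≤n)) (bernoulli 0≤ρ n)

      gaussianBound-suc : ∀ n → gaussianBound (suc n) + gaussianBound (suc n) ≈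
                          gaussianBound n * (ρ ^ʳ n * (W + W)) * ρ ^ʳ suc n
      gaussianBound-suc n = ≈-trans
        (+-cong (*-congʳ expand) (*-congʳ expand))
        (ℝ-Identities.gaussian-step (ρ ^ʳ (n ℕ.* n)) (ρ ^ʳ n) (ρ ^ʳ suc n) C W (W ^ʳ n))
        where
        expand : ρ ^ʳ (suc n ℕ.* suc n) ≈ ρ ^ʳ (n ℕ.* n) * ρ ^ʳ n * ρ ^ʳ suc n
        expand = ≈-trans (^ʳ-congʳ ρ (suc-square n))
          (≈-trans (^ʳ-homo-* ρ (n ℕ.* n ℕ.+ n) (suc n)) (*-congʳ (^ʳ-homo-* ρ (n ℕ.* n) n)))

    -- Since (n + 1)² = n² + n + (n + 1), one step multiplies the bound by ρ^n W and by ρ^(n+1).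
    -- Twice the former is at most 1 from the chosen index on, and the latter is at most 1.
    gaussianBound-halving : ∀ n → gaussianStart ℕ.≤ n →
                            gaussianBound (suc n) + gaussianBound (suc n) ≤ gaussianBound n
    gaussianBound-halving n N≤n = ≤-resp (≈-sym (gaussianBound-suc n))
      (≈-trans (*-identityʳ _) (*-identityʳ _))
      (*-mono-≤ (*-nonneg (0≤gaussianBound n) 0≤1) (0≤^ʳ 0≤ρ (suc n))
        (*-monoˡ-≤ (gaussianBound n) (0≤gaussianBound n) (ρⁿ[W+W]≤1 n N≤n))
        (^ʳ≤1 0≤ρ (<⇒≤ ρ<1) (suc n)))

  -- For s = |p|² the mean ρ = (1 + s)/2 is below 1, and s ≤ ρ² by the inequality of arithmetic and
  -- geometric means. So ρ bounds |p| without a square root.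
  norm<1 : ∀ {p} → ∣ p ∣² < 1# → ∃[ ρ ] 0# ≤ ρ × ρ < 1# × ∥ p ∥≤ ρ
  norm<1 {p} s<1 = ρ , 0≤ρ , ρ<1 , norm 0≤ρ (≤-by-difference (0≤square (half (1# - s)))
    (≈-trans (+-congʳ (≈-trans (≈-sym (*-identityˡ s)) (*-congʳ (≈-sym four-quarters))))
      (ℝ-Identities.mean-square ½ 1# s)))
    where
    s = ∣ p ∣²
    ρ = half (1# + s)
    0≤ρ : 0# ≤ ρ
    0≤ρ = *-nonneg (0≤1/suc 1) (+-nonneg 0≤1 (0≤∣∣² p))
    ρ<1 : ρ < 1#
    ρ<1 = <-respʳ (≈-trans (distribˡ ½ 1# 1#) (half+half 1#))
      (*-monoˡ-< ½ (0<recip _ _) (<-respˡ (+-comm s 1#) (+-monoˡ-< 1# s<1)))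
    four-quarters : (½ + ½) * (½ + ½) * 1# ≈ 1#
    four-quarters = ≈-trans (*-identityʳ _) (≈-trans (*-cong ½+½≈1 ½+½≈1) (*-identityˡ 1#))

  Sums-ℤ : ∀ {f : ℤ → ℂ} {s t} → Sums (λ n → f (+ n)) s → Sums (λ n → f -[1+ n ]) t → Sums f (s +ᶜ t)
  Sums-ℤ {f} S T = Sums-reindex {f = f} to from
    (λ where (+ n) → ≡.refl
             -[1+ n ] → ≡.refl)
    (λ where (inj₁ n) → ≡.refl
             (inj₂ n) → ≡.refl)
    (Sums-⊎ {f = f ∘ to} S T)
    where
    to : ℕ ⊎ ℕ → ℤ
    to (inj₁ n) = + n
    to (inj₂ n) = -[1+ n ]
    from : ℤ → ℕ ⊎ ℕ
    from (+ n)    = inj₁ n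
    from -[1+ n ] = inj₂ n

  module _ {τ : ℂ} (0<τ : 0# < im τ) {a : Carrier} (0<a : 0# < a) {g : ℤ → ℂ} (G : Growth g) where

    private
      term : ℤ → ℂ
      term j = q τ (a * (fromℤ j * fromℤ j)) *ᶜ g j

      sums : (∃[ ρ ] 0# ≤ ρ × ρ < 1# × ∥ q τ a ∥≤ ρ) → ∃[ s ] Sums term s
      sums (ρ , 0≤ρ , ρ<1 , p≤ρ) =
        (proj₁ positive +ᶜ proj₁ negative) , Sums-ℤ (proj₂ positive) (proj₂ negative)
        where
        0≤C : 0# ≤ constant G
        -- At j = 0 the growth bound is the constant itself, and any bound of a modulus is
        -- nonnegative.
        0≤C = ≤-respʳ (*-identityʳ _) (bound-nonneg (growth-bound G (+ 0)))
        b : ℕ → Carrier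
        b = gaussianBound 0≤ρ ρ<1 0≤C (0≤rate G)
        halving : ∀ n → gaussianStart 0≤ρ ρ<1 0≤C (0≤rate G) ℕ.≤ n → b (suc n) + b (suc n) ≤ b n
        halving = gaussianBound-halving 0≤ρ ρ<1 0≤C (0≤rate G)
        term≤b : ∀ j → ∥ term j ∥≤ b ℤ.∣ j ∣
        term≤b j = ∥∥≤-* (∥∥≤-respᶜ
          (≈ᶜ-sym (≈ᶜ-trans (q-cong τ (*-congˡ (fromℤ-square j))) (q-*fromℕ τ a (ℤ.∣ j ∣ ℕ.* ℤ.∣ j ∣))))
          (∥∥≤-^ p≤ρ (ℤ.∣ j ∣ ℕ.* ℤ.∣ j ∣))) (growth-bound G j)
        positive : ∃[ s ] Sums (λ n → term (+ n)) s
        positive = Sums-ℕ-exists {b = b} (λ n → term≤b (+ n)) _ halving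
        negative : ∃[ s ] Sums (λ n → term -[1+ n ]) s
        -- The index -[1+ n ] has absolute value n + 1, so the bound is shifted by one.
        negative = Sums-ℕ-exists {b = λ n → b (suc n)} (λ n → term≤b -[1+ n ]) _
          (λ n N≤n → halving (suc n) (ℕₚ.m≤n⇒m≤1+n N≤n))

    opaque
      gaussian : ∃[ s ] Sums term s
      gaussian = sums (norm<1 (∣q∣²<1 τ 0<τ 0<a))

  -- Integer powers and the four double series

  module _ (z : ℂ) (z≢0 : NonZero z) where
    private
      w : ℂ
      w = inverse z z≢0

    *-inverse : z *ᶜ w ≈ᶜ 1ᶜ
    *-inverse =
      ≈-trans (ℝ-Identities.re-*-inverse (re z) (im z) (recip ∣ z ∣² z≢0)) (recip-inverse ∣ z ∣² z≢0) ,
      ℝ-Identities.im-*-inverse (re z) (im z) (recip ∣ z ∣² z≢0)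

    private
      zpow-⊖ : ∀ m n → zpow z z≢0 (m ℤ.⊖ n) ≈ᶜ z ^ m *ᶜ w ^ n
      zpow-⊖ m       zero    = ≈ᶜ-sym (ℂᴿ.*-identityʳ (z ^ m))
      zpow-⊖ zero    (suc n) = ≈ᶜ-sym (ℂᴿ.*-identityˡ (w ^ suc n))
      zpow-⊖ (suc m) (suc n) = ≈ᶜ-trans (ℂᴿ.reflexive (cong (zpow z z≢0) (ℤₚ.[1+m]⊖[1+n]≡m⊖n m n)))
        (≈ᶜ-trans (zpow-⊖ m n) (≈ᶜ-sym (≈ᶜ-trans (ℂ-Identities.[xy][zw]≈[xz][yw] z (z ^ m) w (w ^ n))
          (≈ᶜ-trans (ℂᴿ.*-congʳ *-inverse) (ℂᴿ.*-identityˡ _)))))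

    zpow-+ : ∀ i j → zpow z z≢0 (i ℤ.+ j) ≈ᶜ zpow z z≢0 i *ᶜ zpow z z≢0 j
    zpow-+ (+ m)    (+ n)    = ^-homo-* z m n
    zpow-+ (+ m)    -[1+ n ] = zpow-⊖ m (suc n)
    zpow-+ -[1+ m ] (+ n)    = ≈ᶜ-trans (zpow-⊖ n (suc m)) (ℂᴿ.*-comm _ _)
    zpow-+ -[1+ m ] -[1+ n ] = ≈ᶜ-trans
      (^-congʳ w (cong suc (≡.sym (ℕₚ.+-suc m n)))) (^-homo-* w (suc m) (suc n))

    zpow-1+double : ∀ k → zpow z z≢0 (+ 1 ℤ.+ (k ℤ.+ k)) ≈ᶜ z *ᶜ (zpow z z≢0 k *ᶜ zpow z z≢0 k)
    zpow-1+double k = ≈ᶜ-trans (zpow-+ (+ 1) (k ℤ.+ k)) (ℂᴿ.*-cong (ℂᴿ.*-identityʳ z) (zpow-+ k k))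

  private
    -1^[n+n] : ∀ n → (-ᶜ 1ᶜ) ^ (n ℕ.+ n) ≈ᶜ 1ᶜ
    -1^[n+n] zero    = ≈ᶜ-refl
    -1^[n+n] (suc n) = ≈ᶜ-trans (^-congʳ (-ᶜ 1ᶜ) (cong suc (ℕₚ.+-suc n n)))
      (≈ᶜ-trans (ℂ-Identities.-1*[-1*x]≈x _) (-1^[n+n] n))

  sgn-even : ∀ k → sgn (k ℤ.+ k) ≈ᶜ 1ᶜ
  sgn-even (+ n)    = -1^[n+n] n
  sgn-even -[1+ n ] = ≈ᶜ-trans (ℂ-Identities.-1*[-1*x]≈x _) (-1^[n+n] n)

  sgn-odd : ∀ k → sgn (+ 1 ℤ.+ (k ℤ.+ k)) ≈ᶜ -ᶜ 1ᶜ
  sgn-odd (+ n)    = ≈ᶜ-trans (ℂᴿ.*-congˡ (-1^[n+n] n)) (ℂᴿ.*-identityʳ _)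
  -- The number 1 - 2 (n + 1) has absolute value 2 n + 1, as in the case above.
  sgn-odd -[1+ n ] = ≈ᶜ-trans (ℂᴿ.*-congˡ (-1^[n+n] n)) (ℂᴿ.*-identityʳ _)

  -- The splitting by the parity of n: the two hypotheses are the even and the odd part in the new
  -- variables.
  Sums-unshear : ∀ e {f : ℤ × ℤ → ℂ} {s t} →
    Sums (λ x → f (unshear e (inj₁ x))) s → Sums (λ x → f (unshear e (inj₂ x))) t → Sums f (s +ᶜ t)
  Sums-unshear e {f} S T = Sums-reindex {f = f} (unshear e) (shear e) (unshear-shear e) (shear-unshear e)
    (Sums-⊎ {f = f ∘ unshear e} S T)

  module _
    {α β : ℤ} (0<α : + 0 ℤ.< α) (α<4β : α ℤ.< + 4 ℤ.* β)
    (τ : ℂ) (0<τ : 0# < im τ)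
    (x y √x : ℂ) (x≢0 : NonZero x) (y≢0 : NonZero y) (√x²≈x : √x *ᶜ √x ≈ᶜ x)
    where

    private
      γ : ℤ
      γ = + 4 ℤ.* β ℤ.- α

      A B G : Carrier
      A = fromℤ α
      B = fromℤ β
      G = fromℤ γ

      0<A : 0# < A
      0<A = 0<fromℤ 0<α

      -- With α > 0 this is the positive definiteness of the quadratic form; it makes the series in
      -- v converge.
      0<G : 0# < G
      0<G = 0<fromℤ (≡.subst (ℤ._< γ) (ℤₚ.+-inverseʳ α) (ℤₚ.+-monoˡ-< (ℤ.- α) α<4β))

      G≈4B-A : G ≈ (B + B + B + B) - A
      G≈4B-A = ≈-trans (fromℤ-+ (+ 4 ℤ.* β) (ℤ.- α)) (+-cong
        (≈-trans (fromℤ-* (+ 4) β) (ℝ-Identities.four* B)) (fromℤ-neg α))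

      X Y : ℤ → ℂ
      X = zpow x x≢0
      Y = zpow y y≢0

      x⁻¹ : ℂ
      x⁻¹ = inverse x x≢0

      -- The coefficients of q ^ (α u²) and q ^ ((4 β - α) v²); the index says
      -- whether the variable is an integer or shifted by 1/2.
      a₀ a₁ b₀ b₁ : ℤ → ℂ
      a₀ j = X j
      a₁ j = X j *ᶜ √x
      b₀ k = X (ℤ.- k) *ᶜ (Y k *ᶜ Y k)
      b₁ k = (X (ℤ.- k) *ᶜ (x⁻¹ *ᶜ √x)) *ᶜ (y *ᶜ (Y k *ᶜ Y k))

      square square½ : ℤ → Carrier
      square  j = fromℤ j * fromℤ j
      square½ j = (fromℤ j + ½) * (fromℤ j + ½)

      Growth-X : Growth X
      Growth-X = Growth-zpow x x≢0

      Growth-YY : Growth (λ k → Y k *ᶜ Y k)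
      Growth-YY = Growth-* (Growth-zpow y y≢0) (Growth-zpow y y≢0)

      integral : ∀ {a} → 0# < a → ∀ {g} → Growth g → ∃[ s ] Sums (λ j → q τ (a * square j) *ᶜ g j) s
      integral 0<a G = gaussian 0<τ 0<a G

      -- As (j + 1/2)² = j² + j + 1/4, the shifted series is an unshifted one whose coefficients
      -- absorb q^(a j) q^(a/4), and these still grow at most geometrically.
      half-integral : ∀ {a} → 0# < a → ∀ {g} → Growth g → ∃[ s ] Sums (λ j → q τ (a * square½ j) *ᶜ g j) s
      half-integral {a} 0<a {g} G = proj₁ shifted , Sums-cong unshift (proj₂ shifted)
        where
        shifted = gaussian 0<τ 0<a (Growth-* (Growth-* (Growth-q τ a) (Growth-const (q τ (a * (½ * ½))))) G)
        unshift : ∀ j → q τ (a * square j) *ᶜ ((q τ (a * fromℤ j) *ᶜ q τ (a * (½ * ½))) *ᶜ g j) ≈ᶜ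
                        q τ (a * square½ j) *ᶜ g j
        unshift j = ≈ᶜ-trans (≈ᶜ-sym (ℂᴿ.*-assoc (q τ (a * square j)) _ (g j))) (ℂᴿ.*-congʳ {g j} (≈ᶜ-sym
          (≈ᶜ-trans (q-cong τ (≈-trans (*-congˡ (ℝ-Identities.[j+h]² (fromℤ j) ½ ½+½≈1))
              (ℝ-Identities.a[x+[y+z]] a _ _ _)))
            (≈ᶜ-trans (q-+ τ (a * square j) (a * fromℤ j + a * (½ * ½)))
              (ℂᴿ.*-congˡ (q-+ τ (a * fromℤ j) (a * (½ * ½))))))))

      ΣA₀ = integral 0<A {a₀} Growth-X
      ΣA₁ = half-integral 0<A {a₁} (Growth-* Growth-X (Growth-const √x))
      ΣB₀ = integral 0<G {b₀} (Growth-* (Growth-neg Growth-X) Growth-YY)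
      ΣB₁ = half-integral 0<G {b₁} (Growth-*
        (Growth-* (Growth-neg Growth-X) (Growth-const (x⁻¹ *ᶜ √x))) (Growth-* (Growth-const y) Growth-YY))

      A₀ A₁ B₀ B₁ : ℂ
      A₀ = proj₁ ΣA₀
      A₁ = proj₁ ΣA₁
      B₀ = proj₁ ΣB₀
      B₁ = proj₁ ΣB₁

      Factored : (ℤ → Carrier) → (ℤ → ℂ) → (ℤ → Carrier) → (ℤ → ℂ) → ℤ × ℤ → ℂ
      Factored r a s b (j , k) = (q τ (A * r j) *ᶜ a j) *ᶜ (q τ (G * s k) *ᶜ b k)

      split : ∀ {Q r s X X₁ X₂ Y Y′} → Q ≈ r + s → X ≈ᶜ X₁ *ᶜ X₂ → Y ≈ᶜ Y′ →
              (q τ r *ᶜ X₁) *ᶜ (q τ s *ᶜ (X₂ *ᶜ Y′)) ≈ᶜ q τ Q *ᶜ X *ᶜ Y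
      split {r = r} {s} {X₁ = X₁} {X₂} {Y′ = Y′} Q≈ X≈ Y≈ = ≈ᶜ-trans
        (ℂ-Identities.regroup (q τ r) X₁ (q τ s) X₂ Y′)
        (≈ᶜ-sym (ℂᴿ.*-cong (ℂᴿ.*-cong (≈ᶜ-trans (q-cong τ Q≈) (q-+ τ r s)) X≈) Y≈))

      quad≈ : ∀ {u u′ v v′ r s} → u ≈ u′ → v ≈ v′ →
        A * (u′ * u′) + A * u′ * v′ + B * (v′ * v′) ≈ A * r + ((B + B + B + B) - A) * s →
        quad α β u v ≈ A * r + G * s
      quad≈ u≈ v≈ e = ≈-trans
        (+-cong (+-cong (*-congˡ (*-cong u≈ u≈)) (*-cong (*-congˡ u≈) v≈)) (*-congˡ (*-cong v≈ v≈)))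
        (≈-trans e (+-congˡ (*-congʳ (≈-sym G≈4B-A))))

      fromℤ-minus : ∀ i j → fromℤ (i ℤ.- j) ≈ fromℤ i - fromℤ j
      fromℤ-minus i j = ≈-trans (fromℤ-+ i (ℤ.- j)) (+-congˡ (fromℤ-neg j))

      -- Brings the integer 1 into the form in which the polynomial identities contain it.
      fromℤ-1 : fromℤ (+ 1) ≈ ½ + ½
      fromℤ-1 = ≈-trans (+-identityʳ 1#) (≈-sym ½+½≈1)

      fromℤ-odd : ∀ k → fromℤ (+ 1 ℤ.+ (k ℤ.+ k)) ≈ (½ + ½) + (fromℤ k + fromℤ k)
      fromℤ-odd k = ≈-trans (fromℤ-+ (+ 1) (k ℤ.+ k)) (+-cong fromℤ-1 (fromℤ-+ k k))

      -- In `b₁` the power x^(-k-1/2) is written x^(-k) x⁻¹ √x. The two roots multiply to x, which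
      -- the factor x⁻¹ cancels.
      X-odd : ∀ j k → (X j *ᶜ √x) *ᶜ (X (ℤ.- k) *ᶜ (x⁻¹ *ᶜ √x)) ≈ᶜ X j *ᶜ X (ℤ.- k)
      X-odd j k = ≈ᶜ-trans (ℂ-Identities.gather (X j) √x (X (ℤ.- k)) x⁻¹)
        (≈ᶜ-trans (ℂᴿ.*-congˡ (≈ᶜ-trans (ℂᴿ.*-congʳ √x²≈x) (*-inverse x x≢0))) (ℂᴿ.*-identityʳ _))

      integral-even : ∀ x → Factored square a₀ square b₀ x ≈ᶜ
        (let m , n = unshear (+ 0) (inj₁ x) in q τ (quad α β (fromℤ m) (fromℤ n)) *ᶜ X m *ᶜ Y n)
      integral-even (j , k) = split
        (quad≈ (fromℤ-minus j k) (fromℤ-+ k k) (ℝ-Identities.quad-integral-even A B (fromℤ j) (fromℤ k)))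
        (zpow-+ x x≢0 j (ℤ.- k)) (zpow-+ y y≢0 k k)

      integral-odd : ∀ x → Factored square½ a₁ square½ b₁ x ≈ᶜ
        (let m , n = unshear (+ 0) (inj₂ x) in q τ (quad α β (fromℤ m) (fromℤ n)) *ᶜ X m *ᶜ Y n)
      integral-odd (j , k) = split
        -- The substitution subtracts e even when e = 0; the vanishing term is removed here and in
        -- the power of x.
        (quad≈ (≈-trans (ℝ.reflexive (cong fromℤ (ℤₚ.+-identityʳ (j ℤ.- k)))) (fromℤ-minus j k)) (fromℤ-odd k)
          (ℝ-Identities.quad-integral-odd A B (fromℤ j) (fromℤ k) ½))
        (≈ᶜ-trans (ℂᴿ.reflexive (cong X (ℤₚ.+-identityʳ (j ℤ.- k))))
          (≈ᶜ-trans (zpow-+ x x≢0 j (ℤ.- k)) (≈ᶜ-sym (X-odd j k))))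
        (zpow-1+double y y≢0 k)

      half-even : ∀ x → Factored square½ a₁ square b₀ x ≈ᶜ
        (let m , n = unshear (+ 1) (inj₁ x) in q τ (quad α β (fromℤ m + ½) (fromℤ n)) *ᶜ (X m *ᶜ √x) *ᶜ Y n)
      half-even (j , k) = split
        (quad≈ (+-congʳ (fromℤ-minus j k)) (fromℤ-+ k k)
          (ℝ-Identities.quad-half-even A B (fromℤ j) (fromℤ k) ½))
        (≈ᶜ-trans (ℂᴿ.*-congʳ (zpow-+ x x≢0 j (ℤ.- k))) (ℂ-Identities.xy∙z≈xz∙y (X j) (X (ℤ.- k)) √x))
        (zpow-+ y y≢0 k k)

      half-odd : ∀ x → Factored square a₀ square½ b₁ x ≈ᶜ
        (let m , n = unshear (+ 1) (inj₂ x) in q τ (quad α β (fromℤ m + ½) (fromℤ n)) *ᶜ (X m *ᶜ √x) *ᶜ Y n)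
      half-odd (j , k) = split
        (quad≈ (+-congʳ (≈-trans (fromℤ-minus (j ℤ.- k) (+ 1)) (+-cong (fromℤ-minus j k) (-‿cong fromℤ-1))))
          (fromℤ-odd k) (ℝ-Identities.quad-half-odd A B (fromℤ j) (fromℤ k) ½))
        -- The shift by e = 1 puts m at j - k - 1; its factor x⁻¹ is the one contained in `b₁`, and
        -- the single root is that of x^(m + 1/2).
        (≈ᶜ-trans (ℂᴿ.*-congʳ (≈ᶜ-trans (zpow-+ x x≢0 (j ℤ.- k) (ℤ.- + 1))
            (ℂᴿ.*-cong (zpow-+ x x≢0 j (ℤ.- k)) (ℂᴿ.*-identityʳ x⁻¹))))
          (ℂ-Identities.reassociate (X j) (X (ℤ.- k)) x⁻¹ √x))
        (zpow-1+double y y≢0 k)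

      f₀ f½ : ℤ × ℤ → ℂ
      f₀ (m , n) = q τ (quad α β (fromℤ m) (fromℤ n)) *ᶜ X m *ᶜ Y n
      f½ (m , n) = q τ (quad α β (fromℤ m + ½) (fromℤ n)) *ᶜ (X m *ᶜ √x) *ᶜ Y n

      product : ∀ {f g : ℤ → ℂ} {s t} → Sums f s → Sums g t → Sums (λ (j , k) → f j *ᶜ g k) (s *ᶜ t)
      product = Sums-× ℤₚ._≟_ ℤₚ._≟_

      even₀ : Sums (λ x → f₀ (unshear (+ 0) (inj₁ x))) (A₀ *ᶜ B₀)
      even₀ = Sums-cong integral-even (product (proj₂ ΣA₀) (proj₂ ΣB₀))

      odd₀ : Sums (λ x → f₀ (unshear (+ 0) (inj₂ x))) (A₁ *ᶜ B₁)
      odd₀ = Sums-cong integral-odd (product (proj₂ ΣA₁) (proj₂ ΣB₁))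

      even½ : Sums (λ x → f½ (unshear (+ 1) (inj₁ x))) (A₁ *ᶜ B₀)
      even½ = Sums-cong half-even (product (proj₂ ΣA₁) (proj₂ ΣB₀))

      odd½ : Sums (λ x → f½ (unshear (+ 1) (inj₂ x))) (A₀ *ᶜ B₁)
      odd½ = Sums-cong half-odd (product (proj₂ ΣA₀) (proj₂ ΣB₁))

      signed-even : ∀ {a u v} k → a *ᶜ u *ᶜ v ≈ᶜ sgn (k ℤ.+ k) *ᶜ a *ᶜ u *ᶜ v
      signed-even {a} k =
        ℂᴿ.*-congʳ (ℂᴿ.*-congʳ (≈ᶜ-sym (≈ᶜ-trans (ℂᴿ.*-congʳ (sgn-even k)) (ℂᴿ.*-identityˡ a))))

      signed-odd : ∀ {a u v} k → -ᶜ (a *ᶜ u *ᶜ v) ≈ᶜ sgn (+ 1 ℤ.+ (k ℤ.+ k)) *ᶜ a *ᶜ u *ᶜ v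
      signed-odd {a} {u} {v} k = ≈ᶜ-trans (ℂ-Identities.-[auv]≈-1auv a u v)
        (ℂᴿ.*-congʳ (ℂᴿ.*-congʳ (ℂᴿ.*-congʳ (≈ᶜ-sym (sgn-odd k)))))

      negate : ∀ {I : Set} {f : I → ℂ} {s} → Sums f s → Sums (λ i → -ᶜ f i) (-ᶜ s)
      negate = IsAdditiveIsometry.Sums-isometry neg-isometry

    opaque
      -- The theorem for the twin `q` and for dominated sums. The sign (-1)^n is constant on each
      -- parity class, so it merely negates the odd part. Opacity keeps the four sums from unfolding
      -- in the transfer to `qpow`.
      theta-identity : ∃[ S₁ ] ∃[ S₂ ] ∃[ S₃ ] ∃[ S₄ ]
        Sums (λ ((m , n) : ℤ × ℤ) →
          sgn n *ᶜ q τ (quad α β (fromℤ m + ½) (fromℤ n)) *ᶜ (zpow x x≢0 m *ᶜ √x) *ᶜ zpow y y≢0 n) S₁ ×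
        Sums (λ ((m , n) : ℤ × ℤ) →
          q τ (quad α β (fromℤ m) (fromℤ n)) *ᶜ zpow x x≢0 m *ᶜ zpow y y≢0 n) S₂ ×
        Sums (λ ((m , n) : ℤ × ℤ) →
          sgn n *ᶜ q τ (quad α β (fromℤ m) (fromℤ n)) *ᶜ zpow x x≢0 m *ᶜ zpow y y≢0 n) S₃ ×
        Sums (λ ((m , n) : ℤ × ℤ) →
          q τ (quad α β (fromℤ m + ½) (fromℤ n)) *ᶜ (zpow x x≢0 m *ᶜ √x) *ᶜ zpow y y≢0 n) S₄ ×
        S₁ ^ 2 +ᶜ S₂ ^ 2 ≈ᶜ S₃ ^ 2 +ᶜ S₄ ^ 2
      theta-identity =
        (A₁ *ᶜ B₀ +ᶜ -ᶜ (A₀ *ᶜ B₁)) , (A₀ *ᶜ B₀ +ᶜ A₁ *ᶜ B₁) ,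
        (A₀ *ᶜ B₀ +ᶜ -ᶜ (A₁ *ᶜ B₁)) , (A₁ *ᶜ B₀ +ᶜ A₀ *ᶜ B₁) ,
        Sums-unshear (+ 1) (Sums-cong (λ (j , k) → signed-even k) even½)
                           (Sums-cong (λ (j , k) → signed-odd k) (negate odd½)) ,
        Sums-unshear (+ 0) even₀ odd₀ ,
        Sums-unshear (+ 0) (Sums-cong (λ (j , k) → signed-even k) even₀)
                           (Sums-cong (λ (j , k) → signed-odd k) (negate odd₀)) ,
        Sums-unshear (+ 1) even½ odd½ ,
        ℂ-Identities.four-squares A₀ A₁ B₀ B₁

  -- Unfolding qpow exposes convergence proofs that are too large to be compared.
  -- The lemmas below, up to limit≃, therefore match the unfolded terms with a
  -- separate variable for each occurrence of such a proof.  Their conclusions are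
  -- datatypes so that they are unified with the goal before the arguments.
  infix 4 _≃_
  data _≃_ (u v : Carrier) : Set ℓ₁ where
    equal : u ≈ v → u ≃ v

  ≃⇒≈ : ∀ {u v} → u ≃ v → u ≈ v
  ≃⇒≈ (equal e) = e

  ≃-refl : ∀ {u} → u ≃ u
  ≃-refl = equal ≈-refl

  limit-unique : ∀ {u v l m} → (∀ n → u n ≈ v n) → Converges u l → Converges v m → l ≈ m
  limit-unique {u} {v} {l} {m} u≈v u→l v→m =
    ≈-by-bounds (≤-by-approximation bound₁) (≤-by-approximation bound₂)
    where
    near : ∀ ε → 0# < ε → ∃[ n ] Bounded (half ε) (u n - l) × Bounded (half ε) (u n - m)
    near ε 0<ε =
      let M , u-near = Converges-within u→l (half ε) (0<half 0<ε)
          N , v-near = Converges-within v→m (half ε) (0<half 0<ε)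
          n = M ℕ.+ N
      in n , u-near n (ℕₚ.m≤m+n M N) , Bounded-resp (+-congʳ (≈-sym (u≈v n))) (v-near n (ℕₚ.m≤n+m N M))
    chain : ∀ {x l m} ε → Bounded (half ε) (x - l) → Bounded (half ε) (x - m) → l ≤ m + ε
    chain ε B B′ = ≤-trans (Bounded⇒≥ B) (≤-respʳ (≈-trans (+-assoc _ _ _) (+-congˡ (half+half ε)))
      (+-monoˡ-≤ (half ε) (Bounded⇒≤ B′)))
    bound₁ : ∀ ε → 0# < ε → l ≤ m + ε
    bound₁ ε 0<ε = let _ , B , B′ = near ε 0<ε in chain ε B B′
    bound₂ : ∀ ε → 0# < ε → m ≤ l + ε
    bound₂ ε 0<ε = let _ , B , B′ = near ε 0<ε in chain ε B′ B

  partialSum-cong : ∀ {t u} → (∀ k → t k ≈ u k) → ∀ n → partialSum t n ≈ partialSum u n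
  partialSum-cong t≈u zero    = ≈-refl
  partialSum-cong t≈u (suc n) = +-cong (partialSum-cong t≈u n) (t≈u n)

  π≃ϖ : ∀ {h h′} →
    proj₁ (complete (partialSum eulerTerm) h) + proj₁ (complete (partialSum eulerTerm) h′) ≃ ϖ
  π≃ϖ {h} {h′} = equal (+-cong (to-euler-sum h) (to-euler-sum h′))
    where
    to-euler-sum : ∀ h → proj₁ (complete (partialSum eulerTerm) h) ≈ proj₁ euler-sum
    to-euler-sum h = limit-unique (λ _ → ≈-refl)
      (proj₂ (complete (partialSum eulerTerm) h)) (proj₂ euler-sum)

  re-expTerm≃ : ∀ {p r s τ k} → p ≃ ϖ → r ≃ s →
    re (expTerm ((p +i 0#) *ᶜ 𝕚 *ᶜ (r +i 0#) *ᶜ τ) k) ≃ re (expTerm (exponent τ s) k)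
  re-expTerm≃ {τ = τ} {k} (equal p≈ϖ) (equal r≈s) = equal (proj₁ (expTerm-cong
    (ℂᴿ.*-congʳ {τ} (ℂᴿ.*-cong (ℂᴿ.*-congʳ {𝕚} (fromℝ-cong p≈ϖ)) (fromℝ-cong r≈s))) k))

  im-expTerm≃ : ∀ {p r s τ k} → p ≃ ϖ → r ≃ s →
    im (expTerm ((p +i 0#) *ᶜ 𝕚 *ᶜ (r +i 0#) *ᶜ τ) k) ≃ im (expTerm (exponent τ s) k)
  im-expTerm≃ {τ = τ} {k} (equal p≈ϖ) (equal r≈s) = equal (proj₂ (expTerm-cong
    (ℂᴿ.*-congʳ {τ} (ℂᴿ.*-cong (ℂᴿ.*-congʳ {𝕚} (fromℝ-cong p≈ϖ)) (fromℝ-cong r≈s))) k))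

  private
    module _ (p r : Carrier) (τ : ℂ) where
      reExp imExp : ℕ → Carrier
      reExp = partialSum (λ k → re (expTerm ((p +i 0#) *ᶜ 𝕚 *ᶜ (r +i 0#) *ᶜ τ) k))
      imExp = partialSum (λ k → im (expTerm ((p +i 0#) *ᶜ 𝕚 *ᶜ (r +i 0#) *ᶜ τ) k))

    module _ {p r : Carrier} {τ : ℂ} (p≃ϖ : p ≃ ϖ) where
      re-q : ∀ h → proj₁ (complete (reExp p r τ) h) ≈ re (q τ r)
      re-q h = limit-unique (partialSum-cong (λ k → ≃⇒≈ (re-expTerm≃ {k = k} p≃ϖ ≃-refl)))
        (proj₂ (complete (reExp p r τ) h)) (re-converges (q-sums τ r))

      im-q : ∀ h → proj₁ (complete (imExp p r τ) h) ≈ im (q τ r)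
      im-q h = limit-unique (partialSum-cong (λ k → ≃⇒≈ (im-expTerm≃ {k = k} p≃ϖ ≃-refl)))
        (proj₂ (complete (imExp p r τ) h)) (im-converges (q-sums τ r))

    -- The coordinates of σ (a + b i), taken apart so that each occurrence of a and b can be a limit
    -- with its own convergence proof.
    reσ imσ : ℂ → Carrier → Carrier → Carrier
    reσ σ a b = re σ * a - im σ * b
    imσ σ a b = re σ * b + im σ * a

    reσ-cong : ∀ σ {a a′ b b′} → a ≈ a′ → b ≈ b′ → reσ σ a b ≈ reσ σ a′ b′
    reσ-cong σ e f = +-cong (*-congˡ e) (-‿cong (*-congˡ f))

    imσ-cong : ∀ σ {a a′ b b′} → a ≈ a′ → b ≈ b′ → imσ σ a b ≈ imσ σ a′ b′
    imσ-cong σ e f = +-cong (*-congˡ f) (*-congˡ e)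

    -- A coordinate of the unfolded triple product (a + b i)(v + w i) t contains a and b twice each,
    -- hence the two copies of each.
    product-cong : ∀ {a₁ a₂ b₁ b₂ a b} v w → a₁ ≈ a → b₁ ≈ b → a₂ ≈ a → b₂ ≈ b → ∀ t₁ t₂ →
      (a₁ * v - b₁ * w) * t₁ + (a₂ * w + b₂ * v) * t₂ ≈ (a * v - b * w) * t₁ + (a * w + b * v) * t₂
    product-cong v w e₁ f₁ e₂ f₂ t₁ t₂ = +-cong
      (*-congʳ (+-cong (*-congʳ e₁) (-‿cong (*-congʳ f₁)))) (*-congʳ (+-cong (*-congʳ e₂) (*-congʳ f₂)))

    product-cong₋ : ∀ {a₁ a₂ b₁ b₂ a b} v w → a₁ ≈ a → b₁ ≈ b → a₂ ≈ a → b₂ ≈ b → ∀ t₁ t₂ →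
      (a₁ * v - b₁ * w) * t₁ - (a₂ * w + b₂ * v) * t₂ ≈ (a * v - b * w) * t₁ - (a * w + b * v) * t₂
    product-cong₋ v w e₁ f₁ e₂ f₂ t₁ t₂ = +-cong
      (*-congʳ (+-cong (*-congʳ e₁) (-‿cong (*-congʳ f₁))))
      (-‿cong (*-congʳ (+-cong (*-congʳ e₂) (*-congʳ f₂))))

  module _ {p r : Carrier} {τ : ℂ} {u y : ℂ} (e : p ≃ ϖ) where
    private
      C : Cauchy (reExp p r τ) → Carrier
      C h = proj₁ (complete (reExp p r τ) h)

      D : Cauchy (imExp p r τ) → Carrier
      D h = proj₁ (complete (imExp p r τ) h)

    re-unsigned≃ : ∀ {h₁ h₂ h₃ h₄} →
      (C h₁ * re u - D h₂ * im u) * re y - (C h₃ * im u + D h₄ * re u) * im y ≃ re (q τ r *ᶜ u *ᶜ y)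
    re-unsigned≃ {h₁} {h₂} {h₃} {h₄} = equal (product-cong₋ _ _
      (re-q e h₁) (im-q e h₂) (re-q e h₃) (im-q e h₄) _ _)

    im-unsigned≃ : ∀ {h₁ h₂ h₃ h₄} →
      (C h₁ * re u - D h₂ * im u) * im y + (C h₃ * im u + D h₄ * re u) * re y ≃ im (q τ r *ᶜ u *ᶜ y)
    im-unsigned≃ {h₁} {h₂} {h₃} {h₄} = equal (product-cong _ _
      (re-q e h₁) (im-q e h₂) (re-q e h₃) (im-q e h₄) _ _)

    re-signed≃ : ∀ {σ h₁ h₂ h₃ h₄ h₅ h₆ h₇ h₈} →
      (reσ σ (C h₁) (D h₂) * re u - imσ σ (C h₃) (D h₄) * im u) * re y -
      (reσ σ (C h₅) (D h₆) * im u + imσ σ (C h₇) (D h₈) * re u) * im y ≃ re (σ *ᶜ q τ r *ᶜ u *ᶜ y)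
    re-signed≃ {σ} {h₁} {h₂} {h₃} {h₄} {h₅} {h₆} {h₇} {h₈} = equal (product-cong₋ _ _
      (reσ-cong σ (re-q e h₁) (im-q e h₂)) (imσ-cong σ (re-q e h₃) (im-q e h₄))
      (reσ-cong σ (re-q e h₅) (im-q e h₆)) (imσ-cong σ (re-q e h₇) (im-q e h₈)) _ _)

    im-signed≃ : ∀ {σ h₁ h₂ h₃ h₄ h₅ h₆ h₇ h₈} →
      (reσ σ (C h₁) (D h₂) * re u - imσ σ (C h₃) (D h₄) * im u) * im y +
      (reσ σ (C h₅) (D h₆) * im u + imσ σ (C h₇) (D h₈) * re u) * re y ≃ im (σ *ᶜ q τ r *ᶜ u *ᶜ y)
    im-signed≃ {σ} {h₁} {h₂} {h₃} {h₄} {h₅} {h₆} {h₇} {h₈} = equal (product-cong _ _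
      (reσ-cong σ (re-q e h₁) (im-q e h₂)) (imσ-cong σ (re-q e h₃) (im-q e h₄))
      (reσ-cong σ (re-q e h₅) (im-q e h₆)) (imσ-cong σ (re-q e h₇) (im-q e h₈)) _ _)

  -- A squared modulus mentions the real part of the finite sum twice and the imaginary part twice;
  -- f₁ to f₄ are these four copies of the family, all matching g.
  limit≃ : ∀ {I : Set} {f₁ f₂ f₃ f₄ g : I → ℂ} {s ε} → Sums g s →
    (∀ i → re (f₁ i) ≃ re (g i)) → (∀ i → re (f₂ i) ≃ re (g i)) →
    (∀ i → im (f₃ i) ≃ im (g i)) → (∀ i → im (f₄ i) ≃ im (g i)) → 0# < ε →
    Σ (List I) λ F₀ → ∀ F → Unique F → F₀ ⊆ F →
      (re (Σᶜ f₁ F) - re s) * (re (Σᶜ f₂ F) - re s) + (im (Σᶜ f₃ F) - im s) * (im (Σᶜ f₄ F) - im s) < ε * ε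
  limit≃ {I} {f₁} {f₂} {f₃} {f₄} {g} {s} {ε} S e₁ e₂ e₃ e₄ 0<ε = proj₁ summed , λ F F! F₀⊆F →
    <-respˡ (+-cong (*-cong (+-congʳ (re-sum e₁ F)) (+-congʳ (re-sum e₂ F)))
                    (*-cong (+-congʳ (im-sum e₃ F)) (+-congʳ (im-sum e₄ F))))
      (proj₂ summed F F! F₀⊆F)
    where
    summed = Sums⇒HasSum S ε 0<ε
    re-sum : ∀ {f : I → ℂ} → (∀ i → re (f i) ≃ re (g i)) → ∀ F → re (Σᶜ g F) ≈ re (Σᶜ f F)
    re-sum {f} e F = ≈-trans (re-Σᶜ g F) (≈-trans (∑-cong (λ i → ≈-sym (≃⇒≈ (e i))) F) (≈-sym (re-Σᶜ f F)))
    im-sum : ∀ {f : I → ℂ} → (∀ i → im (f i) ≃ im (g i)) → ∀ F → im (Σᶜ g F) ≈ im (Σᶜ f F)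
    im-sum {f} e F = ≈-trans (im-Σᶜ g F) (≈-trans (∑-cong (λ i → ≈-sym (≃⇒≈ (e i))) F) (≈-sym (im-Σᶜ f F)))

corollary5p2 :
  ∀ {c ℓ₁ ℓ₂} (R : RealField c ℓ₁ ℓ₂) →
  let
    open Real R
  in
  (α β : ℤ) → + 0 <ᶻ α → α <ᶻ + 4 *ᶻ β →
  (τ : ℂ) → 0# < im τ →
  (x y √x : ℂ) (x≢0 : NonZero x) (y≢0 : NonZero y) → √x *ᶜ √x ≈ᶜ x →
  let
    q^_ = qpow τ
    x^_ = zpow x x≢0
    y^_ = zpow y y≢0
    Q   = quad α β
  in
  ∃[ S₁ ] ∃[ S₂ ] ∃[ S₃ ] ∃[ S₄ ]
    HasSum (λ ((m , n) : ℤ × ℤ) →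
      sgn n *ᶜ q^ (Q (fromℤ m + ½) (fromℤ n)) *ᶜ (x^ m *ᶜ √x) *ᶜ y^ n) S₁ ×
    HasSum (λ ((m , n) : ℤ × ℤ) →
      q^ (Q (fromℤ m) (fromℤ n)) *ᶜ x^ m *ᶜ y^ n) S₂ ×
    HasSum (λ ((m , n) : ℤ × ℤ) →
      sgn n *ᶜ q^ (Q (fromℤ m) (fromℤ n)) *ᶜ x^ m *ᶜ y^ n) S₃ ×
    HasSum (λ ((m , n) : ℤ × ℤ) →
      q^ (Q (fromℤ m + ½) (fromℤ n)) *ᶜ (x^ m *ᶜ √x) *ᶜ y^ n) S₄ ×
    S₁ ^ 2 +ᶜ S₂ ^ 2 ≈ᶜ S₃ ^ 2 +ᶜ S₄ ^ 2
corollary5p2 R α β 0<α α<4β τ 0<τ x y √x x≢0 y≢0 √x²≈x =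
  let S₁ , S₂ , S₃ , S₄ , h₁ , h₂ , h₃ , h₄ , identity =
        theta-identity R {α} {β} 0<α α<4β τ 0<τ x y √x x≢0 y≢0 √x²≈x
  in S₁ , S₂ , S₃ , S₄ ,
    -- Once ε is introduced, `HasSum` is a statement about the unfolded squared modulus, whose four
    -- copies of the summand are matched one by one.
    (λ ε 0<ε → limit≃ R h₁
      (λ _ → re-signed≃ R (π≃ϖ R)) (λ _ → re-signed≃ R (π≃ϖ R))
      (λ _ → im-signed≃ R (π≃ϖ R)) (λ _ → im-signed≃ R (π≃ϖ R)) 0<ε) ,
    (λ ε 0<ε → limit≃ R h₂
      (λ _ → re-unsigned≃ R (π≃ϖ R)) (λ _ → re-unsigned≃ R (π≃ϖ R))
      (λ _ → im-unsigned≃ R (π≃ϖ R)) (λ _ → im-unsigned≃ R (π≃ϖ R)) 0<ε) ,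
    (λ ε 0<ε → limit≃ R h₃
      (λ _ → re-signed≃ R (π≃ϖ R)) (λ _ → re-signed≃ R (π≃ϖ R))
      (λ _ → im-signed≃ R (π≃ϖ R)) (λ _ → im-signed≃ R (π≃ϖ R)) 0<ε) ,
    (λ ε 0<ε → limit≃ R h₄
      (λ _ → re-unsigned≃ R (π≃ϖ R)) (λ _ → re-unsigned≃ R (π≃ϖ R))
      (λ _ → im-unsigned≃ R (π≃ϖ R)) (λ _ → im-unsigned≃ R (π≃ϖ R)) 0<ε) ,
    identity
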